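{- Any quantum algorithm that, with probability at least $\frac{2}{3}$, outputs the LZ77 factorization of every input text $T[1..n]$ in the class of texts with $z=\Theta(1)$ (respectively, with $z=\Theta(n)$) LZ77 factors requires $\Omega(\sqrt{zn})$ input queries. Likewise, any quantum algorithm that, with probability at least $\frac{2}{3}$, outputs the run-length encoded BWT of every input text in the class of texts with $r=\Theta(1)$ (respectively, $r=\Theta(n)$) BWT runs requires $\Omega(\sqrt{rn})$ input queries.
   Context: Model: the text $T[1..n]$ over an integer alphabet is accessible only through a quantum oracle which on query $i$ returns $T[i]$; the query complexity is the number of oracle calls. LZ77 factorization (greedy): start with $i=1$; while $i\le n$: if $T[i]$ is the first occurrence of its symbol, $T[i]$ is the next factor and $i\gets i+1$; otherwise take the largest $j\ge i$ such that $T[i..j]$ occurs in $T$ starting at some position $i'<i$, make $T[i..j]$ the next factor and set $i\gets j+1$. $z$ is the number of factors. BWT: with $\mathrm{SA}$ the suffix array of $T$ (so $T[\mathrm{SA}[i]..n]$ is the $i$-th smallest suffix lexicographically), $\mathrm{BWT}[i]=T[\mathrm{SA}[i]-1]$ (with $T[0]=T[n]$), equivalently the last column of the matrix of lexicographically sorted cyclic rotations of $T$. $r$ is the number of maximal runs of equal symbols in $\mathrm{BWT}$; the run-length encoded BWT lists these runs as (symbol, length) pairs. -}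

module Defs where

open import Data.Bool using (if_then_else_)
open import Data.Fin as Fin using (Fin; zero; suc; toℕ; fromℕ; inject₁)
import Data.Fin.Properties as Fin
open import Data.Integer using (+_)
open import Data.List as List using (List; []; _∷_; length; take; drop; foldr; allFin)
import Data.List.Properties as List
import Data.List.Relation.Binary.Lex.NonStrict as Lex
import Data.List.Sort as Sort
open import Data.Nat as ℕ using (ℕ; zero; suc; NonZero)
open import Data.Nat.DivMod using (_mod_)
import Data.Nat.Properties as ℕ
open import Data.Product using (Σ-syntax; ∃-syntax; _×_; _,_; proj₁)
import Data.Product.Properties as Product
open import Data.Rational as ℚ using (ℚ; 0ℚ; 1ℚ; ½; ∣_∣)
import Data.Rational.Properties as ℚ
open import Data.Rational.Solver using (module +-*-Solver)
open import Data.Vec as Vec using (Vec; lookup; toList)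
import Data.Vec.Functional as Functional
open import Level using (0ℓ)
open import Relation.Binary using (DecidableEquality; DecTotalOrder)
import Relation.Binary.Construct.On as On
open import Relation.Binary.PropositionalEquality
  using (_≡_; refl; sym; trans; cong; cong₂; subst)
open import Relation.Nullary using (¬_; does)

open +-*-Solver using (solve; _:+_; _:*_; _:-_; :-_; _:=_)

-- Reals are Cauchy sequences of rationals with a modulus of convergence,
-- compared by _≈ℝ_ rather than _≡_.

IsCauchy : (ℕ → ℚ) → Set
IsCauchy x = ∀ ε → 0ℚ ℚ.< ε →
  ∃[ N ] (∀ m n → N ℕ.≤ m → N ℕ.≤ n → ∣ x m ℚ.- x n ∣ ℚ.≤ ε)

record ℝ : Set where
  constructor mkℝ
  field
    approx : ℕ → ℚ
    cauchy : IsCauchy approx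

open ℝ public

infix 4 _≈ℝ_ _≤ℝ_

_≈ℝ_ : ℝ → ℝ → Set
x ≈ℝ y = ∀ ε → 0ℚ ℚ.< ε →
  ∃[ N ] (∀ n → N ℕ.≤ n → ∣ approx x n ℚ.- approx y n ∣ ℚ.≤ ε)

_≤ℝ_ : ℝ → ℝ → Set
x ≤ℝ y = ∀ ε → 0ℚ ℚ.< ε →
  ∃[ N ] (∀ n → N ℕ.≤ n → approx x n ℚ.≤ approx y n ℚ.+ ε)

private
  abstract
    +-interchange : ∀ a b c d → (a ℚ.+ b) ℚ.- (c ℚ.+ d) ≡ (a ℚ.- c) ℚ.+ (b ℚ.- d)
    +-interchange = solve 4 (λ a b c d → (a :+ b) :- (c :+ d) := (a :- c) :+ (b :- d)) refl

    *-difference : ∀ a b c d → a ℚ.* b ℚ.- c ℚ.* d ≡ a ℚ.* (b ℚ.- d) ℚ.+ d ℚ.* (a ℚ.- c)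
    *-difference = solve 4 (λ a b c d → a :* b :- c :* d := a :* (b :- d) :+ d :* (a :- c)) refl

    neg-difference : ∀ a b → ℚ.- (a ℚ.- b) ≡ ℚ.- a ℚ.- (ℚ.- b)
    neg-difference = solve 2 (λ a b → :- (a :- b) := :- a :- :- b) refl

    sub-add : ∀ a b → a ≡ (a ℚ.- b) ℚ.+ b
    sub-add = solve 2 (λ a b → a := (a :- b) :+ b) refl

    half-pos : ∀ {ε} → 0ℚ ℚ.< ε → 0ℚ ℚ.< ½ ℚ.* ε
    half-pos {ε} 0<ε =
      subst (ℚ._< ½ ℚ.* ε) (ℚ.*-zeroʳ ½) (ℚ.*-monoʳ-<-pos ½ 0<ε)

    half+half : ∀ ε → ½ ℚ.* ε ℚ.+ ½ ℚ.* ε ≡ ε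
    half+half ε = trans (sym (ℚ.*-distribʳ-+ ε ½ ½)) (ℚ.*-identityˡ ε)

    +-cauchy : ∀ x y → IsCauchy x → IsCauchy y → IsCauchy (λ n → x n ℚ.+ y n)
    +-cauchy x y cx cy ε 0<ε with cx (½ ℚ.* ε) (half-pos 0<ε) | cy (½ ℚ.* ε) (half-pos 0<ε)
    ... | N , hx | M , hy = N ℕ.⊔ M , λ m n p q → begin
      ∣ (x m ℚ.+ y m) ℚ.- (x n ℚ.+ y n) ∣
        ≡⟨ cong ∣_∣ (+-interchange (x m) (y m) (x n) (y n)) ⟩
      ∣ (x m ℚ.- x n) ℚ.+ (y m ℚ.- y n) ∣
        ≤⟨ ℚ.∣p+q∣≤∣p∣+∣q∣ (x m ℚ.- x n) (y m ℚ.- y n) ⟩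
      ∣ x m ℚ.- x n ∣ ℚ.+ ∣ y m ℚ.- y n ∣
        ≤⟨ ℚ.+-mono-≤ (hx m n (ℕ.m⊔n≤o⇒m≤o N M p) (ℕ.m⊔n≤o⇒m≤o N M q))
                      (hy m n (ℕ.m⊔n≤o⇒n≤o N M p) (ℕ.m⊔n≤o⇒n≤o N M q)) ⟩
      ½ ℚ.* ε ℚ.+ ½ ℚ.* ε
        ≡⟨ half+half ε ⟩
      ε ∎
      where open ℚ.≤-Reasoning

    neg-cauchy : ∀ x → IsCauchy x → IsCauchy (λ n → ℚ.- x n)
    neg-cauchy x cx ε 0<ε with cx ε 0<ε
    ... | N , hx = N , λ m n p q →
      subst (ℚ._≤ ε)
        (trans (sym (ℚ.∣-p∣≡∣p∣ (x m ℚ.- x n)))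
               (cong ∣_∣ (neg-difference (x m) (x n))))
        (hx m n p q)

    const-cauchy : ∀ p → IsCauchy (λ _ → p)
    const-cauchy p ε 0<ε = 0 , λ _ _ _ _ →
      subst (ℚ._≤ ε) (sym (cong ∣_∣ (ℚ.+-inverseʳ p))) (ℚ.<⇒≤ 0<ε)

    0<1 : 0ℚ ℚ.< 1ℚ
    0<1 = ℚ.positive⁻¹ 1ℚ

    eventually-bounded : ∀ {x} → IsCauchy x →
      ∃[ B ] 0ℚ ℚ.< B × ∃[ N ] (∀ n → N ℕ.≤ n → ∣ x n ∣ ℚ.≤ B)
    eventually-bounded {x} cx with cx 1ℚ 0<1
    ... | N , hx = 1ℚ ℚ.+ ∣ x N ∣ , ℚ.+-mono-<-≤ 0<1 (ℚ.0≤∣p∣ (x N)) , N , λ n p → begin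
      ∣ x n ∣
        ≡⟨ cong ∣_∣ (sub-add (x n) (x N)) ⟩
      ∣ (x n ℚ.- x N) ℚ.+ x N ∣
        ≤⟨ ℚ.∣p+q∣≤∣p∣+∣q∣ (x n ℚ.- x N) (x N) ⟩
      ∣ x n ℚ.- x N ∣ ℚ.+ ∣ x N ∣
        ≤⟨ ℚ.+-monoˡ-≤ ∣ x N ∣ (hx n N p ℕ.≤-refl) ⟩
      1ℚ ℚ.+ ∣ x N ∣ ∎
      where open ℚ.≤-Reasoning

    shrink : ∀ {B ε} → 0ℚ ℚ.< B → 0ℚ ℚ.< ε → ∃[ δ ] 0ℚ ℚ.< δ × B ℚ.* δ ≡ ε
    shrink {B} {ε} 0<B 0<ε = δ , 0<δ , Bδ≡ε
      where
      instance
        posB : ℚ.Positive B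
        posB = ℚ.positive 0<B
        nzB : ℚ.NonZero B
        nzB = ℚ.pos⇒nonZero B
        posB⁻¹ : ℚ.Positive (ℚ.1/ B)
        posB⁻¹ = ℚ.1/pos⇒pos B
      δ : ℚ
      δ = (ℚ.1/ B) ℚ.* ε
      0<δ : 0ℚ ℚ.< δ
      0<δ = subst (ℚ._< δ) (ℚ.*-zeroʳ (ℚ.1/ B)) (ℚ.*-monoʳ-<-pos (ℚ.1/ B) 0<ε)
      Bδ≡ε : B ℚ.* δ ≡ ε
      Bδ≡ε = trans (sym (ℚ.*-assoc B (ℚ.1/ B) ε))
               (trans (cong (ℚ._* ε) (ℚ.*-inverseʳ B)) (ℚ.*-identityˡ ε))

    *-mono-abs : ∀ {B δ} p q → 0ℚ ℚ.< B → ∣ p ∣ ℚ.≤ B → ∣ q ∣ ℚ.≤ δ → ∣ p ℚ.* q ∣ ℚ.≤ B ℚ.* δ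
    *-mono-abs {B} {δ} p q 0<B p≤B q≤δ = begin
      ∣ p ℚ.* q ∣       ≡⟨ ℚ.∣p*q∣≡∣p∣*∣q∣ p q ⟩
      ∣ p ∣ ℚ.* ∣ q ∣   ≤⟨ ℚ.*-monoʳ-≤-nonNeg ∣ q ∣ {{ℚ.∣-∣-nonNeg q}} p≤B ⟩
      B ℚ.* ∣ q ∣       ≤⟨ ℚ.*-monoˡ-≤-nonNeg B {{ℚ.nonNegative (ℚ.<⇒≤ 0<B)}} q≤δ ⟩
      B ℚ.* δ           ∎
      where open ℚ.≤-Reasoning

    *-estimate : ∀ {B β C γ ε} a b c d → 0ℚ ℚ.< B → 0ℚ ℚ.< C →
      B ℚ.* β ≡ ½ ℚ.* ε → C ℚ.* γ ≡ ½ ℚ.* ε →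
      ∣ a ∣ ℚ.≤ B → ∣ b ℚ.- d ∣ ℚ.≤ β → ∣ d ∣ ℚ.≤ C → ∣ a ℚ.- c ∣ ℚ.≤ γ →
      ∣ a ℚ.* b ℚ.- c ℚ.* d ∣ ℚ.≤ ε
    *-estimate {B} {β} {C} {γ} {ε} a b c d 0<B 0<C Bβ Cγ ha hbd hd hac = begin
      ∣ a ℚ.* b ℚ.- c ℚ.* d ∣
        ≡⟨ cong ∣_∣ (*-difference a b c d) ⟩
      ∣ a ℚ.* (b ℚ.- d) ℚ.+ d ℚ.* (a ℚ.- c) ∣
        ≤⟨ ℚ.∣p+q∣≤∣p∣+∣q∣ (a ℚ.* (b ℚ.- d)) (d ℚ.* (a ℚ.- c)) ⟩
      ∣ a ℚ.* (b ℚ.- d) ∣ ℚ.+ ∣ d ℚ.* (a ℚ.- c) ∣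
        ≤⟨ ℚ.+-mono-≤ (*-mono-abs a (b ℚ.- d) 0<B ha hbd) (*-mono-abs d (a ℚ.- c) 0<C hd hac) ⟩
      B ℚ.* β ℚ.+ C ℚ.* γ
        ≡⟨ trans (cong₂ ℚ._+_ Bβ Cγ) (half+half ε) ⟩
      ε ∎
      where open ℚ.≤-Reasoning

    *-cauchy : ∀ x y → IsCauchy x → IsCauchy y → IsCauchy (λ n → x n ℚ.* y n)
    *-cauchy x y cx cy ε 0<ε =
      let B , 0<B , K , hB = eventually-bounded {x} cx
          C , 0<C , L , hC = eventually-bounded {y} cy
          β , 0<β , Bβ = shrink 0<B (half-pos 0<ε)
          γ , 0<γ , Cγ = shrink 0<C (half-pos 0<ε)
          M , hβ = cy β 0<β
          N , hγ = cx γ 0<γ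
      in (K ℕ.⊔ L) ℕ.⊔ (M ℕ.⊔ N) , λ m n p q →
      let KL≤m = ℕ.m⊔n≤o⇒m≤o (K ℕ.⊔ L) (M ℕ.⊔ N) p
          KL≤n = ℕ.m⊔n≤o⇒m≤o (K ℕ.⊔ L) (M ℕ.⊔ N) q
          MN≤m = ℕ.m⊔n≤o⇒n≤o (K ℕ.⊔ L) (M ℕ.⊔ N) p
          MN≤n = ℕ.m⊔n≤o⇒n≤o (K ℕ.⊔ L) (M ℕ.⊔ N) q
      in *-estimate (x m) (y m) (x n) (y n) 0<B 0<C Bβ Cγ
           (hB m (ℕ.m⊔n≤o⇒m≤o K L KL≤m))
           (hβ m n (ℕ.m⊔n≤o⇒m≤o M N MN≤m) (ℕ.m⊔n≤o⇒m≤o M N MN≤n))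
           (hC n (ℕ.m⊔n≤o⇒n≤o K L KL≤n))
           (hγ m n (ℕ.m⊔n≤o⇒n≤o M N MN≤m) (ℕ.m⊔n≤o⇒n≤o M N MN≤n))

infixl 6 _+ℝ_ _-ℝ_
infixl 7 _*ℝ_
infix  8 -ℝ_

fromℚ : ℚ → ℝ
fromℚ p = mkℝ (λ _ → p) (const-cauchy p)

0ℝ 1ℝ : ℝ
0ℝ = fromℚ 0ℚ
1ℝ = fromℚ 1ℚ

-ℝ_ : ℝ → ℝ
-ℝ x = mkℝ (λ n → ℚ.- approx x n) (neg-cauchy (approx x) (cauchy x))

_+ℝ_ _-ℝ_ _*ℝ_ : ℝ → ℝ → ℝ
x +ℝ y = mkℝ (λ n → approx x n ℚ.+ approx y n) (+-cauchy (approx x) (approx y) (cauchy x) (cauchy y))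
x *ℝ y = mkℝ (λ n → approx x n ℚ.* approx y n) (*-cauchy (approx x) (approx y) (cauchy x) (cauchy y))
x -ℝ y = x +ℝ (-ℝ y)

record ℂ : Set where
  constructor _+i_
  field
    re im : ℝ

open ℂ public

infix  4 _≈ℂ_
infixl 6 _+ℂ_
infixl 7 _*ℂ_

_≈ℂ_ : ℂ → ℂ → Set
u ≈ℂ v = re u ≈ℝ re v × im u ≈ℝ im v

0ℂ 1ℂ : ℂ
0ℂ = 0ℝ +i 0ℝ
1ℂ = 1ℝ +i 0ℝ

_+ℂ_ _*ℂ_ : ℂ → ℂ → ℂ
u +ℂ v = (re u +ℝ re v) +i (im u +ℝ im v)
u *ℂ v = (re u *ℝ re v -ℝ im u *ℝ im v) +i (re u *ℝ im v +ℝ im u *ℝ re v)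

conj : ℂ → ℂ
conj u = re u +i (-ℝ im u)

∣_∣² : ℂ → ℝ
∣ u ∣² = re u *ℝ re u +ℝ im u *ℝ im u

-- The integer alphabet is {0, …, σ-1}, and positions start at 0.

Text : ℕ → ℕ → Set
Text σ n = Vec (Fin σ) n

-- |i, b, k⟩: query position, answer register, workspace of dimension w.
Basis : (n σ w : ℕ) → Set
Basis n σ w = Fin n × Fin σ × Fin w

module Quantum {n σ w : ℕ} where

  _≟ᴮ_ : DecidableEquality (Basis n σ w)
  _≟ᴮ_ = Product.≡-dec Fin._≟_ (Product.≡-dec Fin._≟_ Fin._≟_)

  sumᴮ : {A : Set} → (A → A → A) → A → (Basis n σ w → A) → A
  sumᴮ {A} _⊕_ ε f =
    ∑ λ i → ∑ λ b → ∑ λ k → f (i , b , k)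
    where
    ∑ : {m : ℕ} → (Fin m → A) → A
    ∑ = Functional.foldr _⊕_ ε

  ∑ℝ : (Basis n σ w → ℝ) → ℝ
  ∑ℝ = sumᴮ _+ℝ_ 0ℝ

  ∑ℂ : (Basis n σ w → ℂ) → ℂ
  ∑ℂ = sumᴮ _+ℂ_ 0ℂ

  State : Set
  State = Basis n σ w → ℂ

  -- U s t is the matrix entry ⟨s|U|t⟩.
  Operator : Set
  Operator = Basis n σ w → Basis n σ w → ℂ

  δ : Operator
  δ s t = if does (s ≟ᴮ t) then 1ℂ else 0ℂ

  apply : Operator → State → State
  apply U ψ s = ∑ℂ λ t → U s t *ℂ ψ t

  record IsUnitary (U : Operator) : Set where
    field
      U†U≈1 : ∀ s t → ∑ℂ (λ k → conj (U k s) *ℂ U k t) ≈ℂ δ s t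
      UU†≈1 : ∀ s t → ∑ℂ (λ k → U s k *ℂ conj (U t k)) ≈ℂ δ s t

  Unitary : Set
  Unitary = Σ[ U ∈ Operator ] IsUnitary U

  ∣_⟩ : Basis n σ w → State
  ∣ t ⟩ s = δ s t

  -- |i, b, k⟩ ↦ |i, b + T[i] mod σ, k⟩
  query : Text σ n → Basis n σ w → Basis n σ w
  query T (i , b , k) = i , (toℕ b ℕ.+ toℕ (lookup T i)) mod σ , k
    where
    instance
      σ≢0 : NonZero σ
      σ≢0 = Fin.nonZeroIndex b

  oracle : Text σ n → Operator
  oracle T s t = δ s (query T t)

-- An algorithm making q queries to a text in Text σ n: input-independent
-- unitaries alternate with the oracle, then the whole system is measured
-- in the computational basis and the outcome is decoded by `output`.
-- Intermediate measurements are covered by deferring them.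
record QueryAlgorithm (σ n q : ℕ) (Out : Set) : Set where
  field
    w         : ℕ
    start     : Basis n σ w
    initial   : Quantum.Unitary {n} {σ} {w}
    unitaries : Vec (Quantum.Unitary {n} {σ} {w}) q
    output    : Basis n σ w → Out

  open Quantum {n} {σ} {w}

  finalState : Text σ n → State
  finalState T =
    Vec.foldl (λ _ → State) (λ ψ U → apply (proj₁ U) (apply (oracle T) ψ))
      (apply (proj₁ initial) ∣ start ⟩) unitaries

  probability : DecidableEquality Out → Text σ n → Out → ℝ
  probability _≟_ T o =
    ∑ℝ λ s → if does (output s ≟ o) then ∣ finalState T s ∣² else 0ℝ

module LZ77 {A : Set} (T : List A) where

  fragment : (i ℓ : ℕ) → List A
  fragment i ℓ = take ℓ (drop i T)

  -- Used only when i + ℓ ≤ length T, so that both fragments have length ℓ.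
  OccursBefore : (i ℓ : ℕ) → Set
  OccursBefore i ℓ = ∃[ i′ ] i′ ℕ.< i × fragment i′ ℓ ≡ fragment i ℓ

  data FactorsFrom : ℕ → List (List A) → Set where
    done  : FactorsFrom (length T) []
    fresh : ∀ {i fs} → i ℕ.< length T →
            ¬ OccursBefore i 1 →
            FactorsFrom (i ℕ.+ 1) fs →
            FactorsFrom i (fragment i 1 ∷ fs)
    copy  : ∀ {i ℓ fs} → 1 ℕ.≤ ℓ → i ℕ.+ ℓ ℕ.≤ length T →
            OccursBefore i ℓ →
            (∀ ℓ′ → ℓ ℕ.< ℓ′ → i ℕ.+ ℓ′ ℕ.≤ length T → ¬ OccursBefore i ℓ′) →
            FactorsFrom (i ℕ.+ ℓ) fs →
            FactorsFrom i (fragment i ℓ ∷ fs)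

IsLZ77Factorization : {A : Set} → List A → List (List A) → Set
IsLZ77Factorization T = LZ77.FactorsFrom T 0

-- The lexicographic order puts a proper prefix before its extensions.
suffixOrder : ∀ {σ n} → Text σ n → DecTotalOrder 0ℓ 0ℓ 0ℓ
suffixOrder {σ} {n} T =
  On.decTotalOrder (Lex.≤-decTotalOrder (Fin.≤-decTotalOrder σ))
    (λ (i : Fin n) → drop (toℕ i) (toList T))

suffixArray : ∀ {σ n} → Text σ n → List (Fin n)
suffixArray {n = n} T = Sort.sort (suffixOrder T) (allFin n)

cyclicPred : ∀ {n} → Fin n → Fin n
cyclicPred {suc n} zero    = fromℕ n
cyclicPred {suc n} (suc i) = inject₁ i

bwt : ∀ {σ n} → Text σ n → List (Fin σ)
bwt T = List.map (λ i → lookup T (cyclicPred i)) (suffixArray T)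

module _ {A : Set} (_≟_ : DecidableEquality A) where

  consRun : A → List (A × ℕ) → List (A × ℕ)
  consRun a []             = (a , 1) ∷ []
  consRun a ((b , k) ∷ rs) =
    if does (a ≟ b) then (b , suc k) ∷ rs else (a , 1) ∷ (b , k) ∷ rs

  runLengthEncode : List A → List (A × ℕ)
  runLengthEncode = foldr consRun []

rlbwt : ∀ {σ n} → Text σ n → List (Fin σ × ℕ)
rlbwt T = runLengthEncode Fin._≟_ (bwt T)

record CompressionProblem : Set₁ where
  field
    Output   : ℕ → Set
    _≟ᴼ_     : ∀ {σ} → DecidableEquality (Output σ)
    IsOutput : ∀ {σ n} → Text σ n → Output σ → Set
    size     : ∀ {σ} → Output σ → ℕ

LZ77Problem : CompressionProblem
LZ77Problem = record
  { Output   = λ σ → List (List (Fin σ))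
  ; _≟ᴼ_     = List.≡-dec (List.≡-dec Fin._≟_)
  ; IsOutput = λ T → IsLZ77Factorization (toList T)
  ; size     = length
  }

RLBWTProblem : CompressionProblem
RLBWTProblem = record
  { Output   = λ σ → List (Fin σ × ℕ)
  ; _≟ᴼ_     = List.≡-dec (Product.≡-dec Fin._≟_ ℕ._≟_)
  ; IsOutput = λ T o → rlbwt T ≡ o
  ; size     = length
  }

-- z = Θ(m) with hidden constants 1/a and b.
Θ[_,_] : (a b m z : ℕ) → Set
Θ[ a , b ] m z = m ℕ.≤ a ℕ.* z × z ℕ.≤ b ℕ.* m

module _ (P : CompressionProblem) where
  open CompressionProblem P

  Solves : ∀ {σ n q} → QueryAlgorithm σ n q (Output σ) → (ℕ → Set) → Set
  Solves {σ} {n} A InClass =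
    ∀ (T : Text σ n) (o : Output σ) → IsOutput T o → InClass (size o) →
    fromℚ (+ 2 ℚ./ 3) ≤ℝ QueryAlgorithm.probability A _≟ᴼ_ T o

  -- On the class of texts with size = Θ(f n), Ω(√(size · n)) queries are
  -- required.  Squaring √(z n) ≤ √D · q gives z n ≤ D q².  For too small
  -- hidden constants the class can be empty or a singleton, whence a₀ and
  -- b₀.  With one symbol there is only one text, and the number of LZ77
  -- factors is linear only over growing alphabets; {0, …, n-1} and every
  -- larger alphabet satisfy 2 ≤ σ and f n ≤ σ.
  RequiresΩ√ : (ℕ → ℕ) → Set
  RequiresΩ√ f =
    ∃[ a₀ ] ∃[ b₀ ] (∀ a b → a₀ ℕ.≤ a → b₀ ℕ.≤ b →
    ∃[ D ] ∃[ n₀ ] (∀ n σ q → n₀ ℕ.≤ n → 2 ℕ.≤ σ → f n ℕ.≤ σ →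
      (A : QueryAlgorithm σ n q (Output σ)) → Solves A (Θ[ a , b ] (f n)) →
      ∀ z → Θ[ a , b ] (f n) z → z ℕ.* n ℕ.≤ D ℕ.* (q ℕ.* q)))

{-# OPTIONS --safe #-}
module Submission where

-- The lower bounds come from the adversary method.  Write ψˣ for the state
-- of the algorithm on the text x, and let Wᵢ(x) be the total squared
-- amplitude with which it queries position i, so that ∑ᵢ Wᵢ(x) = q.  If x and
-- y differ only at position i, unitaries preserve Re ⟨ψˣ, ψʸ⟩, while a query
-- changes only the part of it at position i, which AM-GM bounds by the
-- queried amplitudes, with a free rational k in place of a square root.  The
-- overlap starts at 1 and must fall to at most 17/18 when x and y have
-- different outputs; hence k ≤ 18 (k² Wᵢ(x) + Wᵢ(y)) for every k > 0.
--
-- For size Θ(1), compare 0ⁿ with the n texts that have a single 1: summing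
-- over i and choosing k = 36 q gives n ≤ 1296 q².  For size Θ(n), let the
-- texts consist of m ≈ n/2 arbitrary bits followed by pairwise distinct fresh
-- symbols: summing over the edges of the cube {0,1}ᵐ with k = 1 gives
-- m ≤ 36 q.  The fresh symbols force n - m factors and n - m runs.
--
-- Neighbouring texts have different outputs, since they contain different
-- multisets of symbols and either output determines the multiset: the
-- factors concatenate to the text, and the BWT permutes it.

open import Defs
open import Algebra.Bundles using (CommutativeRing)
import Algebra.Properties.CommutativeSemigroup as CommutativeSemigroupProperties
import Algebra.Properties.Semiring.Mult as Mult
import Algebra.Properties.Semiring.Sum as Sum
open import Data.Bool using (Bool; true; false; not; if_then_else_)
open import Data.Empty using (⊥; ⊥-elim)
open import Data.Fin as Fin using (Fin; zero; suc; toℕ)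
open import Data.Fin.Permutation using (permutation)
import Data.Fin.Properties as Fin
open import Data.Integer using (+_)
open import Data.List as List
  using (List; []; _∷_; _++_; take; drop; length; concat; replicate; allFin)
open import Data.List.Membership.Propositional using (_∈_)
import Data.List.Properties as List
open import Data.List.Relation.Binary.Permutation.Propositional
  using (_↭_; ↭-refl; ↭-reflexive; ↭-sym; ↭-trans; prep; swap)
import Data.List.Relation.Binary.Permutation.Propositional.Properties as ↭
open import Data.List.Relation.Unary.Any as Any using (here; there)
import Data.List.Relation.Unary.Any.Properties as Any
import Data.List.Sort as Sort
open import Data.Nat as ℕ using (ℕ; zero; suc)
open import Data.Nat.DivMod
  using (_mod_; _%_; %-distribˡ-+; m%n%n≡m%n; [m+n]%n≡m%n; m<n⇒m%n≡m)
open import Data.Nat.ListAction using () renaming (sum to sumℕ)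
open import Data.Nat.ListAction.Properties using (sum-↭)
import Data.Nat.Properties as ℕ
open import Data.Nat.Solver using () renaming (module +-*-Solver to ℕ-Solver)
open import Data.Product using (∃-syntax; _×_; _,_; proj₁; proj₂)
open import Data.Rational as ℚ using (ℚ; 0ℚ; 1ℚ; ∣_∣)
import Data.Rational.Properties as ℚ
open import Data.Rational.Solver using (module +-*-Solver)
open import Data.Sum using (_⊎_; inj₁; inj₂)
open import Data.Vec as Vec using (Vec; []; _∷_; lookup; toList; _[_]≔_)
import Data.Vec.Properties as Vec
open import Function using (_∘_; id; const)
open import Function.Definitions using (Injective)
open import Level using (0ℓ)
open import Relation.Binary
  using (DecidableEquality; IsPreorder; Preorder; tri<; tri≈; tri>)
open import Relation.Binary.PropositionalEquality
  using (_≡_; _≢_; refl; sym; trans; cong; cong₂; subst; subst₂; module ≡-Reasoning)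
import Relation.Binary.Reasoning.Preorder as ≲-Reasoning
import Relation.Binary.Reasoning.Setoid as ≈-Reasoning
open import Relation.Nullary using (¬_; Dec; does; yes; no; contradiction)

open +-*-Solver using (solve; _:+_; _:*_; _:-_; :-_; _:=_; con)
open ℕ-Solver using ()
  renaming (solve to solveℕ; _:+_ to infixl 6 _⊕_; _:*_ to infixl 7 _⊗_; _:=_ to infix 4 _⊜_; con to lit)

-- Reals

-- The bound 17/18 comes from the disjointness of two outputs. Amplitude by amplitude, 12uv plus 5
-- times the squared amplitudes on the two correct outcomes is at most 9u² + 9v²; summed over all
-- basis states, with both success probabilities at least 2/3, this leaves 12F ≤ 18 - 20/3 for the
-- final overlap F. On the other side the queries give 2k(1 - F) ≤ 2(k² Wᵢ(x) + Wᵢ(y)), and 1 - F ≥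
-- 1/18 is the factor 18. The two families differ in which texts are sensitive. In the star only the
-- centre is sensitive at every position: its weights share one budget q, while each leaf may spend
-- its whole budget on its own position, so the bound is quadratic in q. The size must stay in the
-- class under every flip, which the fixed fresh tail guarantees. Equality and order of reals are
-- limit statements. Hence the inequalities between amplitudes are proved at each rational
-- approximation, with sums of squares as slack, and the linear algebra is done over abstract rings.

divide : ∀ p .{{_ : ℚ.Positive p}} {ε} → 0ℚ ℚ.< ε → ∃[ δ ] 0ℚ ℚ.< δ × p ℚ.* δ ≡ ε
divide p {ε} 0<ε =
    (ℚ.1/ p) ℚ.* ε
  , subst (ℚ._< (ℚ.1/ p) ℚ.* ε) (ℚ.*-zeroʳ (ℚ.1/ p)) (ℚ.*-monoʳ-<-pos (ℚ.1/ p) 0<ε)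
  , trans (sym (ℚ.*-assoc p (ℚ.1/ p) ε))
      (trans (cong (ℚ._* ε) (ℚ.*-inverseʳ p)) (ℚ.*-identityˡ ε))
  where
  instance
    p≢0 : ℚ.NonZero p
    p≢0 = ℚ.pos⇒nonZero p
    1/p>0 : ℚ.Positive (ℚ.1/ p)
    1/p>0 = ℚ.1/pos⇒pos p

halve : ∀ {ε} → 0ℚ ℚ.< ε → ∃[ δ ] 0ℚ ℚ.< δ × δ ℚ.+ δ ≡ ε
halve 0<ε with divide (1ℚ ℚ.+ 1ℚ) 0<ε
... | δ , 0<δ , 2δ≡ε = δ , 0<δ ,
  trans (solve 1 (λ δ → δ :+ δ := con (1ℚ ℚ.+ 1ℚ) :* δ) refl δ) 2δ≡ε

p≤∣p∣ : ∀ p → p ℚ.≤ ∣ p ∣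
p≤∣p∣ p with ℚ.≤-total 0ℚ p
... | inj₁ 0≤p = ℚ.≤-reflexive (sym (ℚ.0≤p⇒∣p∣≡p 0≤p))
... | inj₂ p≤0 = ℚ.≤-trans p≤0 (ℚ.0≤∣p∣ p)

-- x ≈ℝ y unfolds to IsNull (λ n → approx x n ℚ.- approx y n).
IsNull : (ℕ → ℚ) → Set
IsNull u = ∀ ε → 0ℚ ℚ.< ε → ∃[ N ] (∀ n → N ℕ.≤ n → ∣ u n ∣ ℚ.≤ ε)

null-cong : ∀ {u v} → (∀ n → u n ≡ v n) → IsNull u → IsNull v
null-cong u≗v u₀ ε 0<ε with u₀ ε 0<ε
... | N , h = N , λ n N≤n → subst (λ p → ∣ p ∣ ℚ.≤ ε) (u≗v n) (h n N≤n)

null-0 : IsNull (λ _ → 0ℚ)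
null-0 ε 0<ε = 0 , λ _ _ → ℚ.<⇒≤ 0<ε

null-neg : ∀ {u} → IsNull u → IsNull (λ n → ℚ.- u n)
null-neg {u} u₀ ε 0<ε with u₀ ε 0<ε
... | N , h = N , λ n N≤n → subst (ℚ._≤ ε) (sym (ℚ.∣-p∣≡∣p∣ (u n))) (h n N≤n)

null-+ : ∀ {u v} → IsNull u → IsNull v → IsNull (λ n → u n ℚ.+ v n)
null-+ {u} {v} u₀ v₀ ε 0<ε =
  let δ , 0<δ , δ+δ≡ε = halve 0<ε
      M , hu = u₀ δ 0<δ
      N , hv = v₀ δ 0<δ
  in M ℕ.⊔ N , λ n M⊔N≤n → subst (∣ u n ℚ.+ v n ∣ ℚ.≤_) δ+δ≡ε
       (ℚ.≤-trans (ℚ.∣p+q∣≤∣p∣+∣q∣ (u n) (v n))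
         (ℚ.+-mono-≤ (hu n (ℕ.m⊔n≤o⇒m≤o M N M⊔N≤n)) (hv n (ℕ.m⊔n≤o⇒n≤o M N M⊔N≤n))))

cauchy-bounded : ∀ {x} → IsCauchy x →
  ∃[ B ] ℚ.Positive B × ∃[ N ] (∀ n → N ℕ.≤ n → ∣ x n ∣ ℚ.≤ B)
cauchy-bounded {x} cx with cx 1ℚ (ℚ.positive⁻¹ 1ℚ)
... | N , h = 1ℚ ℚ.+ ∣ x N ∣
            , ℚ.positive (ℚ.+-mono-<-≤ (ℚ.positive⁻¹ 1ℚ) (ℚ.0≤∣p∣ (x N))) , N , λ n N≤n → begin
  ∣ x n ∣                      ≡⟨ cong ∣_∣ (solve 2 (λ p q → p := (p :- q) :+ q) refl (x n) (x N)) ⟩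
  ∣ (x n ℚ.- x N) ℚ.+ x N ∣    ≤⟨ ℚ.∣p+q∣≤∣p∣+∣q∣ (x n ℚ.- x N) (x N) ⟩
  ∣ x n ℚ.- x N ∣ ℚ.+ ∣ x N ∣  ≤⟨ ℚ.+-monoˡ-≤ ∣ x N ∣ (h n N N≤n ℕ.≤-refl) ⟩
  1ℚ ℚ.+ ∣ x N ∣               ∎
  where open ℚ.≤-Reasoning

∣*∣-mono-≤ : ∀ p q {B δ} → ℚ.Positive B → ∣ p ∣ ℚ.≤ B → ∣ q ∣ ℚ.≤ δ → ∣ p ℚ.* q ∣ ℚ.≤ B ℚ.* δ
∣*∣-mono-≤ p q {B} {δ} B>0 p≤B q≤δ = begin
  ∣ p ℚ.* q ∣      ≡⟨ ℚ.∣p*q∣≡∣p∣*∣q∣ p q ⟩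
  ∣ p ∣ ℚ.* ∣ q ∣  ≤⟨ ℚ.*-monoʳ-≤-nonNeg ∣ q ∣ {{ℚ.∣-∣-nonNeg q}} p≤B ⟩
  B ℚ.* ∣ q ∣      ≤⟨ ℚ.*-monoˡ-≤-nonNeg B {{ℚ.pos⇒nonNeg B {{B>0}}}} q≤δ ⟩
  B ℚ.* δ          ∎
  where open ℚ.≤-Reasoning

-- A Cauchy sequence is eventually bounded by some `B`, so it suffices that `u` falls below ε/B.
-- This makes multiplication respect `_≈ℝ_`.
null-*-cauchy : ∀ {u x} → IsNull u → IsCauchy x → IsNull (λ n → x n ℚ.* u n)
null-*-cauchy {u} {x} u₀ cx ε 0<ε =
  let B , B>0 , M , hB = cauchy-bounded {x} cx
      δ , 0<δ , Bδ≡ε = divide B {{B>0}} 0<ε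
      N , hu = u₀ δ 0<δ
  in M ℕ.⊔ N , λ n M⊔N≤n → subst (∣ x n ℚ.* u n ∣ ℚ.≤_) Bδ≡ε
       (∣*∣-mono-≤ (x n) (u n) B>0 (hB n (ℕ.m⊔n≤o⇒m≤o M N M⊔N≤n)) (hu n (ℕ.m⊔n≤o⇒n≤o M N M⊔N≤n)))

-- Since x ≈ℝ y and x ≤ℝ y unfold to statements about approx, x and y cannot
-- be inferred from a proof and are passed explicitly throughout.
≈ℝ-pointwise : ∀ {x y} → (∀ n → approx x n ≡ approx y n) → x ≈ℝ y
≈ℝ-pointwise {x} {y} x≗y =
  null-cong (λ n → sym (trans (cong (ℚ._- approx y n) (x≗y n)) (ℚ.+-inverseʳ (approx y n)))) null-0

≈ℝ-refl : ∀ {x} → x ≈ℝ x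
≈ℝ-refl {x} = ≈ℝ-pointwise {x} {x} λ _ → refl

≈ℝ-sym : ∀ {x y} → x ≈ℝ y → y ≈ℝ x
≈ℝ-sym {x} {y} x≈y = null-cong
  (λ n → solve 2 (λ p q → :- (p :- q) := q :- p) refl (approx x n) (approx y n)) (null-neg x≈y)

≈ℝ-trans : ∀ {x y z} → x ≈ℝ y → y ≈ℝ z → x ≈ℝ z
≈ℝ-trans {x} {y} {z} x≈y y≈z = null-cong
  (λ n → solve 3 (λ p q r → (p :- q) :+ (q :- r) := p :- r) refl (approx x n) (approx y n) (approx z n))
  (null-+ x≈y y≈z)

+ℝ-cong : ∀ {x x′ y y′} → x ≈ℝ x′ → y ≈ℝ y′ → x +ℝ y ≈ℝ x′ +ℝ y′
+ℝ-cong {x} {x′} {y} {y′} x≈x′ y≈y′ = null-cong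
  (λ n → solve 4 (λ p p′ q q′ → (p :- p′) :+ (q :- q′) := (p :+ q) :- (p′ :+ q′)) refl
    (approx x n) (approx x′ n) (approx y n) (approx y′ n))
  (null-+ x≈x′ y≈y′)

-ℝ-cong : ∀ {x y} → x ≈ℝ y → -ℝ x ≈ℝ -ℝ y
-ℝ-cong {x} {y} x≈y = null-cong
  (λ n → solve 2 (λ p q → :- (p :- q) := :- p :- :- q) refl (approx x n) (approx y n)) (null-neg x≈y)

*ℝ-cong : ∀ {x x′ y y′} → x ≈ℝ x′ → y ≈ℝ y′ → x *ℝ y ≈ℝ x′ *ℝ y′
*ℝ-cong {x} {x′} {y} {y′} x≈x′ y≈y′ = null-cong
  (λ n → solve 4 (λ p p′ q q′ → q :* (p :- p′) :+ p′ :* (q :- q′) := p :* q :- p′ :* q′) refl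
    (approx x n) (approx x′ n) (approx y n) (approx y′ n))
  (null-+ {λ n → approx y n ℚ.* (approx x n ℚ.- approx x′ n)} {λ n → approx x′ n ℚ.* (approx y n ℚ.- approx y′ n)}
    (null-*-cauchy {x = approx y} x≈x′ (cauchy y))
    (null-*-cauchy {x = approx x′} y≈y′ (cauchy x′)))

ℝ-ring : CommutativeRing 0ℓ 0ℓ
ℝ-ring = record
  { Carrier = ℝ ; _≈_ = _≈ℝ_ ; _+_ = _+ℝ_ ; _*_ = _*ℝ_ ; -_ = -ℝ_ ; 0# = 0ℝ ; 1# = 1ℝ
  ; isCommutativeRing = record
    { isRing = record
      { +-isAbelianGroup = record
        { isGroup = record
          { isMonoid = record
            { isSemigroup = record
              { isMagma = record
                { isEquivalence = record
                  { refl = λ {x} → ≈ℝ-refl {x}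
                  ; sym = λ {x} {y} → ≈ℝ-sym {x} {y}
                  ; trans = λ {x} {y} {z} → ≈ℝ-trans {x} {y} {z} }
                ; ∙-cong = λ {x} {x′} {y} {y′} → +ℝ-cong {x} {x′} {y} {y′} }
              ; assoc = λ x y z → ≈ℝ-pointwise {(x +ℝ y) +ℝ z} {x +ℝ (y +ℝ z)} λ n →
                  ℚ.+-assoc (approx x n) (approx y n) (approx z n) }
            ; identity = (λ x → ≈ℝ-pointwise {0ℝ +ℝ x} {x} λ n → ℚ.+-identityˡ (approx x n))
                       , (λ x → ≈ℝ-pointwise {x +ℝ 0ℝ} {x} λ n → ℚ.+-identityʳ (approx x n)) }
          ; inverse = (λ x → ≈ℝ-pointwise { -ℝ x +ℝ x} {0ℝ} λ n → ℚ.+-inverseˡ (approx x n))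
                    , (λ x → ≈ℝ-pointwise {x -ℝ x} {0ℝ} λ n → ℚ.+-inverseʳ (approx x n))
          ; ⁻¹-cong = λ {x} {y} → -ℝ-cong {x} {y} }
        ; comm = λ x y → ≈ℝ-pointwise {x +ℝ y} {y +ℝ x} λ n → ℚ.+-comm (approx x n) (approx y n) }
      ; *-cong = λ {x} {x′} {y} {y′} → *ℝ-cong {x} {x′} {y} {y′}
      ; *-assoc = λ x y z → ≈ℝ-pointwise {(x *ℝ y) *ℝ z} {x *ℝ (y *ℝ z)} λ n →
          ℚ.*-assoc (approx x n) (approx y n) (approx z n)
      ; *-identity = (λ x → ≈ℝ-pointwise {1ℝ *ℝ x} {x} λ n → ℚ.*-identityˡ (approx x n))
                   , (λ x → ≈ℝ-pointwise {x *ℝ 1ℝ} {x} λ n → ℚ.*-identityʳ (approx x n))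
      ; distrib = (λ x y z → ≈ℝ-pointwise {x *ℝ (y +ℝ z)} {x *ℝ y +ℝ x *ℝ z} λ n →
                    ℚ.*-distribˡ-+ (approx x n) (approx y n) (approx z n))
                , (λ x y z → ≈ℝ-pointwise {(y +ℝ z) *ℝ x} {y *ℝ x +ℝ z *ℝ x} λ n →
                    ℚ.*-distribʳ-+ (approx x n) (approx y n) (approx z n)) }
    ; *-comm = λ x y → ≈ℝ-pointwise {x *ℝ y} {y *ℝ x} λ n → ℚ.*-comm (approx x n) (approx y n) } }

≤ℝ-pointwise : ∀ {x y} → (∀ n → approx x n ℚ.≤ approx y n) → x ≤ℝ y
≤ℝ-pointwise {x} {y} x≤y ε 0<ε = 0 , λ n _ →
  ℚ.≤-trans (x≤y n) (subst (ℚ._≤ approx y n ℚ.+ ε)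
    (ℚ.+-identityʳ (approx y n)) (ℚ.+-monoʳ-≤ (approx y n) (ℚ.<⇒≤ 0<ε)))

≤ℝ-reflexive : ∀ {x y} → x ≈ℝ y → x ≤ℝ y
≤ℝ-reflexive {x} {y} x≈y ε 0<ε with x≈y ε 0<ε
... | N , h = N , λ n N≤n → begin
  approx x n                                 ≡⟨ solve 2 (λ p q → p := q :+ (p :- q)) refl (approx x n) (approx y n) ⟩
  approx y n ℚ.+ (approx x n ℚ.- approx y n) ≤⟨ ℚ.+-monoʳ-≤ (approx y n) 
    (ℚ.≤-trans (p≤∣p∣ (approx x n ℚ.- approx y n)) (h n N≤n)) ⟩
  approx y n ℚ.+ ε                           ∎
  where open ℚ.≤-Reasoning

+ℝ-mono-≤ : ∀ {x x′ y y′} → x ≤ℝ x′ → y ≤ℝ y′ → x +ℝ y ≤ℝ x′ +ℝ y′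
+ℝ-mono-≤ {x} {x′} {y} {y′} x≤x′ y≤y′ ε 0<ε =
  let δ , 0<δ , δ+δ≡ε = halve 0<ε
      M , hx = x≤x′ δ 0<δ
      N , hy = y≤y′ δ 0<δ
  in M ℕ.⊔ N , λ n M⊔N≤n → subst (approx x n ℚ.+ approx y n ℚ.≤_)
       (trans (solve 3 (λ p q δ → (p :+ δ) :+ (q :+ δ) := (p :+ q) :+ (δ :+ δ)) refl (approx x′ n) (approx y′ n) δ)
              (cong ((approx x′ n ℚ.+ approx y′ n) ℚ.+_) δ+δ≡ε))
       (ℚ.+-mono-≤ (hx n (ℕ.m⊔n≤o⇒m≤o M N M⊔N≤n)) (hy n (ℕ.m⊔n≤o⇒n≤o M N M⊔N≤n)))

≤ℝ-trans : ∀ {x y z} → x ≤ℝ y → y ≤ℝ z → x ≤ℝ z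
≤ℝ-trans {x} {y} {z} x≤y y≤z ε 0<ε =
  let δ , 0<δ , δ+δ≡ε = halve 0<ε
      M , hx = x≤y δ 0<δ
      N , hy = y≤z δ 0<δ
  in M ℕ.⊔ N , λ n M⊔N≤n → ℚ.≤-trans (hx n (ℕ.m⊔n≤o⇒m≤o M N M⊔N≤n))
       (subst (approx y n ℚ.+ δ ℚ.≤_)
         (trans (ℚ.+-assoc (approx z n) δ δ) (cong (approx z n ℚ.+_) δ+δ≡ε))
         (ℚ.+-monoˡ-≤ δ (hy n (ℕ.m⊔n≤o⇒n≤o M N M⊔N≤n))))

-- The scalars by which the argument multiplies inequalities are all positive rationals.
*ℝ-monoˡ-≤-pos : ∀ p .{{_ : ℚ.Positive p}} {x y} → x ≤ℝ y → fromℚ p *ℝ x ≤ℝ fromℚ p *ℝ y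
*ℝ-monoˡ-≤-pos p {x} {y} x≤y ε 0<ε =
  let δ , 0<δ , pδ≡ε = divide p 0<ε
      N , h = x≤y δ 0<δ
  in N , λ n N≤n → subst (p ℚ.* approx x n ℚ.≤_)
       (trans (ℚ.*-distribˡ-+ p (approx y n) δ) (cong (p ℚ.* approx y n ℚ.+_) pδ≡ε))
       (ℚ.*-monoˡ-≤-nonNeg p {{ℚ.pos⇒nonNeg p}} (h n N≤n))

-- The way back from ℝ: counting bounds are derived for real sums and read off for rationals here.
-- If `q < p`, a tolerance of half the gap is violated.
fromℚ-cancel-≤ : ∀ {p q} → fromℚ p ≤ℝ fromℚ q → p ℚ.≤ q
fromℚ-cancel-≤ {p} {q} p≤q = ℚ.≮⇒≥ λ q<p →
  let δ , 0<δ , δ+δ≡p-q = halve (0<p-q q<p)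
      N , h = p≤q δ 0<δ
  in ℚ.<-irrefl refl (ℚ.<-≤-trans (p<p+δ 0<δ) (subst (p ℚ.+ δ ℚ.≤_) (q+2δ≡p δ+δ≡p-q) (ℚ.+-monoˡ-≤ δ (h N ℕ.≤-refl))))
  where
  0<p-q : q ℚ.< p → 0ℚ ℚ.< p ℚ.- q
  0<p-q q<p = subst (ℚ._< p ℚ.- q) (ℚ.+-inverseʳ q) (ℚ.+-monoˡ-< (ℚ.- q) q<p)
  p<p+δ : ∀ {δ} → 0ℚ ℚ.< δ → p ℚ.< p ℚ.+ δ
  p<p+δ {δ} 0<δ = subst (ℚ._< p ℚ.+ δ) (ℚ.+-identityʳ p) (ℚ.+-monoʳ-< p 0<δ)
  q+2δ≡p : ∀ {δ} → δ ℚ.+ δ ≡ p ℚ.- q → (q ℚ.+ δ) ℚ.+ δ ≡ p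
  q+2δ≡p {δ} δ+δ≡p-q = trans (ℚ.+-assoc q δ δ)
    (trans (cong (q ℚ.+_) δ+δ≡p-q) (solve 2 (λ p q → q :+ (p :- q) := p) refl p q))

-- Complex numbers

ℂ-ring : CommutativeRing 0ℓ 0ℓ
ℂ-ring = record
  { Carrier = ℂ ; _≈_ = _≈ℂ_ ; _+_ = _+ℂ_ ; _*_ = _*ℂ_ ; -_ = λ u → (-ℝ re u) +i (-ℝ im u) ; 0# = 0ℂ ; 1# = 1ℂ
  ; isCommutativeRing = record
    { isRing = record
      { +-isAbelianGroup = record
        { isGroup = record
          { isMonoid = record
            { isSemigroup = record
              { isMagma = record
                { isEquivalence = record
                  { refl = λ {u} → ≈ℝ-refl {re u} , ≈ℝ-refl {im u}
                  ; sym = λ {u} {v} (p , q) → ≈ℝ-sym {re u} {re v} p , ≈ℝ-sym {im u} {im v} q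
                  ; trans = λ {u} {v} {w} (p , q) (p′ , q′) →
                      ≈ℝ-trans {re u} {re v} {re w} p p′ , ≈ℝ-trans {im u} {im v} {im w} q q′ }
                ; ∙-cong = λ {u} {u′} {v} {v′} (p , q) (p′ , q′) →
                    +ℝ-cong {re u} {re u′} {re v} {re v′} p p′ , +ℝ-cong {im u} {im u′} {im v} {im v′} q q′ }
              ; assoc = λ u v w → R.+-assoc (re u) (re v) (re w) , R.+-assoc (im u) (im v) (im w) }
            ; identity = (λ u → R.+-identityˡ (re u) , R.+-identityˡ (im u))
                       , (λ u → R.+-identityʳ (re u) , R.+-identityʳ (im u)) }
          ; inverse = (λ u → R.-‿inverseˡ (re u) , R.-‿inverseˡ (im u))
                    , (λ u → R.-‿inverseʳ (re u) , R.-‿inverseʳ (im u))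
          ; ⁻¹-cong = λ {u} {v} (p , q) → -ℝ-cong {re u} {re v} p , -ℝ-cong {im u} {im v} q }
        ; comm = λ u v → R.+-comm (re u) (re v) , R.+-comm (im u) (im v) }
      ; *-cong = λ {u} {u′} {v} {v′} (p , q) (p′ , q′) →
            +ℝ-cong {re u *ℝ re v} {re u′ *ℝ re v′} { -ℝ (im u *ℝ im v)} { -ℝ (im u′ *ℝ im v′)}
              (*ℝ-cong {re u} {re u′} {re v} {re v′} p p′)
              (-ℝ-cong {im u *ℝ im v} {im u′ *ℝ im v′} (*ℝ-cong {im u} {im u′} {im v} {im v′} q q′))
          , +ℝ-cong {re u *ℝ im v} {re u′ *ℝ im v′} {im u *ℝ re v} {im u′ *ℝ re v′}
              (*ℝ-cong {re u} {re u′} {im v} {im v′} p q′) (*ℝ-cong {im u} {im u′} {re v} {re v′} q p′)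
      ; *-assoc = λ u v w →
            ≈ℝ-pointwise {re ((u *ℂ v) *ℂ w)} {re (u *ℂ (v *ℂ w))} (λ n → solve 6
              (λ a b c d e f → (a :* c :- b :* d) :* e :- (a :* d :+ b :* c) :* f
                            := a :* (c :* e :- d :* f) :- b :* (c :* f :+ d :* e)) refl
              (a u n) (b u n) (a v n) (b v n) (a w n) (b w n))
          , ≈ℝ-pointwise {im ((u *ℂ v) *ℂ w)} {im (u *ℂ (v *ℂ w))} (λ n → solve 6
              (λ a b c d e f → (a :* c :- b :* d) :* f :+ (a :* d :+ b :* c) :* e
                            := a :* (c :* f :+ d :* e) :+ b :* (c :* e :- d :* f)) refl
              (a u n) (b u n) (a v n) (b v n) (a w n) (b w n))
      ; *-identity =
            (λ u → ≈ℝ-pointwise {re (1ℂ *ℂ u)} {re u} (λ n →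
                     solve 2 (λ a b → con 1ℚ :* a :- con 0ℚ :* b := a) refl (a u n) (b u n))
                 , ≈ℝ-pointwise {im (1ℂ *ℂ u)} {im u} (λ n →
                     solve 2 (λ a b → con 1ℚ :* b :+ con 0ℚ :* a := b) refl (a u n) (b u n)))
          , (λ u → ≈ℝ-pointwise {re (u *ℂ 1ℂ)} {re u} (λ n →
                     solve 2 (λ a b → a :* con 1ℚ :- b :* con 0ℚ := a) refl (a u n) (b u n))
                 , ≈ℝ-pointwise {im (u *ℂ 1ℂ)} {im u} (λ n →
                     solve 2 (λ a b → a :* con 0ℚ :+ b :* con 1ℚ := b) refl (a u n) (b u n)))
      ; distrib =
            (λ u v w → ≈ℝ-pointwise {re (u *ℂ (v +ℂ w))} {re (u *ℂ v +ℂ u *ℂ w)} (λ n → solve 6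
                (λ a b c d e f → a :* (c :+ e) :- b :* (d :+ f) := (a :* c :- b :* d) :+ (a :* e :- b :* f)) refl
                (a u n) (b u n) (a v n) (b v n) (a w n) (b w n))
              , ≈ℝ-pointwise {im (u *ℂ (v +ℂ w))} {im (u *ℂ v +ℂ u *ℂ w)} (λ n → solve 6
                (λ a b c d e f → a :* (d :+ f) :+ b :* (c :+ e) := (a :* d :+ b :* c) :+ (a :* f :+ b :* e)) refl
                (a u n) (b u n) (a v n) (b v n) (a w n) (b w n)))
          , (λ u v w → ≈ℝ-pointwise {re ((v +ℂ w) *ℂ u)} {re (v *ℂ u +ℂ w *ℂ u)} (λ n → solve 6
                (λ a b c d e f → (c :+ e) :* a :- (d :+ f) :* b := (c :* a :- d :* b) :+ (e :* a :- f :* b)) refl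
                (a u n) (b u n) (a v n) (b v n) (a w n) (b w n))
              , ≈ℝ-pointwise {im ((v +ℂ w) *ℂ u)} {im (v *ℂ u +ℂ w *ℂ u)} (λ n → solve 6
                (λ a b c d e f → (c :+ e) :* b :+ (d :+ f) :* a := (c :* b :+ d :* a) :+ (e :* b :+ f :* a)) refl
                (a u n) (b u n) (a v n) (b v n) (a w n) (b w n))) }
    ; *-comm = λ u v →
          ≈ℝ-pointwise {re (u *ℂ v)} {re (v *ℂ u)} (λ n →
            solve 4 (λ a b c d → a :* c :- b :* d := c :* a :- d :* b) refl
            (a u n) (b u n) (a v n) (b v n))
        , ≈ℝ-pointwise {im (u *ℂ v)} {im (v *ℂ u)} (λ n →
            solve 4 (λ a b c d → a :* d :+ b :* c := c :* b :+ d :* a) refl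
            (a u n) (b u n) (a v n) (b v n)) } }
  where
  module R = CommutativeRing ℝ-ring
  a b : ℂ → ℕ → ℚ
  a = approx ∘ re
  b = approx ∘ im

-- Sums over finite index sets and over the computational basis

module FinSum (R : CommutativeRing 0ℓ 0ℓ) where
  open CommutativeRing R hiding (zero) renaming (Carrier to A; refl to ≈-refl; sym to ≈-sym; trans to ≈-trans)
  open Sum semiring public
  open ≈-Reasoning setoid

  sum-zero : ∀ {m} {f : Fin m → A} → (∀ j → f j ≈ 0#) → sum f ≈ 0#
  sum-zero {m} f≈0 = ≈-trans (sum-cong-≋ f≈0) (sum-replicate-zero m)

  sum-single : ∀ {m} (f : Fin m → A) i → (∀ j → j ≢ i → f j ≈ 0#) → sum f ≈ f i
  sum-single f zero    f≈0 = ≈-trans (+-congˡ (sum-zero λ j → f≈0 (suc j) λ ())) (+-identityʳ _)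
  sum-single f (suc i) f≈0 = ≈-trans
    (+-cong (f≈0 zero λ ()) (sum-single (f ∘ suc) i λ j j≢i → f≈0 (suc j) (j≢i ∘ Fin.suc-injective)))
    (+-identityˡ _)

module BasisSum (R : CommutativeRing 0ℓ 0ℓ) (n σ w : ℕ) where
  open CommutativeRing R hiding (zero) renaming (Carrier to A; refl to ≈-refl; sym to ≈-sym; trans to ≈-trans)
  open FinSum R
  open ≈-Reasoning setoid
  open Quantum {n} {σ} {w} using (sumᴮ; _≟ᴮ_)

  ∑₂ : (Fin σ → Fin w → A) → A
  ∑₂ f = sum {σ} λ b → sum {w} (f b)

  ∑₂-cong : ∀ {f g} → (∀ b k → f b k ≈ g b k) → ∑₂ f ≈ ∑₂ g
  ∑₂-cong f≈g = sum-cong-≋ {σ} λ b → sum-cong-≋ {w} (f≈g b)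

  ∑₂-zero : ∀ {f} → (∀ b k → f b k ≈ 0#) → ∑₂ f ≈ 0#
  ∑₂-zero f≈0 = sum-zero {σ} λ b → sum-zero {w} (f≈0 b)

  *-distribˡ-∑₂ : ∀ x f → x * ∑₂ f ≈ ∑₂ λ b k → x * f b k
  *-distribˡ-∑₂ x f = ≈-trans (*-distribˡ-sum {σ} x _) (sum-cong-≋ {σ} λ b → *-distribˡ-sum {w} x (f b))

  ∑₂-distrib-+ : ∀ f g → ∑₂ (λ b k → f b k + g b k) ≈ ∑₂ f + ∑₂ g
  ∑₂-distrib-+ f g = ≈-trans (sum-cong-≋ {σ} λ b → ∑-distrib-+ {w} (f b) (g b))
    (∑-distrib-+ {σ} (λ b → sum (f b)) (λ b → sum (g b)))

  ∑ᴮ : (Basis n σ w → A) → A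
  ∑ᴮ = sumᴮ _+_ 0#

  δᴮ : Basis n σ w → Basis n σ w → A
  δᴮ s t = if does (s ≟ᴮ t) then 1# else 0#

  ∑ᴮ-cong : ∀ {f g} → (∀ s → f s ≈ g s) → ∑ᴮ f ≈ ∑ᴮ g
  ∑ᴮ-cong f≈g = sum-cong-≋ {n} λ i → ∑₂-cong λ b k → f≈g (i , b , k)

  *-distribˡ-∑ᴮ : ∀ x f → x * ∑ᴮ f ≈ ∑ᴮ (λ s → x * f s)
  *-distribˡ-∑ᴮ x f = ≈-trans (*-distribˡ-sum {n} x _)
    (sum-cong-≋ {n} λ i → *-distribˡ-∑₂ x λ b k → f (i , b , k))

  *-distribʳ-∑ᴮ : ∀ x f → ∑ᴮ f * x ≈ ∑ᴮ (λ s → f s * x)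
  *-distribʳ-∑ᴮ x f = ≈-trans (*-comm _ _)
    (≈-trans (*-distribˡ-∑ᴮ x f) (∑ᴮ-cong {λ s → x * f s} λ s → *-comm _ _))

  ∑ᴮ-distrib-+ : ∀ f g → ∑ᴮ (λ s → f s + g s) ≈ ∑ᴮ f + ∑ᴮ g
  ∑ᴮ-distrib-+ f g = ≈-trans
    (sum-cong-≋ {n} λ i → ∑₂-distrib-+ (λ b k → f (i , b , k)) (λ b k → g (i , b , k)))
    (∑-distrib-+ {n} (λ i → ∑₂ λ b k → f (i , b , k)) (λ i → ∑₂ λ b k → g (i , b , k)))

  ∑ᴮ-∑-comm : ∀ {m} (f : Basis n σ w → Fin m → A) → ∑ᴮ (λ s → sum (f s)) ≈ sum λ j → ∑ᴮ λ s → f s j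
  ∑ᴮ-∑-comm {m} f = ≈-trans
    (sum-cong-≋ {n} λ i → ≈-trans (sum-cong-≋ {σ} λ b → ∑-comm {w} {m} (λ k → f (i , b , k)))
                                  (∑-comm {σ} {m} λ b j → sum {w} λ k → f (i , b , k) j))
    (∑-comm {n} {m} λ i j → ∑₂ λ b k → f (i , b , k) j)

  ∑ᴮ-comm : ∀ (f : Basis n σ w → Basis n σ w → A) → ∑ᴮ (λ s → ∑ᴮ (f s)) ≈ ∑ᴮ λ t → ∑ᴮ λ s → f s t
  ∑ᴮ-comm f = ≈-trans (∑ᴮ-∑-comm {n} λ s i → ∑₂ λ b k → f s (i , b , k)) (sum-cong-≋ {n} λ i →
    ≈-trans (∑ᴮ-∑-comm {σ} λ s b → sum {w} λ k → f s (i , b , k)) (sum-cong-≋ {σ} λ b →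
      ∑ᴮ-∑-comm {w} λ s k → f s (i , b , k)))

  ∑ᴮ-single : ∀ f s → (∀ t → t ≢ s → f t ≈ 0#) → ∑ᴮ f ≈ f s
  ∑ᴮ-single f (i , b , k) f≈0 = begin
    ∑ᴮ f
      ≈⟨ sum-single {n} _ i (λ i′ i′≢i → ∑₂-zero λ b′ k′ → f≈0 (i′ , b′ , k′) (i′≢i ∘ cong proj₁)) ⟩
    ∑₂ (λ b′ k′ → f (i , b′ , k′))
      ≈⟨ sum-single {σ} _ b (λ b′ b′≢b → sum-zero {w} λ k′ → f≈0 (i , b′ , k′) (b′≢b ∘ cong (proj₁ ∘ proj₂))) ⟩
    sum (λ k′ → f (i , b , k′))
      ≈⟨ sum-single {w} _ k (λ k′ k′≢k → f≈0 (i , b , k′) (k′≢k ∘ cong (proj₂ ∘ proj₂))) ⟩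
    f (i , b , k) ∎

  δᴮ-≡ : ∀ {s t} → s ≡ t → δᴮ s t ≡ 1#
  δᴮ-≡ {s} {t} s≡t with s ≟ᴮ t
  ... | yes _  = refl
  ... | no s≢t = contradiction s≡t s≢t

  δᴮ-≢ : ∀ {s t} → s ≢ t → δᴮ s t ≡ 0#
  δᴮ-≢ {s} {t} s≢t with s ≟ᴮ t
  ... | yes s≡t = contradiction s≡t s≢t
  ... | no _    = refl

  ∑ᴮ-δ : ∀ s (f : Basis n σ w → A) → ∑ᴮ (λ t → δᴮ s t * f t) ≈ f s
  ∑ᴮ-δ s f = begin
    ∑ᴮ (λ t → δᴮ s t * f t)
      ≈⟨ ∑ᴮ-single (λ t → δᴮ s t * f t) s
           (λ t t≢s → ≈-trans (*-congʳ (reflexive (δᴮ-≢ {s} {t} (t≢s ∘ sym)))) (zeroˡ (f t))) ⟩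
    δᴮ s s * f s  ≈⟨ *-congʳ (reflexive (δᴮ-≡ {s} {s} refl)) ⟩
    1# * f s      ≈⟨ *-identityˡ (f s) ⟩
    f s           ∎

-- The action of the oracle on the answer register when the queried symbol is `v`, and its inverse,
-- which adds `σ ∸ v` in order to stay within ℕ.
shift unshift : ∀ {σ} → Fin σ → Fin σ → Fin σ
shift   {σ} v b = _mod_ (toℕ b ℕ.+ toℕ v) σ {{Fin.nonZeroIndex b}}
unshift {σ} v b = _mod_ (toℕ b ℕ.+ (σ ℕ.∸ toℕ v)) σ {{Fin.nonZeroIndex b}}

-- Any two summands with sum `σ` are allowed, so that one proof covers both orders of composing
-- `shift` and `unshift`.
mod-mod-cancel : ∀ {σ} .{{_ : ℕ.NonZero σ}} (b : Fin σ) u v → u ℕ.+ v ≡ σ →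
  (toℕ ((toℕ b ℕ.+ u) mod σ) ℕ.+ v) mod σ ≡ b
mod-mod-cancel {σ} b u v u+v≡σ = Fin.toℕ-injective (begin
  toℕ ((toℕ ((toℕ b ℕ.+ u) mod σ) ℕ.+ v) mod σ)
    ≡⟨ Fin.toℕ-fromℕ< _ ⟩
  (toℕ ((toℕ b ℕ.+ u) mod σ) ℕ.+ v) % σ
    ≡⟨ cong (λ a → (a ℕ.+ v) % σ) (Fin.toℕ-fromℕ< _) ⟩
  ((toℕ b ℕ.+ u) % σ ℕ.+ v) % σ
    ≡⟨ %-distribˡ-+ ((toℕ b ℕ.+ u) % σ) v σ ⟩
  ((toℕ b ℕ.+ u) % σ % σ ℕ.+ v % σ) % σ
    ≡⟨ cong (λ a → (a ℕ.+ v % σ) % σ) (m%n%n≡m%n (toℕ b ℕ.+ u) σ) ⟩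
  ((toℕ b ℕ.+ u) % σ ℕ.+ v % σ) % σ
    ≡⟨ %-distribˡ-+ (toℕ b ℕ.+ u) v σ ⟨
  (toℕ b ℕ.+ u ℕ.+ v) % σ
    ≡⟨ cong (_% σ) (trans (ℕ.+-assoc (toℕ b) u v) (cong (toℕ b ℕ.+_) u+v≡σ)) ⟩
  (toℕ b ℕ.+ σ) % σ
    ≡⟨ [m+n]%n≡m%n (toℕ b) σ ⟩
  toℕ b % σ
    ≡⟨ m<n⇒m%n≡m (Fin.toℕ<n b) ⟩
  toℕ b ∎)
  where open ≡-Reasoning

unshift-shift : ∀ {σ} (v b : Fin σ) → unshift v (shift v b) ≡ b
unshift-shift v b = mod-mod-cancel {{Fin.nonZeroIndex b}} b (toℕ v) _ (ℕ.m+[n∸m]≡n (ℕ.<⇒≤ (Fin.toℕ<n v)))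

shift-unshift : ∀ {σ} (v b : Fin σ) → shift v (unshift v b) ≡ b
shift-unshift v b = mod-mod-cancel {{Fin.nonZeroIndex b}} b _ (toℕ v) (ℕ.m∸n+n≡m (ℕ.<⇒≤ (Fin.toℕ<n v)))

-- Change of basis and the oracle

-- Applied to conjugation on ℂ and to the real part from ℂ to ℝ.
module AdditiveMap (C R : CommutativeRing 0ℓ 0ℓ) where
  module C = CommutativeRing C
  module R = CommutativeRing R
  open FinSum

  module _ (h : C.Carrier → R.Carrier) (h-0 : h C.0# R.≈ R.0#) (h-+ : ∀ x y → h (x C.+ y) R.≈ h x R.+ h y) where

    map-sum : ∀ {m} (f : Fin m → C.Carrier) → h (sum C f) R.≈ sum R (h ∘ f)
    map-sum {zero}  f = h-0
    map-sum {suc m} f = R.trans (h-+ _ _) (R.+-congˡ (map-sum {m} (f ∘ suc)))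

    map-∑ᴮ : ∀ n σ w (f : Basis n σ w → C.Carrier) → h (BasisSum.∑ᴮ C n σ w f) R.≈ BasisSum.∑ᴮ R n σ w (h ∘ f)
    map-∑ᴮ n σ w f = R.trans (map-sum {n} _) (sum-cong-≋ R {n} λ i →
      R.trans (map-sum {σ} _) (sum-cong-≋ R {σ} λ b → map-sum {w} _))

-- dot u v = Re (conj u * v), with C and R abstracting ℂ and ℝ.
record DotProduct (C R : CommutativeRing 0ℓ 0ℓ) : Set where
  open CommutativeRing C using (_≈_; _+_; _*_; 0#) renaming (Carrier to A)
  private module R = CommutativeRing R
  field
    star      : A → A
    star-cong : ∀ {x y} → x ≈ y → star x ≈ star y
    star-0    : star 0# ≈ 0#
    star-+    : ∀ x y → star (x + y) ≈ star x + star y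
    star-*    : ∀ x y → star (x * y) ≈ star x * star y
    real      : A → R.Carrier
    real-cong : ∀ {x y} → x ≈ y → real x R.≈ real y
    real-0    : real 0# R.≈ R.0#
    real-+    : ∀ x y → real (x + y) R.≈ real x R.+ real y
    dot       : A → A → R.Carrier
    dot≈real  : ∀ x y → dot x y R.≈ real (star x * y)

module ChangeOfBasis (C R : CommutativeRing 0ℓ 0ℓ) (D : DotProduct C R) (n σ w : ℕ) where

  open CommutativeRing C hiding (zero) renaming (Carrier to A; refl to ≈-refl; sym to ≈-sym; trans to ≈-trans)
  module R = CommutativeRing R
  open DotProduct D
  open FinSum R
  open BasisSum C n σ w
  module ∑R = BasisSum R n σ w
  open AdditiveMap using (map-∑ᴮ)
  open CommutativeSemigroupProperties *-commutativeSemigroup using (interchange)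
  open ≈-Reasoning setoid

  star-∑ᴮ : ∀ f → star (∑ᴮ f) ≈ ∑ᴮ (star ∘ f)
  star-∑ᴮ = map-∑ᴮ C C star star-0 star-+ n σ w

  -- Both matrix products expand to a triple sum; once the sum over `k` is innermost, it is the
  -- entry of U†U at `s` and `t`.
  inner-product-invariant : ∀ (U : Basis n σ w → Basis n σ w → A) →
    (∀ s t → ∑ᴮ (λ k → star (U k s) * U k t) ≈ δᴮ s t) → ∀ (φ ψ : Basis n σ w → A) →
    ∑ᴮ (λ k → star (∑ᴮ λ s → U k s * φ s) * ∑ᴮ λ t → U k t * ψ t) ≈ ∑ᴮ λ s → star (φ s) * ψ s
  inner-product-invariant U U†U≈1 φ ψ = begin
    ∑ᴮ (λ k → star (∑ᴮ λ s → U k s * φ s) * ∑ᴮ λ t → U k t * ψ t)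
      ≈⟨ ∑ᴮ-cong expand ⟩
    ∑ᴮ (λ k → ∑ᴮ λ s → ∑ᴮ λ t → (star (U k s) * U k t) * (star (φ s) * ψ t))
      ≈⟨ ∑ᴮ-comm (λ k s → ∑ᴮ λ t → (star (U k s) * U k t) * (star (φ s) * ψ t)) ⟩
    ∑ᴮ (λ s → ∑ᴮ λ k → ∑ᴮ λ t → (star (U k s) * U k t) * (star (φ s) * ψ t))
      ≈⟨ ∑ᴮ-cong (λ s → ∑ᴮ-comm λ k t → (star (U k s) * U k t) * (star (φ s) * ψ t)) ⟩
    ∑ᴮ (λ s → ∑ᴮ λ t → ∑ᴮ λ k → (star (U k s) * U k t) * (star (φ s) * ψ t))
      ≈⟨ ∑ᴮ-cong (λ s → ∑ᴮ-cong λ t → ≈-trans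
           (≈-sym (*-distribʳ-∑ᴮ (star (φ s) * ψ t) λ k → star (U k s) * U k t)) (*-congʳ (U†U≈1 s t))) ⟩
    ∑ᴮ (λ s → ∑ᴮ λ t → δᴮ s t * (star (φ s) * ψ t))
      ≈⟨ ∑ᴮ-cong (λ s → ∑ᴮ-δ s λ t → star (φ s) * ψ t) ⟩
    ∑ᴮ (λ s → star (φ s) * ψ s) ∎
    where
    expand : ∀ k → star (∑ᴮ λ s → U k s * φ s) * ∑ᴮ (λ t → U k t * ψ t)
                 ≈ ∑ᴮ λ s → ∑ᴮ λ t → (star (U k s) * U k t) * (star (φ s) * ψ t)
    expand k = begin
      star (∑ᴮ λ s → U k s * φ s) * ∑ᴮ (λ t → U k t * ψ t)
        ≈⟨ *-congʳ (≈-trans (star-∑ᴮ _) (∑ᴮ-cong λ s → star-* (U k s) (φ s))) ⟩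
      ∑ᴮ (λ s → star (U k s) * star (φ s)) * ∑ᴮ (λ t → U k t * ψ t)
        ≈⟨ *-distribʳ-∑ᴮ _ (λ s → star (U k s) * star (φ s)) ⟩
      ∑ᴮ (λ s → (star (U k s) * star (φ s)) * ∑ᴮ λ t → U k t * ψ t)
        ≈⟨ ∑ᴮ-cong (λ s → ≈-trans (*-distribˡ-∑ᴮ _ λ t → U k t * ψ t)
             (∑ᴮ-cong λ t → interchange (star (U k s)) (star (φ s)) (U k t) (ψ t))) ⟩
      ∑ᴮ (λ s → ∑ᴮ λ t → (star (U k s) * U k t) * (star (φ s) * ψ t)) ∎

  dot-invariant : ∀ (U : Basis n σ w → Basis n σ w → A) →
    (∀ s t → ∑ᴮ (λ k → star (U k s) * U k t) ≈ δᴮ s t) → ∀ (φ ψ : Basis n σ w → A) →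
    ∑R.∑ᴮ (λ k → dot (∑ᴮ λ s → U k s * φ s) (∑ᴮ λ t → U k t * ψ t)) R.≈ ∑R.∑ᴮ λ s → dot (φ s) (ψ s)
  dot-invariant U U†U≈1 φ ψ = R.trans (R.sym (real-inner-product _ _))
    (R.trans (real-cong (inner-product-invariant U U†U≈1 φ ψ)) (real-inner-product φ ψ))
    where
    real-inner-product : ∀ φ ψ → real (∑ᴮ λ s → star (φ s) * ψ s) R.≈ ∑R.∑ᴮ λ s → dot (φ s) (ψ s)
    real-inner-product φ ψ = R.trans (map-∑ᴮ C R real real-0 real-+ n σ w λ s → star (φ s) * ψ s)
      (∑R.∑ᴮ-cong λ s → R.sym (dot≈real (φ s) (ψ s)))

  dot-cong : ∀ {u u′ v v′} → u ≈ u′ → v ≈ v′ → dot u v R.≈ dot u′ v′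
  dot-cong u≈u′ v≈v′ = R.trans (dot≈real _ _)
    (R.trans (real-cong (*-cong (star-cong u≈u′) v≈v′)) (R.sym (dot≈real _ _)))

  module Q = Quantum {n} {σ} {w}

  -- Over ℂ this unfolds to `apply (oracle T)`, the query step of `finalState`.
  queryOp : Text σ n → (Basis n σ w → A) → Basis n σ w → A
  queryOp T ψ s = ∑ᴮ λ t → δᴮ s (Q.query T t) * ψ t

  unquery : Text σ n → Basis n σ w → Basis n σ w
  unquery T (i , b , k) = i , unshift (lookup T i) b , k

  query-unquery : ∀ T s → Q.query T (unquery T s) ≡ s
  query-unquery T (i , b , k) = cong (λ c → i , c , k) (shift-unshift (lookup T i) b)

  unquery-query : ∀ T s → unquery T (Q.query T s) ≡ s
  unquery-query T (i , b , k) = cong (λ c → i , c , k) (unshift-shift (lookup T i) b)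

  -- The oracle is a permutation matrix: only the preimage of `s` under the query contributes to the
  -- entry at `s`.
  queryOp-unquery : ∀ T ψ s → queryOp T ψ s ≈ ψ (unquery T s)
  queryOp-unquery T ψ s = begin
    ∑ᴮ (λ t → δᴮ s (Q.query T t) * ψ t)
      ≈⟨ ∑ᴮ-single (λ t → δᴮ s (Q.query T t) * ψ t) (unquery T s)
           (λ t t≢ → ≈-trans (*-congʳ (reflexive (δᴮ-≢ {s} {Q.query T t} λ s≡Qt →
             t≢ (trans (sym (unquery-query T t)) (cong (unquery T) (sym s≡Qt)))))) (zeroˡ (ψ t))) ⟩
    δᴮ s (Q.query T (unquery T s)) * ψ (unquery T s)
      ≈⟨ *-congʳ (reflexive (δᴮ-≡ {s} {Q.query T (unquery T s)} (sym (query-unquery T s)))) ⟩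
    1# * ψ (unquery T s)
      ≈⟨ *-identityˡ _ ⟩
    ψ (unquery T s) ∎

  -- Where the texts agree, the oracle permutes the answer register of both states in the same way,
  -- and a sum over that register is invariant under a common permutation.
  queryOp-local : ∀ x y i → lookup x i ≡ lookup y i → ∀ φ ψ →
    ∑R.∑₂ (λ b k → dot (queryOp x φ (i , b , k)) (queryOp y ψ (i , b , k))) R.≈
    ∑R.∑₂ (λ b k → dot (φ (i , b , k)) (ψ (i , b , k)))
  queryOp-local x y i xᵢ≡yᵢ φ ψ = R.trans
    (∑R.∑₂-cong λ b k → dot-cong (queryOp-unquery x φ (i , b , k))
      (≈-trans (queryOp-unquery y ψ (i , b , k))
        (reflexive (cong (λ v → ψ (i , unshift v b , k)) (sym xᵢ≡yᵢ)))))
    (R.sym (∑-permute {σ} {σ} (λ b → sum {w} λ k → dot (φ (i , b , k)) (ψ (i , b , k)))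
      (permutation (unshift (lookup x i)) (shift (lookup x i))
        (unshift-shift (lookup x i)) (shift-unshift (lookup x i)))))

-- The adversary argument

record OrderedRing : Set₁ where
  field
    commutativeRing : CommutativeRing 0ℓ 0ℓ
  open CommutativeRing commutativeRing using (_≈_; _+_) renaming (Carrier to A)
  field
    _≤_        : A → A → Set
    isPreorder : IsPreorder _≈_ _≤_
    +-mono-≤   : ∀ {x x′ y y′} → x ≤ x′ → y ≤ y′ → (x + y) ≤ (x′ + y′)

  preorder : Preorder 0ℓ 0ℓ 0ℓ
  preorder = record { isPreorder = isPreorder }

module OrderedSum (O : OrderedRing) where
  open OrderedRing O
  open CommutativeRing commutativeRing hiding (zero)
    renaming (Carrier to A; refl to ≈-refl; sym to ≈-sym; trans to ≈-trans)
  open FinSum commutativeRing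
  open IsPreorder isPreorder using () renaming (refl to ≤-refl; reflexive to ≤-reflexive; trans to ≤-trans)
  open CommutativeSemigroupProperties +-commutativeSemigroup using (interchange; xy∙z≈xz∙y)

  sum-mono-≤ : ∀ {m} {f g : Fin m → A} → (∀ j → f j ≤ g j) → sum f ≤ sum g
  sum-mono-≤ {zero}  f≤g = ≤-refl
  sum-mono-≤ {suc m} f≤g = +-mono-≤ (f≤g zero) (sum-mono-≤ (f≤g ∘ suc))

  -- Used for the overlap before and after a query, split by position: only the position where the
  -- texts differ can change, and the change is charged to `e`.
  sum-≤-except : ∀ {m} {f g : Fin m → A} i {e} → (∀ j → j ≢ i → f j ≈ g j) → f i ≤ (g i + e) →
    sum f ≤ (sum g + e)
  sum-≤-except zero f≈g fi≤gi+e = ≤-trans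
    (+-mono-≤ fi≤gi+e (≤-reflexive (sum-cong-≋ λ j → f≈g (suc j) λ ())))
    (≤-reflexive (xy∙z≈xz∙y _ _ _))
  sum-≤-except (suc i) f≈g fi≤gi+e = ≤-trans
    (+-mono-≤ (≤-reflexive (f≈g zero λ ()))
              (sum-≤-except i (λ j j≢i → f≈g (suc j) (j≢i ∘ Fin.suc-injective)) fi≤gi+e))
    (≤-reflexive (≈-sym (+-assoc _ _ _)))

  ∑ⱽ : ∀ m → (Vec Bool m → A) → A
  ∑ⱽ zero    f = f []
  ∑ⱽ (suc m) f = ∑ⱽ m (f ∘ (true ∷_)) + ∑ⱽ m (f ∘ (false ∷_))

  ∑ⱽ-mono-≤ : ∀ m {f g} → (∀ x → f x ≤ g x) → ∑ⱽ m f ≤ ∑ⱽ m g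
  ∑ⱽ-mono-≤ zero    f≤g = f≤g []
  ∑ⱽ-mono-≤ (suc m) f≤g = +-mono-≤ (∑ⱽ-mono-≤ m (f≤g ∘ (true ∷_))) (∑ⱽ-mono-≤ m (f≤g ∘ (false ∷_)))

  ∑ⱽ-distrib-+ : ∀ m f g → ∑ⱽ m (λ x → f x + g x) ≈ ∑ⱽ m f + ∑ⱽ m g
  ∑ⱽ-distrib-+ zero    f g = ≈-refl
  ∑ⱽ-distrib-+ (suc m) f g = ≈-trans (+-cong (∑ⱽ-distrib-+ m _ _) (∑ⱽ-distrib-+ m _ _)) (interchange _ _ _ _)

  ∑ⱽ-flip : ∀ m f j → ∑ⱽ m (λ x → f (Vec.updateAt x j not)) ≈ ∑ⱽ m f
  ∑ⱽ-flip (suc m) f zero    = +-comm _ _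
  ∑ⱽ-flip (suc m) f (suc j) = +-cong (∑ⱽ-flip m _ j) (∑ⱽ-flip m _ j)

  ∑-∑ⱽ-comm : ∀ k m (f : Fin k → Vec Bool m → A) → sum (λ j → ∑ⱽ m (f j)) ≈ ∑ⱽ m λ x → sum λ j → f j x
  ∑-∑ⱽ-comm k zero    f = ≈-refl
  ∑-∑ⱽ-comm k (suc m) f = ≈-trans (∑-distrib-+ {k} _ _) (+-cong (∑-∑ⱽ-comm k m _) (∑-∑ⱽ-comm k m _))

  0≤sum : ∀ {m} {f : Fin m → A} → (∀ j → 0# ≤ f j) → 0# ≤ sum f
  0≤sum {m} 0≤f = ≤-trans (≤-reflexive (≈-sym (sum-replicate-zero m))) (sum-mono-≤ {m} 0≤f)

  term≤sum : ∀ {m} {f : Fin m → A} → (∀ j → 0# ≤ f j) → ∀ i → f i ≤ sum f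
  term≤sum {suc m} 0≤f zero    =
    ≤-trans (≤-reflexive (≈-sym (+-identityʳ _))) (+-mono-≤ ≤-refl (0≤sum {m} (0≤f ∘ suc)))
  term≤sum {suc m} 0≤f (suc i) =
    ≤-trans (≤-reflexive (≈-sym (+-identityˡ _))) (+-mono-≤ (0≤f zero) (term≤sum {m} (0≤f ∘ suc) i))

  sum-↑ˡ-≤ : ∀ m {m′} {f : Fin (m ℕ.+ m′) → A} → (∀ i → 0# ≤ f i) → sum (λ j → f (j Fin.↑ˡ m′)) ≤ sum f
  sum-↑ˡ-≤ zero    {m′} 0≤f = 0≤sum {m′} 0≤f
  sum-↑ˡ-≤ (suc m) {m′} 0≤f = +-mono-≤ ≤-refl (sum-↑ˡ-≤ m {m′} (0≤f ∘ suc))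

  -- `W₀` belongs to the centre and `W i` to the leaf `i`. The weights of the centre add up to one
  -- total over all positions, whereas a leaf is bounded at its own position by its whole total `r`.
  -- The factor `κ` later balances these two contributions.
  star-edges : ∀ {m} {W₀ : Fin m → A} {W : Fin m → Fin m → A} {e c κ r} →
    (∀ {x y} → x ≤ y → (c * x) ≤ (c * y)) → (∀ i j → 0# ≤ W i j) → (∀ i → sum (W i) ≈ r) →
    (∀ i → e ≤ (c * (κ * W₀ i + W i i))) →
    sum {m} (λ _ → e) ≤ (c * (κ * sum W₀ + sum {m} λ _ → r))
  star-edges {m} {W₀} {W} {e} {c} {κ} {r} c-mono 0≤W ∑W≈r edge = begin
    sum {m} (λ _ → e)
      ≲⟨ sum-mono-≤ {m} (λ i → ≤-trans (edge i) (c-mono (+-mono-≤ ≤-refl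
           (≤-trans (term≤sum {m} (0≤W i) i) (≤-reflexive (∑W≈r i)))))) ⟩
    sum (λ i → c * (κ * W₀ i + r))
      ≈⟨ *-distribˡ-sum {m} c _ ⟨
    c * sum (λ i → κ * W₀ i + r)
      ≈⟨ *-congˡ (≈-trans (∑-distrib-+ {m} _ _) (+-congʳ (≈-sym (*-distribˡ-sum {m} κ W₀)))) ⟩
    c * (κ * sum W₀ + sum {m} λ _ → r) ∎
    where open ≲-Reasoning preorder

  -- Flipping a bit permutes the cube, so both endpoints of the edges
  -- contribute the same total.
  cube-edges : ∀ {m m′} (W : Vec Bool m → Fin (m ℕ.+ m′) → A) → (∀ x i → 0# ≤ W x i) → ∀ {e} →
    (∀ x (j : Fin m) → e ≤ (W x (j Fin.↑ˡ m′) + W (Vec.updateAt x j not) (j Fin.↑ˡ m′))) →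
    ∑ⱽ m (λ _ → ∑[ _ < m ] e) ≤ (∑ⱽ m (λ x → sum (W x)) + ∑ⱽ m (λ x → sum (W x)))
  cube-edges {m} {m′} W 0≤W {e} edge = begin
    ∑ⱽ m (λ _ → ∑[ _ < m ] e)
      ≲⟨ ∑ⱽ-mono-≤ m (λ x → sum-mono-≤ {m} (edge x)) ⟩
    ∑ⱽ m (λ x → sum λ j → V x j + V (Vec.updateAt x j not) j)
      ≈⟨ ∑-∑ⱽ-comm m m _ ⟨
    sum (λ j → ∑ⱽ m λ x → V x j + V (Vec.updateAt x j not) j)
      ≈⟨ sum-cong-≋ {m} (λ j → ≈-trans (∑ⱽ-distrib-+ m _ _) (+-congˡ (∑ⱽ-flip m (λ x → V x j) j))) ⟩
    sum (λ j → ∑ⱽ m (λ x → V x j) + ∑ⱽ m λ x → V x j)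
      ≈⟨ ∑-distrib-+ {m} _ _ ⟩
    sum (λ j → ∑ⱽ m λ x → V x j) + sum (λ j → ∑ⱽ m λ x → V x j)
      ≈⟨ +-cong (∑-∑ⱽ-comm m m _) (∑-∑ⱽ-comm m m _) ⟩
    ∑ⱽ m (λ x → sum (V x)) + ∑ⱽ m (λ x → sum (V x))
      ≲⟨ +-mono-≤ V≤W V≤W ⟩
    ∑ⱽ m (λ x → sum (W x)) + ∑ⱽ m (λ x → sum (W x)) ∎
    where
    open ≲-Reasoning preorder
    V : Vec Bool m → Fin m → A
    V x j = W x (j Fin.↑ˡ m′)
    V≤W : ∑ⱽ m (λ x → sum (V x)) ≤ ∑ⱽ m (λ x → sum (W x))
    V≤W = ∑ⱽ-mono-≤ m λ x → sum-↑ˡ-≤ m (0≤W x)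

-- The adversary argument sees an algorithm only through these two invariances; `QueryBound.model`
-- supplies the actual unitaries and oracle.
record QueryModel (O : OrderedRing) (n σ w : ℕ) : Set₁ where
  open OrderedRing O using (commutativeRing)
  open CommutativeRing commutativeRing using (_≈_) renaming (Carrier to A)
  open BasisSum commutativeRing n σ w
  field
    Amplitude : Set
    Operation : Set
    dot       : Amplitude → Amplitude → A

  State : Set
  State = Basis n σ w → Amplitude

  ⟨_,_⟩ : State → State → A
  ⟨ φ , ψ ⟩ = ∑ᴮ λ s → dot (φ s) (ψ s)

  -- The share of the overlap in which position `i` is about to be queried. On the diagonal it is
  -- the squared amplitude of querying `i`.
  slice : State → State → Fin n → A
  slice φ ψ i = ∑₂ λ b k → dot (φ (i , b , k)) (ψ (i , b , k))

  field
    act          : Operation → State → State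
    act-isometry : ∀ U φ ψ → ⟨ act U φ , act U ψ ⟩ ≈ ⟨ φ , ψ ⟩
    query        : Text σ n → State → State
    query-local  : ∀ x y i → lookup x i ≡ lookup y i → ∀ φ ψ → slice (query x φ) (query y ψ) i ≈ slice φ ψ i

module Adversary (O : OrderedRing) (n σ w : ℕ) (M : QueryModel O n σ w) where
  open OrderedRing O
  open CommutativeRing commutativeRing hiding (zero)
    renaming (Carrier to A; refl to ≈-refl; sym to ≈-sym; trans to ≈-trans)
  open IsPreorder isPreorder using () renaming (refl to ≤-refl; reflexive to ≤-reflexive; trans to ≤-trans)
  open CommutativeSemigroupProperties +-commutativeSemigroup using (interchange; x∙yz≈y∙xz)
  open FinSum commutativeRing
  open OrderedSum O
  open BasisSum commutativeRing n σ w
  open QueryModel M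

  evolve : ∀ {q} → State → Vec Operation q → Text σ n → State
  evolve ψ Us T = Vec.foldl (λ _ → State) (λ ψ U → act U (query T ψ)) ψ Us

  -- The Wᵢ of the overview: the diagonal slices just before each query, added up.
  queryWeight : ∀ {q} → State → Vec Operation q → Text σ n → Fin n → A
  queryWeight ψ []       T i = 0#
  queryWeight ψ (U ∷ Us) T i = slice ψ ψ i + queryWeight (act U (query T ψ)) Us T i

  ∑₂-mono-≤ : ∀ {f g} → (∀ b k → f b k ≤ g b k) → ∑₂ f ≤ ∑₂ g
  ∑₂-mono-≤ f≤g = sum-mono-≤ {σ} λ b → sum-mono-≤ {w} (f≤g b)

  ∑ᴮ-mono-≤ : ∀ {f g} → (∀ s → f s ≤ g s) → ∑ᴮ f ≤ ∑ᴮ g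
  ∑ᴮ-mono-≤ f≤g = sum-mono-≤ {n} λ i → ∑₂-mono-≤ λ b k → f≤g (i , b , k)

  -- A text agrees with itself everywhere, so `query-local` applies at every position and the query
  -- preserves the norm.
  step-isometry : ∀ U T ψ → ⟨ act U (query T ψ) , act U (query T ψ) ⟩ ≈ ⟨ ψ , ψ ⟩
  step-isometry U T ψ = ≈-trans (act-isometry U _ _) (sum-cong-≋ {n} λ i → query-local T T i refl ψ ψ)

  evolve-norm : ∀ {q} ψ (Us : Vec Operation q) T → ⟨ evolve ψ Us T , evolve ψ Us T ⟩ ≈ ⟨ ψ , ψ ⟩
  evolve-norm ψ []       T = ≈-refl
  evolve-norm ψ (U ∷ Us) T = ≈-trans (evolve-norm _ Us T) (step-isometry U T ψ)

  -- Before each query the slices over all positions make up the full squared norm, which never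
  -- changes.
  sum-queryWeight : ∀ {q x} ψ (Us : Vec Operation q) T → ⟨ ψ , ψ ⟩ ≈ x → sum (queryWeight ψ Us T) ≈ ∑[ _ < q ] x
  sum-queryWeight ψ []       T ψψ≈x = sum-replicate-zero n
  sum-queryWeight ψ (U ∷ Us) T ψψ≈x = ≈-trans (∑-distrib-+ {n} (slice ψ ψ) _)
    (+-cong ψψ≈x (sum-queryWeight _ Us T (≈-trans (step-isometry U T ψ) ψψ≈x)))

  queryWeight-nonneg : (∀ u → 0# ≤ dot u u) → ∀ {q} ψ (Us : Vec Operation q) T i → 0# ≤ queryWeight ψ Us T i
  queryWeight-nonneg 0≤dot ψ []       T i = ≤-refl
  queryWeight-nonneg 0≤dot ψ (U ∷ Us) T i = ≤-trans (≤-reflexive (≈-sym (+-identityˡ 0#)))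
    (+-mono-≤ 0≤slice (queryWeight-nonneg 0≤dot _ Us T i))
    where
    0≤slice : 0# ≤ slice ψ ψ i
    0≤slice = ≤-trans (≤-reflexive (≈-sym (∑₂-zero λ b k → ≈-refl)))
      (∑₂-mono-≤ λ b k → 0≤dot (ψ (i , b , k)))

  -- `c` and `κ` stand for 2k and k². The hypotheses are AM-GM with both signs: ±2k uv ≤ k²u² + v².
  module _ (c κ : A)
    (dot-≤ : ∀ u v → (c * dot u v) ≤ (κ * dot u u + dot v v))
    (dot-≥ : ∀ u v → 0# ≤ (c * dot u v + (κ * dot u u + dot v v))) where

    weight : State → State → Fin n → A
    weight φ ψ i = κ * slice φ φ i + slice ψ ψ i

    ∑₂-weight : ∀ φ ψ i → ∑₂ (λ b k → κ * dot (φ (i , b , k)) (φ (i , b , k)) + dot (ψ (i , b , k)) (ψ (i , b , k)))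
                        ≈ weight φ ψ i
    ∑₂-weight φ ψ i = ≈-trans (∑₂-distrib-+ _ _) (+-congʳ (≈-sym (*-distribˡ-∑₂ κ _)))

    slice-≤ : ∀ φ ψ i → (c * slice φ ψ i) ≤ weight φ ψ i
    slice-≤ φ ψ i = ≤-trans (≤-reflexive (*-distribˡ-∑₂ c _))
      (≤-trans (∑₂-mono-≤ λ b k → dot-≤ (φ (i , b , k)) (ψ (i , b , k))) (≤-reflexive (∑₂-weight φ ψ i)))

    slice-≥ : ∀ φ ψ i → 0# ≤ (c * slice φ ψ i + weight φ ψ i)
    slice-≥ φ ψ i = ≤-trans (≤-reflexive (≈-sym (∑₂-zero λ b k → ≈-refl)))
      (≤-trans (∑₂-mono-≤ λ b k → dot-≥ (φ (i , b , k)) (ψ (i , b , k)))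
        (≤-reflexive (≈-trans (∑₂-distrib-+ _ _)
          (+-cong (≈-sym (*-distribˡ-∑₂ c _)) (∑₂-weight φ ψ i)))))

    module _ (x y : Text σ n) (i : Fin n) (x≡y : ∀ j → j ≢ i → lookup x j ≡ lookup y j) where

      -- After scaling by `c`, the slice at `i` is at most `e` before the query and at least `-e`
      -- after it. The same `e` serves twice because the query preserves the diagonal slices of both
      -- states.
      query-progress : ∀ φ ψ → (c * ⟨ φ , ψ ⟩) ≤
        (c * ⟨ query x φ , query y ψ ⟩ + (weight φ ψ i + weight φ ψ i))
      query-progress φ ψ = begin
        c * ⟨ φ , ψ ⟩
          ≈⟨ *-distribˡ-sum {n} c (slice φ ψ) ⟩
        sum (λ j → c * slice φ ψ j)
          ≲⟨ sum-≤-except {n} i (λ j j≢i → *-congˡ (≈-sym (query-local x y j (x≡y j j≢i) φ ψ))) at-i ⟩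
        sum (λ j → c * slice (query x φ) (query y ψ) j) + (e + e)
          ≈⟨ +-congʳ (*-distribˡ-sum {n} c (slice (query x φ) (query y ψ))) ⟨
        c * ⟨ query x φ , query y ψ ⟩ + (e + e) ∎
        where
        open ≲-Reasoning preorder
        e = weight φ ψ i
        at-i : (c * slice φ ψ i) ≤ (c * slice (query x φ) (query y ψ) i + (e + e))
        at-i = begin
          c * slice φ ψ i
            ≲⟨ slice-≤ φ ψ i ⟩
          e
            ≈⟨ +-identityʳ e ⟨
          e + 0#
            ≲⟨ +-mono-≤ ≤-refl (slice-≥ (query x φ) (query y ψ) i) ⟩
          e + (c * slice (query x φ) (query y ψ) i + weight (query x φ) (query y ψ) i)
            ≈⟨ +-congˡ (+-congˡ (+-cong (*-congˡ (query-local x x i refl φ φ)) (query-local y y i refl ψ ψ))) ⟩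
          e + (c * slice (query x φ) (query y ψ) i + e)
            ≈⟨ x∙yz≈y∙xz _ _ _ ⟩
          c * slice (query x φ) (query y ψ) i + (e + e) ∎

      -- Telescopes `query-progress` over all queries; the unitaries in between leave the overlap
      -- unchanged.
      progress : ∀ {q} φ ψ (Us : Vec Operation q) (let E = κ * queryWeight φ Us x i + queryWeight ψ Us y i) →
        (c * ⟨ φ , ψ ⟩) ≤ (c * ⟨ evolve φ Us x , evolve ψ Us y ⟩ + (E + E))
      progress φ ψ [] = ≤-reflexive (≈-sym (≈-trans (+-congˡ (≈-trans (+-cong E≈0 E≈0) (+-identityˡ 0#))) (+-identityʳ _)))
        where
        E≈0 : κ * 0# + 0# ≈ 0#
        E≈0 = ≈-trans (+-identityʳ _) (zeroʳ κ)
      progress φ ψ (U ∷ Us) = begin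
        c * ⟨ φ , ψ ⟩
          ≲⟨ query-progress φ ψ ⟩
        c * ⟨ query x φ , query y ψ ⟩ + (e + e)
          ≈⟨ +-congʳ (*-congˡ (act-isometry U (query x φ) (query y ψ))) ⟨
        c * ⟨ φ′ , ψ′ ⟩ + (e + e)
          ≲⟨ +-mono-≤ (progress φ′ ψ′ Us) ≤-refl ⟩
        (c * ⟨ evolve φ′ Us x , evolve ψ′ Us y ⟩ + (E + E)) + (e + e)
          ≈⟨ ≈-trans (+-assoc _ _ _) (+-congˡ (≈-trans (+-comm _ _) (interchange _ _ _ _))) ⟩
        c * ⟨ evolve φ′ Us x , evolve ψ′ Us y ⟩ + ((e + E) + (e + E))
          ≈⟨ +-congˡ (+-cong e+E e+E) ⟩
        c * ⟨ evolve φ′ Us x , evolve ψ′ Us y ⟩ + _ ∎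
        where
        open ≲-Reasoning preorder
        φ′ = act U (query x φ)
        ψ′ = act U (query y ψ)
        e = weight φ ψ i
        E = κ * queryWeight φ′ Us x i + queryWeight ψ′ Us y i
        e+E : e + E ≈ κ * queryWeight φ (U ∷ Us) x i + queryWeight ψ (U ∷ Us) y i
        e+E = ≈-trans (interchange _ _ _ _) (+-congʳ (≈-sym (distribˡ κ _ _)))

  -- Lifts `dot-distinguish` from amplitudes to states, where its conditional terms add up to the
  -- two success probabilities.
  ∑ᴮ-mono-≤-linear : ∀ c d e (f a b g h : Basis n σ w → A) →
    (∀ s → (c * f s + (d * a s + d * b s)) ≤ (e * g s + e * h s)) →
    (c * ∑ᴮ f + (d * ∑ᴮ a + d * ∑ᴮ b)) ≤ (e * ∑ᴮ g + e * ∑ᴮ h)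
  ∑ᴮ-mono-≤-linear c d e f a b g h f≤g = begin
    c * ∑ᴮ f + (d * ∑ᴮ a + d * ∑ᴮ b)
      ≈⟨ +-cong (*-distribˡ-∑ᴮ c f) (linear d a b) ⟩
    ∑ᴮ (λ s → c * f s) + ∑ᴮ (λ s → d * a s + d * b s)
      ≈⟨ ∑ᴮ-distrib-+ (λ s → c * f s) (λ s → d * a s + d * b s) ⟨
    ∑ᴮ (λ s → c * f s + (d * a s + d * b s))
      ≲⟨ ∑ᴮ-mono-≤ f≤g ⟩
    ∑ᴮ (λ s → e * g s + e * h s)
      ≈⟨ linear e g h ⟨
    e * ∑ᴮ g + e * ∑ᴮ h ∎
    where
    open ≲-Reasoning preorder
    linear : ∀ c f g → c * ∑ᴮ f + c * ∑ᴮ g ≈ ∑ᴮ λ s → c * f s + c * g s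
    linear c f g = ≈-trans (+-cong (*-distribˡ-∑ᴮ c f) (*-distribˡ-∑ᴮ c g))
      (≈-sym (∑ᴮ-distrib-+ (λ s → c * f s) (λ s → c * g s)))

-- Inequalities between amplitudes

0≤p*p : ∀ p → 0ℚ ℚ.≤ p ℚ.* p
0≤p*p p with ℚ.≤-total 0ℚ p
... | inj₁ 0≤p = subst (ℚ._≤ p ℚ.* p) (ℚ.*-zeroʳ p) (ℚ.*-monoˡ-≤-nonNeg p {{ℚ.nonNegative 0≤p}} 0≤p)
... | inj₂ p≤0 = subst (ℚ._≤ p ℚ.* p) (ℚ.*-zeroʳ p) (ℚ.*-monoˡ-≤-nonPos p {{ℚ.nonPositive p≤0}} p≤0)

-- The common pattern of the inequalities below: `r` is an explicit sum of squares and the equation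
-- is a polynomial identity.
≤-by-nonneg : ∀ p {q r} → 0ℚ ℚ.≤ r → p ℚ.+ r ≡ q → p ℚ.≤ q
≤-by-nonneg p {q} {r} 0≤r p+r≡q =
  subst₂ ℚ._≤_ (ℚ.+-identityʳ p) p+r≡q (ℚ.+-monoʳ-≤ p 0≤r)

0≤p*p+q*q : ∀ p q → 0ℚ ℚ.≤ p ℚ.* p ℚ.+ q ℚ.* q
0≤p*p+q*q p q = ℚ.+-mono-≤ (0≤p*p p) (0≤p*p q)

dot : ℂ → ℂ → ℝ
dot u v = re u *ℝ re v +ℝ im u *ℝ im v

0≤dot : ∀ u → 0ℝ ≤ℝ dot u u
0≤dot u = ≤ℝ-pointwise {0ℝ} {dot u u} λ n → 0≤p*p+q*q (approx (re u) n) (approx (im u) n)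

dot-≤ : ∀ k u v → fromℚ (k ℚ.+ k) *ℝ dot u v ≤ℝ fromℚ (k ℚ.* k) *ℝ dot u u +ℝ dot v v
dot-≤ k u v = ≤ℝ-pointwise {fromℚ (k ℚ.+ k) *ℝ dot u v} {fromℚ (k ℚ.* k) *ℝ dot u u +ℝ dot v v} λ n →
  let a = approx (re u) n ; b = approx (im u) n ; c = approx (re v) n ; d = approx (im v) n in
  ≤-by-nonneg _ (0≤p*p+q*q (k ℚ.* a ℚ.- c) (k ℚ.* b ℚ.- d))
    (solve 5 (λ k a b c d → (k :+ k) :* (a :* c :+ b :* d) :+
        ((k :* a :- c) :* (k :* a :- c) :+ (k :* b :- d) :* (k :* b :- d))
      := k :* k :* (a :* a :+ b :* b) :+ (c :* c :+ d :* d)) refl k a b c d)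

dot-≥ : ∀ k u v → 0ℝ ≤ℝ fromℚ (k ℚ.+ k) *ℝ dot u v +ℝ (fromℚ (k ℚ.* k) *ℝ dot u u +ℝ dot v v)
dot-≥ k u v = ≤ℝ-pointwise {0ℝ} {fromℚ (k ℚ.+ k) *ℝ dot u v +ℝ (fromℚ (k ℚ.* k) *ℝ dot u u +ℝ dot v v)} λ n →
  let a = approx (re u) n ; b = approx (im u) n ; c = approx (re v) n ; d = approx (im v) n in
  ≤-by-nonneg 0ℚ (0≤p*p+q*q (k ℚ.* a ℚ.+ c) (k ℚ.* b ℚ.+ d))
    (solve 5 (λ k a b c d → con 0ℚ :+
        ((k :* a :+ c) :* (k :* a :+ c) :+ (k :* b :+ d) :* (k :* b :+ d))
      := (k :+ k) :* (a :* c :+ b :* d) :+ (k :* k :* (a :* a :+ b :* b) :+ (c :* c :+ d :* d)))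
      refl k a b c d)

5ℚ 9ℚ 12ℚ 18ℚ ⅔ : ℚ
⅔ = + 2 ℚ./ 3
5ℚ  = + 5 ℚ./ 1
9ℚ  = + 9 ℚ./ 1
12ℚ = + 12 ℚ./ 1
18ℚ = + 18 ℚ./ 1

-- Outside the two events 2uv ≤ u² + v²; inside, the weights 4 and 9 satisfy
-- 12uv ≤ 4u² + 9v², which leaves 5u² to spare.
dot-distinguish : ∀ p q u v → (p ≡ true → q ≡ true → ⊥) →
  fromℚ 12ℚ *ℝ dot u v +ℝ (fromℚ 5ℚ *ℝ (if p then ∣ u ∣² else 0ℝ) +ℝ fromℚ 5ℚ *ℝ (if q then ∣ v ∣² else 0ℝ))
    ≤ℝ fromℚ 9ℚ *ℝ dot u u +ℝ fromℚ 9ℚ *ℝ dot v v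
dot-distinguish true true u v ¬p∧q = ⊥-elim (¬p∧q refl refl)
dot-distinguish true false u v _ = ≤ℝ-pointwise {L} {fromℚ 9ℚ *ℝ dot u u +ℝ fromℚ 9ℚ *ℝ dot v v} λ n →
  let a = approx (re u) n ; b = approx (im u) n ; c = approx (re v) n ; d = approx (im v) n
      2a-3c = (a ℚ.+ a) ℚ.- (c ℚ.+ c ℚ.+ c) ; 2b-3d = (b ℚ.+ b) ℚ.- (d ℚ.+ d ℚ.+ d) in
  ≤-by-nonneg _ (0≤p*p+q*q 2a-3c 2b-3d)
    (solve 4 (λ a b c d → con 12ℚ :* (a :* c :+ b :* d) :+ (con 5ℚ :* (a :* a :+ b :* b) :+ con 5ℚ :* con 0ℚ) :+
        (((a :+ a) :- (c :+ c :+ c)) :* ((a :+ a) :- (c :+ c :+ c)) :+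
         ((b :+ b) :- (d :+ d :+ d)) :* ((b :+ b) :- (d :+ d :+ d)))
      := con 9ℚ :* (a :* a :+ b :* b) :+ con 9ℚ :* (c :* c :+ d :* d)) refl a b c d)
  where L = fromℚ 12ℚ *ℝ dot u v +ℝ (fromℚ 5ℚ *ℝ ∣ u ∣² +ℝ fromℚ 5ℚ *ℝ 0ℝ)
dot-distinguish false true u v _ = ≤ℝ-pointwise {L} {fromℚ 9ℚ *ℝ dot u u +ℝ fromℚ 9ℚ *ℝ dot v v} λ n →
  let a = approx (re u) n ; b = approx (im u) n ; c = approx (re v) n ; d = approx (im v) n
      3a-2c = (a ℚ.+ a ℚ.+ a) ℚ.- (c ℚ.+ c) ; 3b-2d = (b ℚ.+ b ℚ.+ b) ℚ.- (d ℚ.+ d) in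
  ≤-by-nonneg _ (0≤p*p+q*q 3a-2c 3b-2d)
    (solve 4 (λ a b c d → con 12ℚ :* (a :* c :+ b :* d) :+ (con 5ℚ :* con 0ℚ :+ con 5ℚ :* (c :* c :+ d :* d)) :+
        (((a :+ a :+ a) :- (c :+ c)) :* ((a :+ a :+ a) :- (c :+ c)) :+
         ((b :+ b :+ b) :- (d :+ d)) :* ((b :+ b :+ b) :- (d :+ d)))
      := con 9ℚ :* (a :* a :+ b :* b) :+ con 9ℚ :* (c :* c :+ d :* d)) refl a b c d)
  where L = fromℚ 12ℚ *ℝ dot u v +ℝ (fromℚ 5ℚ *ℝ 0ℝ +ℝ fromℚ 5ℚ *ℝ ∣ v ∣²)
dot-distinguish false false u v _ = ≤ℝ-trans {L} {L′} {fromℚ 9ℚ *ℝ dot u u +ℝ fromℚ 9ℚ *ℝ dot v v}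
  (≤ℝ-pointwise {L} {L′} λ n → ℚ.+-monoʳ-≤ (approx (fromℚ 12ℚ *ℝ dot u v) n) (ℚ.+-monoʳ-≤ (5ℚ ℚ.* 0ℚ)
    (ℚ.*-monoˡ-≤-nonNeg 5ℚ (0≤p*p+q*q (approx (re v) n) (approx (im v) n)))))
  (dot-distinguish false true u v λ ())
  where
  L  = fromℚ 12ℚ *ℝ dot u v +ℝ (fromℚ 5ℚ *ℝ 0ℝ +ℝ fromℚ 5ℚ *ℝ 0ℝ)
  L′ = fromℚ 12ℚ *ℝ dot u v +ℝ (fromℚ 5ℚ *ℝ 0ℝ +ℝ fromℚ 5ℚ *ℝ ∣ v ∣²)

ℝ-ordered : OrderedRing
ℝ-ordered = record
  { commutativeRing = ℝ-ring
  ; _≤_        = _≤ℝ_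
  ; isPreorder = record
    { isEquivalence = CommutativeRing.isEquivalence ℝ-ring
    ; reflexive     = λ {x} {y} → ≤ℝ-reflexive {x} {y}
    ; trans         = λ {x} {y} {z} → ≤ℝ-trans {x} {y} {z} }
  ; +-mono-≤   = λ {x} {x′} {y} {y′} → +ℝ-mono-≤ {x} {x′} {y} {y′} }

ℝ-preorder : Preorder 0ℓ 0ℓ 0ℓ
ℝ-preorder = OrderedRing.preorder ℝ-ordered

module ℝ-Sum = FinSum ℝ-ring
module ℝ-OrderedSum = OrderedSum ℝ-ordered
module ℝR = CommutativeRing ℝ-ring

ℂ-dot : DotProduct ℂ-ring ℝ-ring
ℂ-dot = record
  { star      = conj
  ; star-cong = λ {u} {v} (p , q) → p , -ℝ-cong {im u} {im v} q
  ; star-0    = ℝR.refl {0ℝ} , ≈ℝ-pointwise { -ℝ 0ℝ} {0ℝ} λ _ → refl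
  ; star-+    = λ u v → ℝR.refl {re u +ℝ re v}
      , ≈ℝ-pointwise { -ℝ (im u +ℝ im v)} { -ℝ im u +ℝ -ℝ im v} λ n →
          ℚ.neg-distrib-+ (approx (im u) n) (approx (im v) n)
  ; star-*    = λ u v →
        ≈ℝ-pointwise {re (conj (u *ℂ v))} {re (conj u *ℂ conj v)} (λ n →
          solve 4 (λ a b c d → a :* c :- b :* d := a :* c :- (:- b) :* (:- d)) refl
            (approx (re u) n) (approx (im u) n) (approx (re v) n) (approx (im v) n))
      , ≈ℝ-pointwise {im (conj (u *ℂ v))} {im (conj u *ℂ conj v)} (λ n →
          solve 4 (λ a b c d → :- (a :* d :+ b :* c) := a :* (:- d) :+ (:- b) :* c) refl
            (approx (re u) n) (approx (im u) n) (approx (re v) n) (approx (im v) n))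
  ; real      = re
  ; real-cong = proj₁
  ; real-0    = ℝR.refl {0ℝ}
  ; real-+    = λ u v → ℝR.refl {re u +ℝ re v}
  ; dot       = dot
  ; dot≈real  = λ u v → ≈ℝ-pointwise {dot u v} {re (conj u *ℂ v)} λ n →
      solve 4 (λ a b c d → a :* c :+ b :* d := a :* c :- (:- b) :* d) refl
        (approx (re u) n) (approx (im u) n) (approx (re v) n) (approx (im v) n) }

-- F is the final overlap of two states that are to be told apart.  Adding 9
-- times the first inequality to 3k/2 times the second eliminates F.
solve-overlap : ∀ k .{{_ : ℚ.Positive k}} F E →
  fromℚ (k ℚ.+ k) *ℝ 1ℝ ≤ℝ fromℚ (k ℚ.+ k) *ℝ F +ℝ (E +ℝ E) →
  fromℚ 12ℚ *ℝ F +ℝ (fromℚ 5ℚ *ℝ fromℚ (+ 2 ℚ./ 3) +ℝ fromℚ 5ℚ *ℝ fromℚ (+ 2 ℚ./ 3)) 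
    ≤ℝ fromℚ 9ℚ *ℝ 1ℝ +ℝ fromℚ 9ℚ *ℝ 1ℝ →
  fromℚ k ≤ℝ fromℚ 18ℚ *ℝ E
solve-overlap k F E h₁ h₂ = begin
  fromℚ k
    ≈⟨ ≈ℝ-pointwise {fromℚ k} {(L₁ +ℝ L₂) -ℝ Z} (λ n →
         solve 2 (λ k F → k := (con 9ℚ :* ((k :+ k) :* con 1ℚ) :+
             con ³⁄₂ :* k :* (con 12ℚ :* F :+ (con 5ℚ :* con ⅔ :+ con 5ℚ :* con ⅔)))
           :- (con 18ℚ :* k :* F :+ con 27ℚ :* k)) refl k (approx F n)) ⟩
  (L₁ +ℝ L₂) -ℝ Z
    ≲⟨ +ℝ-mono-≤ {L₁ +ℝ L₂} {R₁ +ℝ R₂} { -ℝ Z} { -ℝ Z}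
         (+ℝ-mono-≤ {L₁} {R₁} {L₂} {R₂}
           (*ℝ-monoˡ-≤-pos 9ℚ {fromℚ (k ℚ.+ k) *ℝ 1ℝ} {fromℚ (k ℚ.+ k) *ℝ F +ℝ (E +ℝ E)} h₁)
           (*ℝ-monoˡ-≤-pos (³⁄₂ ℚ.* k) {{ℚ.pos*pos⇒pos ³⁄₂ k}}
             {fromℚ 12ℚ *ℝ F +ℝ ⅔ₓ} {fromℚ 9ℚ *ℝ 1ℝ +ℝ fromℚ 9ℚ *ℝ 1ℝ} h₂))
         (≤ℝ-reflexive { -ℝ Z} { -ℝ Z} (ℝR.refl { -ℝ Z})) ⟩
  (R₁ +ℝ R₂) -ℝ Z
    ≈⟨ ≈ℝ-pointwise {(R₁ +ℝ R₂) -ℝ Z} {fromℚ 18ℚ *ℝ E} (λ n →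
         solve 3 (λ k F E → (con 9ℚ :* ((k :+ k) :* F :+ (E :+ E)) :+
             con ³⁄₂ :* k :* (con 9ℚ :* con 1ℚ :+ con 9ℚ :* con 1ℚ))
           :- (con 18ℚ :* k :* F :+ con 27ℚ :* k) := con 18ℚ :* E) refl k (approx F n) (approx E n)) ⟩
  fromℚ 18ℚ *ℝ E ∎
  where
  open ≲-Reasoning ℝ-preorder
  27ℚ ³⁄₂ : ℚ
  27ℚ = + 27 ℚ./ 1
  ³⁄₂ = + 3 ℚ./ 2
  ⅔ₓ Z L₁ L₂ R₁ R₂ : ℝ
  ⅔ₓ = fromℚ 5ℚ *ℝ fromℚ (+ 2 ℚ./ 3) +ℝ fromℚ 5ℚ *ℝ fromℚ (+ 2 ℚ./ 3)
  Z  = fromℚ (18ℚ ℚ.* k) *ℝ F +ℝ fromℚ (27ℚ ℚ.* k)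
  L₁ = fromℚ 9ℚ *ℝ (fromℚ (k ℚ.+ k) *ℝ 1ℝ)
  L₂ = fromℚ (³⁄₂ ℚ.* k) *ℝ (fromℚ 12ℚ *ℝ F +ℝ ⅔ₓ)
  R₁ = fromℚ 9ℚ *ℝ (fromℚ (k ℚ.+ k) *ℝ F +ℝ (E +ℝ E))
  R₂ = fromℚ (³⁄₂ ℚ.* k) *ℝ (fromℚ 9ℚ *ℝ 1ℝ +ℝ fromℚ 9ℚ *ℝ 1ℝ)

-- The bound for a pair of texts that differ at one position

module QueryBound {n σ q : ℕ} {Out : Set} (_≟_ : DecidableEquality Out) (A : QueryAlgorithm σ n q Out) where

  open QueryAlgorithm A
  open Quantum {n} {σ} {w}
  open BasisSum ℝ-ring n σ w
  open ChangeOfBasis ℂ-ring ℝ-ring ℂ-dot n σ w using (dot-invariant; queryOp; queryOp-local)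

  model : QueryModel ℝ-ordered n σ w
  model = record
    { Amplitude    = ℂ
    ; Operation    = Unitary
    ; dot          = dot
    ; act          = λ U → apply (proj₁ U)
    ; act-isometry = λ U → dot-invariant (proj₁ U) (IsUnitary.U†U≈1 (proj₂ U))
    ; query        = queryOp
    ; query-local  = queryOp-local }

  open QueryModel model using (⟨_,_⟩; act-isometry)
  open Adversary ℝ-ordered n σ w model

  ψ₀ : State
  ψ₀ = apply (proj₁ initial) ∣ start ⟩

  ⟨ψ₀,ψ₀⟩≈1 : ⟨ ψ₀ , ψ₀ ⟩ ≈ℝ 1ℝ
  ⟨ψ₀,ψ₀⟩≈1 = ℝR.trans {⟨ ψ₀ , ψ₀ ⟩} {⟨ ∣ start ⟩ , ∣ start ⟩ ⟩} {1ℝ} (act-isometry initial ∣ start ⟩ ∣ start ⟩)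
    (ℝR.trans {⟨ ∣ start ⟩ , ∣ start ⟩ ⟩} {dot (δ start start) (δ start start)} {1ℝ}
      (∑ᴮ-single (λ s → dot (δ s start) (δ s start)) start λ s s≢start →
        dot-δ (δ s start) 0ℂ 0ℝ (∑C.δᴮ-≢ s≢start) (≈ℝ-pointwise {dot 0ℂ 0ℂ} {0ℝ} λ _ → refl))
      (dot-δ (δ start start) 1ℂ 1ℝ (∑C.δᴮ-≡ {start} {start} refl) (≈ℝ-pointwise {dot 1ℂ 1ℂ} {1ℝ} λ _ → refl)))
    where
    module ∑C = BasisSum ℂ-ring n σ w
    dot-δ : ∀ u v x → u ≡ v → dot v v ≈ℝ x → dot u u ≈ℝ x
    dot-δ u .u x refl uu≈x = uu≈x

  W : Text σ n → Fin n → ℝ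
  W = queryWeight ψ₀ unitaries

  0≤W : ∀ T i → 0ℝ ≤ℝ W T i
  0≤W = queryWeight-nonneg 0≤dot ψ₀ unitaries

  ∑W≈q : ∀ T → ℝ-Sum.sum (W T) ≈ℝ ℝ-Sum.sum {q} λ _ → 1ℝ
  ∑W≈q T = sum-queryWeight ψ₀ unitaries T ⟨ψ₀,ψ₀⟩≈1

  norm-final : ∀ T → ⟨ finalState T , finalState T ⟩ ≈ℝ 1ℝ
  norm-final T = ℝR.trans {⟨ finalState T , finalState T ⟩} {⟨ ψ₀ , ψ₀ ⟩} {1ℝ}
    (evolve-norm ψ₀ unitaries T) ⟨ψ₀,ψ₀⟩≈1

  -- Distinct outputs are disjoint events of the final measurement: no basis state is decoded to
  -- both, which is the hypothesis of `dot-distinguish`.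
  final-overlap : ∀ x y {o o′} → o ≢ o′ →
    fromℚ 12ℚ *ℝ ⟨ finalState x , finalState y ⟩
      +ℝ (fromℚ 5ℚ *ℝ probability _≟_ x o +ℝ fromℚ 5ℚ *ℝ probability _≟_ y o′)
    ≤ℝ fromℚ 9ℚ *ℝ ⟨ finalState x , finalState x ⟩ +ℝ fromℚ 9ℚ *ℝ ⟨ finalState y , finalState y ⟩
  final-overlap x y {o} {o′} o≢o′ = ∑ᴮ-mono-≤-linear (fromℚ 12ℚ) (fromℚ 5ℚ) (fromℚ 9ℚ)
    (λ s → dot (φ s) (ψ s))
    (λ s → if does (output s ≟ o) then ∣ φ s ∣² else 0ℝ)
    (λ s → if does (output s ≟ o′) then ∣ ψ s ∣² else 0ℝ)
    (λ s → dot (φ s) (φ s)) (λ s → dot (ψ s) (ψ s))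
    (λ s → dot-distinguish (does (output s ≟ o)) (does (output s ≟ o′)) (φ s) (ψ s) (disjoint s))
    where
    φ ψ : State
    φ = finalState x
    ψ = finalState y
    disjoint : ∀ s → does (output s ≟ o) ≡ true → does (output s ≟ o′) ≡ true → ⊥
    disjoint s p p′ with output s ≟ o | output s ≟ o′
    ... | yes refl | yes o≡o′ = o≢o′ o≡o′

  -- Both runs begin in `ψ₀`, which does not depend on the text, so their initial overlap is its
  -- squared norm.
  edge : ∀ k .{{_ : ℚ.Positive k}} x y i → (∀ j → j ≢ i → lookup x j ≡ lookup y j) →
    ∀ {o o′} → o ≢ o′ → fromℚ (+ 2 ℚ./ 3) ≤ℝ probability _≟_ x o → fromℚ (+ 2 ℚ./ 3) ≤ℝ probability _≟_ y o′ →
    fromℚ k ≤ℝ fromℚ 18ℚ *ℝ (fromℚ (k ℚ.* k) *ℝ W x i +ℝ W y i)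
  edge k x y i x≡y {o} {o′} o≢o′ x⇒o y⇒o′ = solve-overlap k F E initial-overlap small-overlap
    where
    open ≲-Reasoning ℝ-preorder
    F E ⅔ₓ : ℝ
    F  = ⟨ finalState x , finalState y ⟩
    E  = fromℚ (k ℚ.* k) *ℝ W x i +ℝ W y i
    ⅔ₓ = fromℚ 5ℚ *ℝ fromℚ (+ 2 ℚ./ 3) +ℝ fromℚ 5ℚ *ℝ fromℚ (+ 2 ℚ./ 3)
    initial-overlap : fromℚ (k ℚ.+ k) *ℝ 1ℝ ≤ℝ fromℚ (k ℚ.+ k) *ℝ F +ℝ (E +ℝ E)
    initial-overlap = begin
      fromℚ (k ℚ.+ k) *ℝ 1ℝ
        ≈⟨ ℝR.*-congˡ {fromℚ (k ℚ.+ k)} {⟨ ψ₀ , ψ₀ ⟩} {1ℝ} ⟨ψ₀,ψ₀⟩≈1 ⟨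
      fromℚ (k ℚ.+ k) *ℝ ⟨ ψ₀ , ψ₀ ⟩
        ≲⟨ progress (fromℚ (k ℚ.+ k)) (fromℚ (k ℚ.* k)) (dot-≤ k) (dot-≥ k) x y i x≡y ψ₀ ψ₀ unitaries ⟩
      fromℚ (k ℚ.+ k) *ℝ F +ℝ (E +ℝ E) ∎
    px py x² y² : ℝ
    px = fromℚ 5ℚ *ℝ probability _≟_ x o
    py = fromℚ 5ℚ *ℝ probability _≟_ y o′
    x² = ⟨ finalState x , finalState x ⟩
    y² = ⟨ finalState y , finalState y ⟩
    small-overlap : fromℚ 12ℚ *ℝ F +ℝ ⅔ₓ ≤ℝ fromℚ 9ℚ *ℝ 1ℝ +ℝ fromℚ 9ℚ *ℝ 1ℝ
    small-overlap = begin
      fromℚ 12ℚ *ℝ F +ℝ ⅔ₓ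
        ≲⟨ +ℝ-mono-≤ {fromℚ 12ℚ *ℝ F} {fromℚ 12ℚ *ℝ F} {⅔ₓ} {px +ℝ py}
             (≤ℝ-reflexive {fromℚ 12ℚ *ℝ F} {fromℚ 12ℚ *ℝ F} (ℝR.refl {fromℚ 12ℚ *ℝ F}))
             (+ℝ-mono-≤ {fromℚ 5ℚ *ℝ fromℚ (+ 2 ℚ./ 3)} {px} {fromℚ 5ℚ *ℝ fromℚ (+ 2 ℚ./ 3)} {py}
               (*ℝ-monoˡ-≤-pos 5ℚ {fromℚ (+ 2 ℚ./ 3)} {probability _≟_ x o} x⇒o)
               (*ℝ-monoˡ-≤-pos 5ℚ {fromℚ (+ 2 ℚ./ 3)} {probability _≟_ y o′} y⇒o′)) ⟩
      fromℚ 12ℚ *ℝ F +ℝ (px +ℝ py)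
        ≲⟨ final-overlap x y o≢o′ ⟩
      fromℚ 9ℚ *ℝ x² +ℝ fromℚ 9ℚ *ℝ y²
        ≈⟨ ℝR.+-cong {fromℚ 9ℚ *ℝ x²} {fromℚ 9ℚ *ℝ 1ℝ} {fromℚ 9ℚ *ℝ y²} {fromℚ 9ℚ *ℝ 1ℝ}
             (ℝR.*-congˡ {fromℚ 9ℚ} {x²} {1ℝ} (norm-final x)) (ℝR.*-congˡ {fromℚ 9ℚ} {y²} {1ℝ} (norm-final y)) ⟩
      fromℚ 9ℚ *ℝ 1ℝ +ℝ fromℚ 9ℚ *ℝ 1ℝ ∎

-- From sums of real weights to bounds on the number of queries

module ℚ-Mult = Mult (CommutativeRing.semiring ℚ.+-*-commutativeRing)

-- As an iterated sum of `1ℚ` it inherits the semiring laws of multiples, and on numerals it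
-- evaluates, for instance to `18ℚ`.
fromℕ : ℕ → ℚ
fromℕ m = m ℚ-Mult.× 1ℚ

fromℕ-+ : ∀ m n → fromℕ (m ℕ.+ n) ≡ fromℕ m ℚ.+ fromℕ n
fromℕ-+ = ℚ-Mult.×-homo-+ 1ℚ

fromℕ-* : ∀ m n → fromℕ (m ℕ.* n) ≡ fromℕ m ℚ.* fromℕ n
fromℕ-* m n = ℚ-Mult.×1-homo-* m n

0≤fromℕ : ∀ m → 0ℚ ℚ.≤ fromℕ m
0≤fromℕ zero    = ℚ.≤-refl
0≤fromℕ (suc m) = ℚ.+-mono-≤ (ℚ.<⇒≤ (ℚ.positive⁻¹ 1ℚ)) (0≤fromℕ m)

0<fromℕ-suc : ∀ m → 0ℚ ℚ.< fromℕ (suc m)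
0<fromℕ-suc m = ℚ.+-mono-<-≤ (ℚ.positive⁻¹ 1ℚ) (0≤fromℕ m)

fromℕ-cancel-≤ : ∀ m n → fromℕ m ℚ.≤ fromℕ n → m ℕ.≤ n
fromℕ-cancel-≤ zero    n       _   = ℕ.z≤n
fromℕ-cancel-≤ (suc m) zero    m≤0 = ⊥-elim (ℚ.<-irrefl refl (ℚ.<-≤-trans (0<fromℕ-suc m) m≤0))
fromℕ-cancel-≤ (suc m) (suc n) m≤n = ℕ.s≤s (fromℕ-cancel-≤ m n
  (subst₂ ℚ._≤_ (-1+1+p≡p (fromℕ m)) (-1+1+p≡p (fromℕ n)) (ℚ.+-monoʳ-≤ (ℚ.- 1ℚ) m≤n)))
  where
  -1+1+p≡p : ∀ p → ℚ.- 1ℚ ℚ.+ (1ℚ ℚ.+ p) ≡ p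
  -1+1+p≡p = solve 1 (λ p → :- con 1ℚ :+ (con 1ℚ :+ p) := p) refl

sum-const : ∀ m p → ℝ-Sum.sum {m} (λ _ → fromℚ p) ≈ℝ fromℚ (fromℕ m ℚ.* p)
sum-const zero    p = ≈ℝ-pointwise {0ℝ} {fromℚ (0ℚ ℚ.* p)} λ _ → sym (ℚ.*-zeroˡ p)
sum-const (suc m) p = ℝR.trans {fromℚ p +ℝ S} {fromℚ p +ℝ fromℚ (fromℕ m ℚ.* p)} {fromℚ (fromℕ (suc m) ℚ.* p)}
  (ℝR.+-congˡ {fromℚ p} {S} {fromℚ (fromℕ m ℚ.* p)} (sum-const m p))
  (≈ℝ-pointwise {fromℚ p +ℝ fromℚ (fromℕ m ℚ.* p)} {fromℚ (fromℕ (suc m) ℚ.* p)} λ _ →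
    solve 2 (λ m p → p :+ m :* p := (con 1ℚ :+ m) :* p) refl (fromℕ m) p)
  where S = ℝ-Sum.sum {m} (λ _ → fromℚ p)

open ℝ-OrderedSum using (∑ⱽ; ∑ⱽ-mono-≤; cube-edges; star-edges)

∑ⱽ-const : ∀ m p → ∑ⱽ m (λ _ → fromℚ p) ≈ℝ fromℚ (fromℕ (2 ℕ.^ m) ℚ.* p)
∑ⱽ-const zero    p = ≈ℝ-pointwise {fromℚ p} {fromℚ (fromℕ 1 ℚ.* p)} λ _ → sym (ℚ.*-identityˡ p)
∑ⱽ-const (suc m) p = ℝR.trans {S +ℝ S} {C +ℝ C} {fromℚ (fromℕ (2 ℕ.^ suc m) ℚ.* p)}
  (ℝR.+-cong {S} {C} {S} {C} (∑ⱽ-const m p) (∑ⱽ-const m p))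
  (≈ℝ-pointwise {C +ℝ C} {fromℚ (fromℕ (2 ℕ.^ suc m) ℚ.* p)} λ _ → begin
    fromℕ (2 ℕ.^ m) ℚ.* p ℚ.+ fromℕ (2 ℕ.^ m) ℚ.* p
      ≡⟨ solve 2 (λ c p → c :* p :+ c :* p := (con 1ℚ :+ (con 1ℚ :+ con 0ℚ)) :* c :* p) refl (fromℕ (2 ℕ.^ m)) p ⟩
    fromℕ 2 ℚ.* fromℕ (2 ℕ.^ m) ℚ.* p
      ≡⟨ cong (ℚ._* p) (fromℕ-* 2 (2 ℕ.^ m)) ⟨
    fromℕ (2 ℕ.^ suc m) ℚ.* p ∎)
  where
  open ≡-Reasoning
  S C : ℝ
  S = ∑ⱽ m λ _ → fromℚ p
  C = fromℚ (fromℕ (2 ℕ.^ m) ℚ.* p)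

-- The choice suc k = 36 q balances the two terms on the right.
balance : ∀ n q → (∀ k → n ℕ.* suc k ℕ.≤ 18 ℕ.* (suc k ℕ.* suc k ℕ.* q ℕ.+ n ℕ.* q)) →
  n ℕ.≤ 1296 ℕ.* (q ℕ.* q)
balance n zero    bound = subst₂ ℕ._≤_ (ℕ.*-identityʳ n) (cong (18 ℕ.*_) (ℕ.*-zeroʳ n)) (bound 0)
balance n (suc r) bound = ℕ.*-cancelˡ-≤ (18 ℕ.* suc r) {{ℕ.m*n≢0 18 (suc r)}}
  (ℕ.+-cancelʳ-≤ (18 ℕ.* (n ℕ.* suc r)) (18 ℕ.* suc r ℕ.* n)
    (18 ℕ.* suc r ℕ.* (1296 ℕ.* (suc r ℕ.* suc r))) (subst₂ ℕ._≤_
    (solveℕ 2 (λ n r → n ⊗ (lit 36 ⊗ r) ⊜ lit 18 ⊗ r ⊗ n ⊕ lit 18 ⊗ (n ⊗ r)) refl n (suc r))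
    (solveℕ 2 (λ n r → lit 18 ⊗ ((lit 36 ⊗ r) ⊗ (lit 36 ⊗ r) ⊗ r ⊕ n ⊗ r)
      ⊜ lit 18 ⊗ r ⊗ (lit 1296 ⊗ (r ⊗ r)) ⊕ lit 18 ⊗ (n ⊗ r)) refl n (suc r))
    (bound (ℕ.pred (36 ℕ.* suc r)))))

module _ {n σ q : ℕ} {Out : Set} (_≟_ : DecidableEquality Out) (A : QueryAlgorithm σ n q Out) where

  open QueryAlgorithm A using (probability)
  open QueryBound _≟_ A using (W; 0≤W; ∑W≈q; edge)

  opaque
    -- An edge of the adversary graph, labelled with the position where its ends differ. The outputs
    -- are existential, so the counting below speaks of texts only.
    Distinguishes : Text σ n → Text σ n → Fin n → Set
    Distinguishes x y i = (∀ j → j ≢ i → lookup x j ≡ lookup y j) × ∃[ o ] ∃[ o′ ] (o ≢ o′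
      × fromℚ (+ 2 ℚ./ 3) ≤ℝ probability _≟_ x o × fromℚ (+ 2 ℚ./ 3) ≤ℝ probability _≟_ y o′)

    mkDistinguishes : ∀ {x y i o o′} → (∀ j → j ≢ i → lookup x j ≡ lookup y j) → o ≢ o′ →
      fromℚ (+ 2 ℚ./ 3) ≤ℝ probability _≟_ x o → fromℚ (+ 2 ℚ./ 3) ≤ℝ probability _≟_ y o′ → Distinguishes x y i
    mkDistinguishes {o = o} {o′} agree o≢o′ x⇒o y⇒o′ = agree , o , o′ , o≢o′ , x⇒o , y⇒o′

    distinguishes-edge : ∀ k .{{_ : ℚ.Positive k}} {x y i} → Distinguishes x y i →
      fromℚ k ≤ℝ fromℚ 18ℚ *ℝ (fromℚ (k ℚ.* k) *ℝ W x i +ℝ W y i)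
    distinguishes-edge k {x} {y} {i} (agree , o , o′ , o≢o′ , x⇒o , y⇒o′) =
      edge k x y i agree {o} {o′} o≢o′ x⇒o y⇒o′

  ∑W≈ : ∀ T → ℝ-Sum.sum (W T) ≈ℝ fromℚ (fromℕ q)
  ∑W≈ T = ℝR.trans {ℝ-Sum.sum (W T)} {ℝ-Sum.sum {q} λ _ → 1ℝ} {fromℚ (fromℕ q)} (∑W≈q T)
    (ℝR.trans {ℝ-Sum.sum {q} λ _ → 1ℝ} {fromℚ (fromℕ q ℚ.* 1ℚ)} {fromℚ (fromℕ q)}
      (sum-const q 1ℚ) (≈ℝ-pointwise {fromℚ (fromℕ q ℚ.* 1ℚ)} {fromℚ (fromℕ q)} λ _ → ℚ.*-identityʳ (fromℕ q)))

  -- One edge per position, each scaled by `suc k`, which is positive for every `k`; the choice of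
  -- `k` is left to `balance`.
  star-bound : (x₀ : Text σ n) (x : Fin n → Text σ n) → (∀ i → Distinguishes x₀ (x i) i) → ∀ k →
    n ℕ.* suc k ℕ.≤ 18 ℕ.* (suc k ℕ.* suc k ℕ.* q ℕ.+ n ℕ.* q)
  star-bound x₀ x d k = fromℕ-cancel-≤ _ _ (subst₂ ℚ._≤_ (sym (fromℕ-* n (suc k))) (sym rhs)
    (fromℚ-cancel-≤ {fromℕ n ℚ.* κ} {18ℚ ℚ.* (κ ℚ.* κ ℚ.* fromℕ q ℚ.+ fromℕ n ℚ.* fromℕ q)} (begin
      fromℚ (fromℕ n ℚ.* κ)
        ≈⟨ sum-const n κ ⟨
      ℝ-Sum.sum {n} (λ _ → fromℚ κ)
        ≲⟨ star-edges {n} {W x₀} {λ i → W (x i)} {fromℚ κ} {fromℚ 18ℚ} {fromℚ (κ ℚ.* κ)} {fromℚ (fromℕ q)}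
             (λ {u} {v} → *ℝ-monoˡ-≤-pos 18ℚ {u} {v}) (λ i → 0≤W (x i)) (λ i → ∑W≈ (x i))
             (λ i → distinguishes-edge κ {{ℚ.positive (0<fromℕ-suc k)}} {x₀} {x i} {i} (d i)) ⟩
      fromℚ 18ℚ *ℝ (fromℚ (κ ℚ.* κ) *ℝ ℝ-Sum.sum (W x₀) +ℝ ℝ-Sum.sum {n} λ _ → fromℚ (fromℕ q))
        ≈⟨ ℝR.*-congˡ {fromℚ 18ℚ} {fromℚ (κ ℚ.* κ) *ℝ ℝ-Sum.sum (W x₀) +ℝ (ℝ-Sum.sum {n} λ _ → fromℚ (fromℕ q))}
             {fromℚ (κ ℚ.* κ) *ℝ fromℚ (fromℕ q) +ℝ fromℚ (fromℕ n ℚ.* fromℕ q)}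
             (ℝR.+-cong {fromℚ (κ ℚ.* κ) *ℝ ℝ-Sum.sum (W x₀)} {fromℚ (κ ℚ.* κ) *ℝ fromℚ (fromℕ q)}
               {ℝ-Sum.sum {n} λ _ → fromℚ (fromℕ q)} {fromℚ (fromℕ n ℚ.* fromℕ q)}
               (ℝR.*-congˡ {fromℚ (κ ℚ.* κ)} {ℝ-Sum.sum (W x₀)} {fromℚ (fromℕ q)} (∑W≈ x₀)) (sum-const n (fromℕ q))) ⟩
      fromℚ 18ℚ *ℝ (fromℚ (κ ℚ.* κ) *ℝ fromℚ (fromℕ q) +ℝ fromℚ (fromℕ n ℚ.* fromℕ q))
        ≈⟨ ≈ℝ-pointwise {fromℚ 18ℚ *ℝ (fromℚ (κ ℚ.* κ) *ℝ fromℚ (fromℕ q) +ℝ fromℚ (fromℕ n ℚ.* fromℕ q))}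
             {fromℚ (18ℚ ℚ.* (κ ℚ.* κ ℚ.* fromℕ q ℚ.+ fromℕ n ℚ.* fromℕ q))} (λ _ → refl) ⟩
      fromℚ (18ℚ ℚ.* (κ ℚ.* κ ℚ.* fromℕ q ℚ.+ fromℕ n ℚ.* fromℕ q)) ∎)))
    where
    open ≲-Reasoning ℝ-preorder
    κ : ℚ
    κ = fromℕ (suc k)
    rhs : fromℕ (18 ℕ.* (suc k ℕ.* suc k ℕ.* q ℕ.+ n ℕ.* q)) ≡
      18ℚ ℚ.* (κ ℚ.* κ ℚ.* fromℕ q ℚ.+ fromℕ n ℚ.* fromℕ q)
    rhs = trans (fromℕ-* 18 (suc k ℕ.* suc k ℕ.* q ℕ.+ n ℕ.* q))
      (cong (18ℚ ℚ.*_) (trans (fromℕ-+ (suc k ℕ.* suc k ℕ.* q) (n ℕ.* q))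
      (cong₂ ℚ._+_ (trans (fromℕ-* (suc k ℕ.* suc k) q)
        (cong (ℚ._* fromℕ q) (fromℕ-* (suc k) (suc k)))) (fromℕ-* n q))))

  search-bound : (x₀ : Text σ n) (x : Fin n → Text σ n) → (∀ i → Distinguishes x₀ (x i) i) →
    n ℕ.≤ 1296 ℕ.* (q ℕ.* q)
  search-bound x₀ x d = balance n q (star-bound x₀ x d)

module _ {m m′ σ q : ℕ} {Out : Set} (_≟_ : DecidableEquality Out) (A : QueryAlgorithm σ (m ℕ.+ m′) q Out) where

  open QueryBound _≟_ A using (W; 0≤W)

  -- Every edge is visited from both of its ends and every vertex spends at most `q` in total, so 2ᵐ
  -- m ≤ 2 · 18 · 2ᵐ q; this is the origin of 36.
  cube-bound : (x : Vec Bool m → Text σ (m ℕ.+ m′)) →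
    (∀ v j → Distinguishes _≟_ A (x v) (x (Vec.updateAt v j not)) (j Fin.↑ˡ m′)) → m ℕ.≤ 36 ℕ.* q
  cube-bound x d = ℕ.*-cancelˡ-≤ (2 ℕ.^ m) {{ℕ.m^n≢0 2 m}} (fromℕ-cancel-≤ _ _ (subst₂ ℚ._≤_ lhs rhs
    (fromℚ-cancel-≤ {fromℕ (2 ℕ.^ m) ℚ.* (fromℕ m ℚ.* 1ℚ)} {c ℚ.+ c} (begin
      fromℚ (fromℕ (2 ℕ.^ m) ℚ.* (fromℕ m ℚ.* 1ℚ))
        ≈⟨ ∑ⱽ-const m (fromℕ m ℚ.* 1ℚ) ⟨
      ∑ⱽ m (λ _ → fromℚ (fromℕ m ℚ.* 1ℚ))
        ≲⟨ ∑ⱽ-mono-≤ m {λ _ → fromℚ (fromℕ m ℚ.* 1ℚ)} {λ _ → ℝ-Sum.sum {m} λ _ → 1ℝ} (λ _ →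
             ≤ℝ-reflexive {fromℚ (fromℕ m ℚ.* 1ℚ)} {ℝ-Sum.sum {m} λ _ → 1ℝ}
               (ℝR.sym {ℝ-Sum.sum {m} λ _ → 1ℝ} {fromℚ (fromℕ m ℚ.* 1ℚ)} (sum-const m 1ℚ))) ⟩
      ∑ⱽ m (λ _ → ℝ-Sum.sum {m} λ _ → 1ℝ)
        ≲⟨ cube-edges {m} {m′} V 0≤V {1ℝ} V-edge ⟩
      ∑ⱽ m (λ v → ℝ-Sum.sum (V v)) +ℝ ∑ⱽ m (λ v → ℝ-Sum.sum (V v))
        ≲⟨ +ℝ-mono-≤ {∑ⱽ m (λ v → ℝ-Sum.sum (V v))} {fromℚ c} {∑ⱽ m (λ v → ℝ-Sum.sum (V v))} {fromℚ c} V-total V-total ⟩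
      fromℚ c +ℝ fromℚ c
        ≈⟨ ≈ℝ-pointwise {fromℚ c +ℝ fromℚ c} {fromℚ (c ℚ.+ c)} (λ _ → refl) ⟩
      fromℚ (c ℚ.+ c) ∎))))
    where
    open ≲-Reasoning ℝ-preorder
    c : ℚ
    c = fromℕ (2 ℕ.^ m) ℚ.* (18ℚ ℚ.* fromℕ q)
    V : Vec Bool m → Fin (m ℕ.+ m′) → ℝ
    V v i = fromℚ 18ℚ *ℝ W (x v) i
    0≤V : ∀ v i → 0ℝ ≤ℝ V v i
    0≤V v i = begin
      0ℝ            ≈⟨ ≈ℝ-pointwise {0ℝ} {fromℚ 18ℚ *ℝ 0ℝ} (λ _ → refl) ⟩
      fromℚ 18ℚ *ℝ 0ℝ ≲⟨ *ℝ-monoˡ-≤-pos 18ℚ {0ℝ} {W (x v) i} (0≤W (x v) i) ⟩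
      V v i         ∎
    V-edge : ∀ v j → 1ℝ ≤ℝ V v (j Fin.↑ˡ m′) +ℝ V (Vec.updateAt v j not) (j Fin.↑ˡ m′)
    V-edge v j = begin
      1ℝ
        ≲⟨ distinguishes-edge _≟_ A 1ℚ {x v} {x (Vec.updateAt v j not)} {j Fin.↑ˡ m′} (d v j) ⟩
      fromℚ 18ℚ *ℝ (fromℚ 1ℚ *ℝ X +ℝ Y)
        ≈⟨ ≈ℝ-pointwise {fromℚ 18ℚ *ℝ (fromℚ 1ℚ *ℝ X +ℝ Y)} {fromℚ 18ℚ *ℝ X +ℝ fromℚ 18ℚ *ℝ Y} (λ n →
             solve 2 (λ a b → con 18ℚ :* (con 1ℚ :* a :+ b) := con 18ℚ :* a :+ con 18ℚ :* b) refl
               (approx X n) (approx Y n)) ⟩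
      fromℚ 18ℚ *ℝ X +ℝ fromℚ 18ℚ *ℝ Y ∎
      where
      X = W (x v) (j Fin.↑ˡ m′)
      Y = W (x (Vec.updateAt v j not)) (j Fin.↑ˡ m′)
    V-total : ∑ⱽ m (λ v → ℝ-Sum.sum (V v)) ≤ℝ fromℚ c
    V-total = begin
      ∑ⱽ m (λ v → ℝ-Sum.sum (V v))
        ≲⟨ ∑ⱽ-mono-≤ m {λ v → ℝ-Sum.sum (V v)} {λ _ → fromℚ (18ℚ ℚ.* fromℕ q)} (λ v → begin
             ℝ-Sum.sum (V v)
               ≈⟨ ℝ-Sum.*-distribˡ-sum {m ℕ.+ m′} (fromℚ 18ℚ) (W (x v)) ⟨
             fromℚ 18ℚ *ℝ ℝ-Sum.sum (W (x v))
               ≈⟨ ℝR.*-congˡ {fromℚ 18ℚ} {ℝ-Sum.sum (W (x v))} {fromℚ (fromℕ q)} (∑W≈ _≟_ A (x v)) ⟩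
             fromℚ 18ℚ *ℝ fromℚ (fromℕ q)
               ≈⟨ ≈ℝ-pointwise {fromℚ 18ℚ *ℝ fromℚ (fromℕ q)} {fromℚ (18ℚ ℚ.* fromℕ q)} (λ _ → refl) ⟩
             fromℚ (18ℚ ℚ.* fromℕ q) ∎) ⟩
      ∑ⱽ m (λ _ → fromℚ (18ℚ ℚ.* fromℕ q))
        ≈⟨ ∑ⱽ-const m (18ℚ ℚ.* fromℕ q) ⟩
      fromℚ c ∎
    lhs : fromℕ (2 ℕ.^ m) ℚ.* (fromℕ m ℚ.* 1ℚ) ≡ fromℕ (2 ℕ.^ m ℕ.* m)
    lhs = trans (cong (fromℕ (2 ℕ.^ m) ℚ.*_) (ℚ.*-identityʳ (fromℕ m))) (sym (fromℕ-* (2 ℕ.^ m) m))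
    rhs : c ℚ.+ c ≡ fromℕ (2 ℕ.^ m ℕ.* (36 ℕ.* q))
    rhs = trans (solve 2 (λ t q → t :* (con 18ℚ :* q) :+ t :* (con 18ℚ :* q) := t :* (con (fromℕ 36) :* q)) refl
      (fromℕ (2 ℕ.^ m)) (fromℕ q))
      (sym (trans (fromℕ-* (2 ℕ.^ m) (36 ℕ.* q)) (cong (fromℕ (2 ℕ.^ m) ℚ.*_) (fromℕ-* 36 q))))

-- LZ77 factorizations

private variable A : Set

-- drop p T ≡ a ∷ drop (suc p) T says that T has the symbol a at position p.
Symbol : List A → ℕ → A → Set
Symbol T p a = drop p T ≡ a ∷ drop (suc p) T

symbol-exists : ∀ (T : List A) p → p ℕ.< length T → ∃[ a ] Symbol T p a
symbol-exists (a ∷ T) zero    _         = a , refl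
symbol-exists (a ∷ T) (suc p) (ℕ.s≤s p<) = symbol-exists T p p<

symbol-lookup : ∀ {n} (v : Vec A n) i → Symbol (toList v) (toℕ i) (lookup v i)
symbol-lookup (a ∷ v) zero    = refl
symbol-lookup (a ∷ v) (suc i) = symbol-lookup v i

take-constant : ∀ (T : List A) a p ℓ → (∀ q → p ℕ.≤ q → q ℕ.< p ℕ.+ ℓ → Symbol T q a) →
  take ℓ (drop p T) ≡ replicate ℓ a
take-constant T a p zero    _     = refl
take-constant T a p (suc ℓ) const = begin
  take (suc ℓ) (drop p T)           ≡⟨ cong (take (suc ℓ)) (const p ℕ.≤-refl (ℕ.m<m+n p ℕ.z<s)) ⟩
  a ∷ take ℓ (drop (suc p) T)       ≡⟨ cong (a ∷_) (take-constant T a (suc p) ℓ λ q p<q q< →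
                                         const q (ℕ.<⇒≤ p<q) (subst (q ℕ.<_) (sym (ℕ.+-suc p ℓ)) q<)) ⟩
  a ∷ replicate ℓ a                 ∎
  where open ≡-Reasoning

take-last : ∀ (xs : List A) ℓ {a ys} → drop ℓ xs ≡ a ∷ ys → drop ℓ (take (suc ℓ) xs) ≡ a ∷ []
take-last (x ∷ xs) zero    refl = refl
take-last (x ∷ xs) (suc ℓ) eq   = take-last xs ℓ eq

module _ (T : List A) where
  open LZ77 T

  -- Equal fragments have equal last symbols. Hence a copied factor repeats its last symbol from an
  -- earlier position.
  fragment-symbols : ∀ {i i′ ℓ a a′} → fragment i (suc ℓ) ≡ fragment i′ (suc ℓ) →
    Symbol T (i ℕ.+ ℓ) a → Symbol T (i′ ℕ.+ ℓ) a′ → a ≡ a′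
  fragment-symbols {i} {i′} {ℓ} same a-at a′-at = List.∷-injectiveˡ (trans
    (sym (take-last (drop i T) ℓ (trans (List.drop-drop i ℓ T) a-at)))
    (trans (cong (drop ℓ) same) (take-last (drop i′ T) ℓ (trans (List.drop-drop i′ ℓ T) a′-at))))

  -- Excludes the constructor `fresh` wherever some longer match exists.
  occurs-shorter : ∀ {i ℓ} → 1 ℕ.≤ ℓ → OccursBefore i ℓ → OccursBefore i 1
  occurs-shorter {i} {ℓ} 1≤ℓ (i′ , i′<i , same) =
    i′ , i′<i , trans (take₁ i′) (trans (cong (take 1) same) (sym (take₁ i)))
    where
    take₁ : ∀ j → fragment j 1 ≡ take 1 (fragment j ℓ)
    take₁ j = trans (cong (λ k → take k (drop j T)) (sym (ℕ.m≤n⇒m⊓n≡m 1≤ℓ))) (sym (List.take-take 1 ℓ (drop j T)))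

  fragment-++ : ∀ i ℓ → fragment i ℓ ++ drop (i ℕ.+ ℓ) T ≡ drop i T
  fragment-++ i ℓ = trans (cong (fragment i ℓ ++_) (sym (List.drop-drop i ℓ T))) (List.take++drop≡id ℓ (drop i T))

  concat-factors : ∀ {i fs} → FactorsFrom i fs → concat fs ≡ drop i T
  concat-factors done = sym (List.drop-all (length T) T ℕ.≤-refl)
  concat-factors (fresh {i} _ _ fac) =
    trans (cong (fragment i 1 ++_) (concat-factors fac)) (fragment-++ i 1)
  concat-factors (copy {i} {ℓ} _ _ _ _ fac) =
    trans (cong (fragment i ℓ ++_) (concat-factors fac)) (fragment-++ i ℓ)

  suc-+ : ∀ k i → suc (k ℕ.+ i) ≡ k ℕ.+ (i ℕ.+ 1)
  suc-+ k i = trans (sym (ℕ.+-suc k i)) (cong (k ℕ.+_) (ℕ.+-comm 1 i))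

  suc-+-≤ : ∀ k i {ℓ} → 1 ℕ.≤ ℓ → suc (k ℕ.+ i) ℕ.≤ k ℕ.+ (i ℕ.+ ℓ)
  suc-+-≤ k i 1≤ℓ = ℕ.≤-trans (ℕ.≤-reflexive (suc-+ k i)) (ℕ.+-monoʳ-≤ k (ℕ.+-monoʳ-≤ i 1≤ℓ))

  length-factors : ∀ {i fs} → FactorsFrom i fs → length fs ℕ.+ i ℕ.≤ length T
  length-factors done = ℕ.≤-refl
  length-factors (fresh {i} {fs} _ _ fac) =
    ℕ.≤-trans (suc-+-≤ (length fs) i ℕ.≤-refl) (length-factors fac)
  length-factors (copy {i} {ℓ} {fs} 1≤ℓ _ _ _ fac) =
    ℕ.≤-trans (suc-+-≤ (length fs) i 1≤ℓ) (length-factors fac)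

  -- Every start from `p` on is allowed, because a greedy factor may reach further than the match
  -- that bounds it from below.
  AtMost : ℕ → ℕ → Set
  AtMost k p = ∀ {q fs} → p ℕ.≤ q → FactorsFrom q fs → length fs ℕ.≤ k

  atMost-end : AtMost 0 (length T)
  atMost-end {q} {fs} end≤q fac = ℕ.+-cancelʳ-≤ q (length fs) 0 (ℕ.≤-trans (length-factors fac) end≤q)

  atMost-step : ∀ {k p} → AtMost k (p ℕ.+ 1) → AtMost (suc k) p
  atMost-step bound p≤q done = ℕ.z≤n
  atMost-step bound p≤q (fresh _ _ fac) = ℕ.s≤s (bound (ℕ.+-monoˡ-≤ 1 p≤q) fac)
  atMost-step bound p≤q (copy 1≤ℓ _ _ _ fac) = ℕ.s≤s (bound (ℕ.+-mono-≤ p≤q 1≤ℓ) fac)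

  -- A factor that starts inside the stretch reaches `e`: stopping earlier would contradict the
  -- maximality of the match, since the rest of the stretch has an earlier occurrence.
  atMost-run : ∀ {k p e} → e ℕ.≤ length T → (∀ q → p ℕ.≤ q → q ℕ.< e → OccursBefore q (e ℕ.∸ q)) →
    AtMost k e → AtMost (suc k) p
  atMost-run {k} {p} {e} e≤T run bound {q} p≤q fac with e ℕ.≤? q
  ... | yes e≤q = ℕ.m≤n⇒m≤1+n (bound e≤q fac)
  ... | no  e≰q = go fac
    where
    q<e : q ℕ.< e
    q<e = ℕ.≰⇒> e≰q
    occ : OccursBefore q (e ℕ.∸ q)
    occ = run q p≤q q<e
    q+e∸q≡e : q ℕ.+ (e ℕ.∸ q) ≡ e
    q+e∸q≡e = ℕ.m+[n∸m]≡n (ℕ.<⇒≤ q<e)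
    go : ∀ {fs} → FactorsFrom q fs → length fs ℕ.≤ suc k
    go done = ℕ.z≤n
    go (fresh _ ¬occ _) = ⊥-elim (¬occ (occurs-shorter (ℕ.m<n⇒0<n∸m q<e) occ))
    go (copy {ℓ = ℓ} _ _ _ maximal fac) with e ℕ.≤? q ℕ.+ ℓ
    ... | yes e≤q+ℓ = ℕ.s≤s (bound e≤q+ℓ fac)
    ... | no  e≰q+ℓ = ⊥-elim (maximal (e ℕ.∸ q) ℓ<e∸q (subst (ℕ._≤ length T) (sym q+e∸q≡e) e≤T) occ)
      where
      ℓ<e∸q : ℓ ℕ.< e ℕ.∸ q
      ℓ<e∸q = ℕ.+-cancelˡ-< q ℓ (e ℕ.∸ q) (subst (q ℕ.+ ℓ ℕ.<_) (sym q+e∸q≡e) (ℕ.≰⇒> e≰q+ℓ))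

  -- A run of one symbol is self-overlapping: it copies from one position earlier.
  occurs-in-run : ∀ {a} q e → 1 ℕ.≤ q → q ℕ.< e → (∀ p → q ℕ.≤ suc p → p ℕ.< e → Symbol T p a) →
    OccursBefore q (e ℕ.∸ q)
  occurs-in-run {a} (suc q) e _ q<e run = q , ℕ.≤-refl , trans
    (take-constant T a q (e ℕ.∸ suc q) λ p q≤p p< → run p (ℕ.s≤s q≤p)
      (ℕ.<-≤-trans p< (ℕ.≤-trans (ℕ.n≤1+n _) (ℕ.≤-reflexive (ℕ.m+[n∸m]≡n (ℕ.<⇒≤ q<e))))))
    (sym (take-constant T a (suc q) (e ℕ.∸ suc q) λ p q<p p< → run p (ℕ.m≤n⇒m≤1+n q<p)
      (subst (p ℕ.<_) (ℕ.m+[n∸m]≡n (ℕ.<⇒≤ q<e)) p<)))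

  -- One factor each is allowed for a start at 0, between 1 and `i`, at `i`, at `i + 1`, and from
  -- `i + 2` on. A run copies from one position earlier, so its first symbol is counted separately;
  -- this accounts for the steps at 0 and `i + 1`.
  sparse-atMost : ∀ {a} i → i ℕ.< length T → (∀ p → p ℕ.< length T → p ≢ i → Symbol T p a) → AtMost 5 0
  sparse-atMost {a} i i<T a-at =
    atMost-step (atMost-run (ℕ.<⇒≤ i<T)
      (λ q 1≤q q<i → occurs-in-run {a} q i 1≤q q<i λ p _ p<i → a-at p (ℕ.<-trans p<i i<T) (ℕ.<⇒≢ p<i))
      (atMost-step (atMost-step (atMost-run ℕ.≤-refl
        (λ q i+2≤q q<T → occurs-in-run {a} q (length T) (ℕ.≤-trans (ℕ.m≤n+m 1 (i ℕ.+ 1)) i+2≤q) q<T λ p q≤1+p p<T →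
          a-at p p<T λ p≡i → ℕ.<⇒≱ (i+1<i+2 p≡i) (ℕ.≤-trans i+2≤q q≤1+p))
        atMost-end))))
    where
    i+1<i+2 : ∀ {p} → p ≡ i → suc p ℕ.< i ℕ.+ 1 ℕ.+ 1
    i+1<i+2 refl = ℕ.≤-reflexive (trans (ℕ.+-comm 2 i) (sym (ℕ.+-assoc i 1 1)))

  -- A copied factor ends by position `m`, for otherwise its last symbol would be new. Beyond `m`
  -- all factors therefore have length 1, and `i ⊔ m` discounts the positions before `m`.
  fresh-atLeast : ∀ m → (∀ p p′ {a a′} → m ℕ.≤ p → p′ ℕ.< p → Symbol T p a → Symbol T p′ a′ → a ≢ a′) →
    ∀ {i fs} → FactorsFrom i fs → length T ℕ.≤ length fs ℕ.+ (i ℕ.⊔ m)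
  fresh-atLeast m distinct done = ℕ.m≤m⊔n (length T) m
  fresh-atLeast m distinct (fresh {i} {fs} _ _ fac) = ℕ.≤-trans (fresh-atLeast m distinct fac)
    (ℕ.≤-trans (ℕ.+-monoʳ-≤ (length fs) (ℕ.⊔-lub
        (ℕ.≤-trans (ℕ.≤-reflexive (ℕ.+-comm i 1)) (ℕ.s≤s (ℕ.m≤m⊔n i m))) (ℕ.m≤n⇒m≤1+n (ℕ.m≤n⊔m i m))))
      (ℕ.≤-reflexive (ℕ.+-suc (length fs) (i ℕ.⊔ m))))
  fresh-atLeast m distinct (copy {i} {suc ℓ} {fs} _ i+ℓ≤T (i′ , i′<i , same) _ fac) with i ℕ.+ suc ℓ ℕ.≤? m
  ... | yes i+ℓ≤m = ℕ.≤-trans (fresh-atLeast m distinct fac) (ℕ.m≤n⇒m≤1+n (ℕ.+-monoʳ-≤ (length fs)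
        (ℕ.≤-trans (ℕ.≤-reflexive (ℕ.m≤n⇒m⊔n≡n i+ℓ≤m)) (ℕ.m≤n⊔m i m))))
  ... | no  i+ℓ≰m = ⊥-elim (distinct (i ℕ.+ ℓ) (i′ ℕ.+ ℓ) m≤i+ℓ (ℕ.+-monoˡ-< ℓ i′<i) (proj₂ a-at) (proj₂ a′-at)
        (fragment-symbols {i} {i′} {ℓ} (sym same) (proj₂ a-at) (proj₂ a′-at)))
    where
    m≤i+ℓ : m ℕ.≤ i ℕ.+ ℓ
    m≤i+ℓ = ℕ.≤-pred (subst (m ℕ.<_) (ℕ.+-suc i ℓ) (ℕ.≰⇒> i+ℓ≰m))
    i+ℓ<T : i ℕ.+ ℓ ℕ.< length T
    i+ℓ<T = ℕ.≤-trans (ℕ.≤-reflexive (sym (ℕ.+-suc i ℓ))) i+ℓ≤T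
    a-at = symbol-exists T (i ℕ.+ ℓ) i+ℓ<T
    a′-at = symbol-exists T (i′ ℕ.+ ℓ) (ℕ.<-trans (ℕ.+-monoˡ-< ℓ i′<i) i+ℓ<T)

  module _ (_≟_ : DecidableEquality A) where

    occursBefore? : ∀ i ℓ → Dec (OccursBefore i ℓ)
    occursBefore? i ℓ = ℕ.anyUpTo? (λ i′ → List.≡-dec _≟_ (fragment i′ ℓ) (fragment i ℓ)) i

    extend-≤ : ∀ {Q : ℕ → Set} {L ℓ} → (ℓ ℕ.≤ L → Q ℓ) → Q (suc L) → ℓ ℕ.≤ suc L → Q ℓ
    extend-≤ h q ℓ≤1+L with ℕ.m≤n⇒m<n∨m≡n ℓ≤1+L
    ... | inj₁ (ℕ.s≤s ℓ≤L) = h ℓ≤L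
    ... | inj₂ refl        = q

    -- Tries the lengths downwards from `L`, so that all longer ones are already refuted at the
    -- first success, as `copy` demands.
    longestMatch : ∀ i L →
      (∃[ ℓ ] 1 ℕ.≤ ℓ × ℓ ℕ.≤ L × OccursBefore i ℓ × (∀ ℓ′ → ℓ ℕ.< ℓ′ → ℓ′ ℕ.≤ L → ¬ OccursBefore i ℓ′))
      ⊎ (∀ ℓ → 1 ℕ.≤ ℓ → ℓ ℕ.≤ L → ¬ OccursBefore i ℓ)
    longestMatch i zero = inj₂ λ ℓ 1≤ℓ ℓ≤0 → ⊥-elim (ℕ.<⇒≱ 1≤ℓ ℓ≤0)
    longestMatch i (suc L) with occursBefore? i (suc L)
    ... | yes occ = inj₁ (suc L , ℕ.s≤s ℕ.z≤n , ℕ.≤-refl , occ , λ ℓ′ L<ℓ′ ℓ′≤L → ⊥-elim (ℕ.<⇒≱ L<ℓ′ ℓ′≤L))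
    ... | no ¬occ with longestMatch i L
    ...   | inj₁ (ℓ , 1≤ℓ , ℓ≤L , occ , maximal) = inj₁ (ℓ , 1≤ℓ , ℕ.m≤n⇒m≤1+n ℓ≤L , occ ,
              λ ℓ′ ℓ<ℓ′ → extend-≤ {λ ℓ → ¬ OccursBefore i ℓ} (maximal ℓ′ ℓ<ℓ′) ¬occ)
    ...   | inj₂ none = inj₂ λ ℓ 1≤ℓ → extend-≤ {λ ℓ → ¬ OccursBefore i ℓ} (none ℓ 1≤ℓ) ¬occ

    -- `Solves` speaks only about texts together with a valid output, so the hard texts need a
    -- factorization. Each factor is nonempty, hence the text length is enough fuel.
    factorize : ∀ fuel i → i ℕ.≤ length T → length T ℕ.≤ fuel ℕ.+ i → ∃[ fs ] FactorsFrom i fs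
    factorize fuel i i≤T T≤ with ℕ.m≤n⇒m<n∨m≡n i≤T
    ... | inj₂ refl = [] , done
    factorize zero i i≤T T≤ | inj₁ i<T = ⊥-elim (ℕ.<⇒≱ i<T T≤)
    factorize (suc fuel) i i≤T T≤ | inj₁ i<T with longestMatch i (length T ℕ.∸ i)
    ... | inj₁ (ℓ , 1≤ℓ , ℓ≤ , occ , maximal) =
          let i+ℓ≤T = subst (i ℕ.+ ℓ ℕ.≤_) (ℕ.m+[n∸m]≡n i≤T) (ℕ.+-monoʳ-≤ i ℓ≤)
              fs , fac = factorize fuel (i ℕ.+ ℓ) i+ℓ≤T (ℕ.≤-trans T≤ (suc-+-≤ fuel i 1≤ℓ))
          in fragment i ℓ ∷ fs , copy 1≤ℓ i+ℓ≤T occ (λ ℓ′ ℓ<ℓ′ i+ℓ′≤T → maximal ℓ′ ℓ<ℓ′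
               (ℕ.+-cancelˡ-≤ i ℓ′ (length T ℕ.∸ i) (subst (i ℕ.+ ℓ′ ℕ.≤_) (sym (ℕ.m+[n∸m]≡n i≤T)) i+ℓ′≤T))) fac
    ... | inj₂ none =
          let fs , fac = factorize fuel (i ℕ.+ 1) (ℕ.≤-trans (ℕ.≤-reflexive (ℕ.+-comm i 1)) i<T)
                           (ℕ.≤-trans T≤ (suc-+-≤ fuel i ℕ.≤-refl))
          in fragment i 1 ∷ fs , fresh i<T (none 1 ℕ.≤-refl (ℕ.m<n⇒0<n∸m i<T)) fac

-- The Burrows–Wheeler transform

rotate-↭ : ∀ {n} (f : Fin n → A) → List.tabulate (f ∘ cyclicPred) ↭ List.tabulate f
rotate-↭ {n = zero}  f = ↭-refl
rotate-↭ {n = suc n} f = last-first n f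
  where
  last-first : ∀ n (f : Fin (suc n) → A) → f (Fin.fromℕ n) ∷ List.tabulate (f ∘ Fin.inject₁) ↭ List.tabulate f
  last-first zero    f = ↭-refl
  last-first (suc n) f = ↭-trans (swap _ _ ↭-refl) (prep _ (last-first n (f ∘ suc)))

tabulate-toList : ∀ {n} (v : Vec A n) → List.tabulate (lookup v) ≡ toList v
tabulate-toList []      = refl
tabulate-toList (a ∷ v) = cong (a ∷_) (tabulate-toList v)

-- Sorting permutes the positions, and `cyclicPred` rotates them.
bwt-↭ : ∀ {σ n} (T : Text σ n) → bwt T ↭ toList T
bwt-↭ {n = n} T = ↭-trans (↭.map⁺ _ (Sort.sort-↭ (suffixOrder T) (allFin n)))
  (↭-trans (↭-reflexive (List.map-tabulate id (lookup T ∘ cyclicPred)))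
    (↭-trans (rotate-↭ (lookup T)) (↭-reflexive (tabulate-toList T))))

module _ (_≟_ : DecidableEquality A) where

  private encode = runLengthEncode _≟_

  runLengthDecode : List (A × ℕ) → List A
  runLengthDecode []             = []
  runLengthDecode ((a , k) ∷ rs) = replicate k a ++ runLengthDecode rs

  decode-consRun : ∀ a rs → runLengthDecode (consRun _≟_ a rs) ≡ a ∷ runLengthDecode rs
  decode-consRun a []             = refl
  decode-consRun a ((b , k) ∷ rs) with a ≟ b
  ... | yes refl = refl
  ... | no _     = refl

  decode-encode : ∀ xs → runLengthDecode (encode xs) ≡ xs
  decode-encode []       = refl
  decode-encode (x ∷ xs) = trans (decode-consRun x (encode xs)) (cong (x ∷_) (decode-encode xs))

  length-consRun : ∀ a rs → length (consRun _≟_ a rs) ℕ.≤ suc (length rs)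
  length-consRun a []             = ℕ.≤-refl
  length-consRun a ((b , k) ∷ rs) with a ≟ b
  ... | yes _ = ℕ.n≤1+n _
  ... | no _  = ℕ.≤-refl

  length-encode : ∀ xs → length (encode xs) ℕ.≤ length xs
  length-encode []       = ℕ.z≤n
  length-encode (x ∷ xs) = ℕ.≤-trans (length-consRun x (encode xs)) (ℕ.s≤s (length-encode xs))

  encode-nonempty : ∀ xs → 1 ℕ.≤ length xs → 1 ℕ.≤ length (encode xs)
  encode-nonempty (x ∷ xs) _ with encode xs
  ... | []           = ℕ.≤-refl
  ... | (b , k) ∷ rs with x ≟ b
  ...   | yes _ = ℕ.s≤s ℕ.z≤n
  ...   | no _  = ℕ.s≤s ℕ.z≤n

  consRun-here : ∀ a rs → a ∈ List.map proj₁ (consRun _≟_ a rs)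
  consRun-here a []             = here refl
  consRun-here a ((b , k) ∷ rs) with a ≟ b
  ... | yes refl = here refl
  ... | no _     = here refl

  consRun-there : ∀ {x} a rs → x ∈ List.map proj₁ rs → x ∈ List.map proj₁ (consRun _≟_ a rs)
  consRun-there a ((b , k) ∷ rs) x∈ with a ≟ b
  consRun-there a ((b , k) ∷ rs) (here refl) | yes _ = here refl
  consRun-there a ((b , k) ∷ rs) (there x∈)  | yes _ = there x∈
  ... | no _ = there x∈

  ∈-encode : ∀ {x xs} → x ∈ xs → x ∈ List.map proj₁ (encode xs)
  ∈-encode {xs = y ∷ xs} (here refl) = consRun-here y (encode xs)
  ∈-encode {xs = y ∷ xs} (there x∈)  = consRun-there y (encode xs) (∈-encode x∈)

  -- Each symbol that occurs heads some run, and choosing such a run for each of them is injective.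
  distinct≤length-encode : ∀ {m xs} (f : Fin m → A) → Injective _≡_ _≡_ f → (∀ j → f j ∈ xs) →
    m ℕ.≤ length (encode xs)
  distinct≤length-encode {m} {xs} f f-inj f∈ = subst (m ℕ.≤_) (List.length-map proj₁ (encode xs))
    (Fin.injective⇒≤ λ {i} {j} same → f-inj (trans (Any.lookup-index (f∈′ i))
      (trans (cong (List.lookup (List.map proj₁ (encode xs))) same) (sym (Any.lookup-index (f∈′ j))))))
    where
    f∈′ : ∀ j → f j ∈ List.map proj₁ (encode xs)
    f∈′ j = ∈-encode (f∈ j)

-- A permutation invariant that changes whenever a single symbol is replaced by another one. On
-- texts over 0 and 1 it counts the 1s.
weight : ∀ {σ} → List (Fin σ) → ℕ
weight = sumℕ ∘ List.map toℕ

-- A run of a nonzero symbol pays 2, for itself and for a run of 0s next to it;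
-- only a leading run of 0s remains unpaid.
unpaid : ∀ {σ} → List (Fin σ × ℕ) → ℕ
unpaid []                  = 0
unpaid ((zero  , k) ∷ rs)  = 1
unpaid ((suc _ , k) ∷ rs)  = 0

unpaid≤1 : ∀ {σ} (rs : List (Fin σ × ℕ)) → unpaid rs ℕ.≤ 1
unpaid≤1 []                 = ℕ.z≤n
unpaid≤1 ((zero  , k) ∷ rs) = ℕ.≤-refl
unpaid≤1 ((suc _ , k) ∷ rs) = ℕ.z≤n

unpaid-cong : ∀ {σ j k} (a : Fin σ) rs → unpaid ((a , j) ∷ rs) ≡ unpaid ((a , k) ∷ rs)
unpaid-cong zero    rs = refl
unpaid-cong (suc _) rs = refl

length-encode-weight : ∀ {σ} (xs : List (Fin σ)) (let rs = runLengthEncode Fin._≟_ xs) →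
  length rs ℕ.≤ 2 ℕ.* weight xs ℕ.+ unpaid rs
length-encode-weight []       = ℕ.z≤n
length-encode-weight (x ∷ xs) = step x (runLengthEncode Fin._≟_ xs) (length-encode-weight xs)
  where
  step : ∀ {σ} (x : Fin σ) rs {w} → length rs ℕ.≤ 2 ℕ.* w ℕ.+ unpaid rs →
    length (consRun Fin._≟_ x rs) ℕ.≤ 2 ℕ.* (toℕ x ℕ.+ w) ℕ.+ unpaid (consRun Fin._≟_ x rs)
  step zero    [] h = ℕ.m≤n+m 1 _
  step (suc x) [] {w} h = ℕ.≤-trans (ℕ.s≤s ℕ.z≤n) (ℕ.m≤m+n _ 0)
  step x ((b , k) ∷ rs) {w} h with x Fin.≟ b
  ... | yes refl = ℕ.≤-trans h (ℕ.≤-trans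
        (ℕ.+-monoˡ-≤ _ (ℕ.*-monoʳ-≤ 2 (ℕ.m≤n+m w (toℕ x))))
        (ℕ.≤-reflexive (cong (2 ℕ.* (toℕ x ℕ.+ w) ℕ.+_) (unpaid-cong x rs))))
  step zero ((zero , k) ∷ rs) h | no x≢b = ⊥-elim (x≢b refl)
  step zero ((suc b , k) ∷ rs) {w} h | no _ = ℕ.≤-trans (ℕ.s≤s h)
    (ℕ.≤-reflexive (trans (cong suc (ℕ.+-identityʳ (2 ℕ.* w))) (ℕ.+-comm 1 (2 ℕ.* w))))
  step (suc x) ((b , k) ∷ rs) {w} h | no _ = begin
    suc (suc (length rs))                        ≤⟨ ℕ.s≤s h ⟩
    suc (2 ℕ.* w ℕ.+ unpaid ((b , k) ∷ rs))      ≤⟨ ℕ.s≤s (ℕ.+-monoʳ-≤ (2 ℕ.* w) (unpaid≤1 ((b , k) ∷ rs))) ⟩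
    suc (2 ℕ.* w ℕ.+ 1)                          ≡⟨ ℕ.+-suc (2 ℕ.* w) 1 ⟨
    2 ℕ.* w ℕ.+ 2                                ≡⟨ ℕ.*-distribˡ-+ 2 w 1 ⟨
    2 ℕ.* (w ℕ.+ 1)                              ≤⟨ ℕ.*-monoʳ-≤ 2 (ℕ.≤-trans
      (ℕ.≤-reflexive (ℕ.+-comm w 1)) (ℕ.s≤s (ℕ.m≤n+m w (toℕ x)))) ⟩
    2 ℕ.* (suc (toℕ x) ℕ.+ w)                    ≤⟨ ℕ.m≤m+n _ _ ⟩
    2 ℕ.* (suc (toℕ x) ℕ.+ w) ℕ.+ 0              ∎
    where open ℕ.≤-Reasoning

symbol-position : ∀ {n} (v : Vec A n) p {a} → Symbol (toList v) p a → ∃[ i ] toℕ i ≡ p × lookup v i ≡ a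
symbol-position (a ∷ v) zero    refl = zero , refl , refl
symbol-position (a ∷ v) (suc p) a-at with symbol-position v p a-at
... | i , refl , refl = suc i , refl , refl

-- Hard instances

textWeight : ∀ {σ n} → Text σ n → ℕ
textWeight = weight ∘ toList

FreshFrom : ∀ {σ n} → ℕ → Text σ n → Set
FreshFrom m T = ∀ p p′ → m ℕ.≤ toℕ p → toℕ p′ ℕ.< toℕ p → lookup T p ≢ lookup T p′

-- What the lower bounds require of a problem, so that the same hard texts serve LZ77 and RLBWT.
-- `output-↭` separates neighbours; the other two fields put the star and the cube into their
-- classes.
record IsHard (P : CompressionProblem) : Set where
  open CompressionProblem P
  field
    output-↭ : ∀ {σ n} (T T′ : Text σ n) {o} → IsOutput T o → IsOutput T′ o → toList T ↭ toList T′
    sparse-output : ∀ {σ n} (T : Text (suc σ) (suc n)) → textWeight T ℕ.≤ 1 →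
      ∃[ o ] IsOutput T o × 1 ℕ.≤ size o × size o ℕ.≤ 5
    fresh-output : ∀ {σ m m′} (T : Text σ (m ℕ.+ m′)) → FreshFrom m T →
      ∃[ o ] IsOutput T o × m′ ℕ.≤ size o × size o ℕ.≤ m ℕ.+ m′

sparse-position : ∀ {σ n} (T : Text (suc σ) (suc n)) → textWeight T ℕ.≤ 1 →
  ∃[ i ] ∀ p → p ≢ i → lookup T p ≡ zero
-- An all-zero text ends up here too and gets its last position as the exceptional one.
sparse-position (a ∷ []) _ = zero , λ { zero p≢i → ⊥-elim (p≢i refl) }
sparse-position (zero ∷ T@(_ ∷ _)) T≤1 with sparse-position T T≤1
... | i , zero-off-i = suc i , λ { zero _ → refl ; (suc p) p≢i → zero-off-i p (p≢i ∘ cong suc) }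
sparse-position (suc a ∷ T@(_ ∷ _)) (ℕ.s≤s T≤0) = zero ,
  λ { zero p≢i → ⊥-elim (p≢i refl) ; (suc p) _ → all-zero T (ℕ.≤-trans (ℕ.m≤n+m _ (toℕ a)) T≤0) p }
  where
  all-zero : ∀ {σ n} (T : Text (suc σ) n) → textWeight T ℕ.≤ 0 → ∀ p → lookup T p ≡ zero
  all-zero (zero ∷ T) T≤0 zero    = refl
  all-zero (zero ∷ T) T≤0 (suc p) = all-zero T T≤0 p

LZ77-isHard : IsHard LZ77Problem
LZ77-isHard = record
  { output-↭ = λ T T′ fac fac′ → ↭-reflexive
      (trans (sym (concat-factors (toList T) fac)) (concat-factors (toList T′) fac′))
  ; sparse-output = λ T T≤1 →
      let fs , fac = factors T
          i , zero-off-i = sparse-position T T≤1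
      in fs , fac , nonempty fac , sparse-atMost (toList T) {zero} (toℕ i) (position< T i)
           (λ p p<T p≢i → subst₂ (Symbol (toList T)) (Fin.toℕ-fromℕ< (subst (p ℕ.<_) (Vec.length-toList T) p<T))
             (zero-off-i _ λ p≡i → p≢i (trans (sym (Fin.toℕ-fromℕ< _)) (cong toℕ p≡i)))
             (symbol-lookup T (Fin.fromℕ< (subst (p ℕ.<_) (Vec.length-toList T) p<T))))
           ℕ.z≤n fac
  ; fresh-output = λ {σ} {m} {m′} T T-fresh →
      let fs , fac = factors T
      in fs , fac
       , ℕ.+-cancelʳ-≤ m m′ (length fs) (subst (ℕ._≤ length fs ℕ.+ m) (trans (Vec.length-toList T) (ℕ.+-comm m m′))
           (fresh-atLeast (toList T) m (distinct T T-fresh) fac))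
       , subst₂ ℕ._≤_ (ℕ.+-identityʳ (length fs)) (Vec.length-toList T) (length-factors (toList T) fac)
  }
  where
  factors : ∀ {σ n} (T : Text σ n) → ∃[ fs ] IsLZ77Factorization (toList T) fs
  factors T = factorize (toList T) Fin._≟_ (length (toList T)) 0 ℕ.z≤n (ℕ.m≤m+n _ 0)
  position< : ∀ {σ n} (T : Text σ n) (i : Fin n) → toℕ i ℕ.< length (toList T)
  position< T i = subst (toℕ i ℕ.<_) (sym (Vec.length-toList T)) (Fin.toℕ<n i)
  nonempty : ∀ {σ n} {T : Text σ (suc n)} {fs} → IsLZ77Factorization (toList T) fs → 1 ℕ.≤ length fs
  nonempty {fs = f ∷ fs} fac = ℕ.s≤s ℕ.z≤n
  nonempty {T = a ∷ T} {fs = []} fac with () ← concat-factors (toList (a ∷ T)) fac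
  distinct : ∀ {σ n m} (T : Text σ n) → FreshFrom m T →
    ∀ p p′ {a a′} → m ℕ.≤ p → p′ ℕ.< p → Symbol (toList T) p a → Symbol (toList T) p′ a′ → a ≢ a′
  distinct T T-fresh p p′ m≤p p′<p a-at a′-at
    with symbol-position T p a-at | symbol-position T p′ a′-at
  ... | i , refl , refl | i′ , refl , refl = T-fresh i i′ m≤p p′<p

RLBWT-isHard : IsHard RLBWTProblem
RLBWT-isHard = record
  { output-↭ = λ T T′ {o} eq eq′ → ↭-trans (↭-sym (bwt-↭ T)) (↭-trans (↭-reflexive
      (trans (sym (decode-encode Fin._≟_ (bwt T)))
        (trans (cong (runLengthDecode Fin._≟_) (trans eq (sym eq′))) (decode-encode Fin._≟_ (bwt T′)))))
      (bwt-↭ T′))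
  ; sparse-output = λ T T≤1 → rlbwt T , refl
      , encode-nonempty Fin._≟_ (bwt T) (subst (1 ℕ.≤_) (sym (length-bwt T)) (ℕ.s≤s ℕ.z≤n))
      , (begin
          length (rlbwt T)                       ≤⟨ length-encode-weight (bwt T) ⟩
          2 ℕ.* weight (bwt T) ℕ.+ unpaid (rlbwt T)
            ≤⟨ ℕ.+-mono-≤ (ℕ.*-monoʳ-≤ 2 (subst (ℕ._≤ 1) (sym (sum-↭ (↭.map⁺ toℕ (bwt-↭ T)))) T≤1))
                          (unpaid≤1 (rlbwt T)) ⟩
          -- The RLBWT bound is 2 · 1 + 1; the 5 is the bound that the LZ77 factors need.
          3                                      ≤⟨ ℕ.m≤m+n 3 2 ⟩
          5                                      ∎)
  ; fresh-output = λ {σ} {m} {m′} T T-fresh → rlbwt T , refl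
      , distinct≤length-encode Fin._≟_ (λ j → lookup T (m Fin.↑ʳ j)) (fresh-injective T T-fresh)
          (λ j → ↭.∈-resp-↭ (↭-sym (bwt-↭ T)) (∈-lookup T (m Fin.↑ʳ j)))
      , subst (length (rlbwt T) ℕ.≤_) (length-bwt T) (length-encode Fin._≟_ (bwt T))
  }
  where
  open ℕ.≤-Reasoning
  length-bwt : ∀ {σ n} (T : Text σ n) → length (bwt T) ≡ n
  length-bwt T = trans (↭.↭-length (bwt-↭ T)) (Vec.length-toList T)
  ∈-lookup : ∀ {n} (v : Vec A n) i → lookup v i ∈ toList v
  ∈-lookup (a ∷ v) zero    = here refl
  ∈-lookup (a ∷ v) (suc i) = there (∈-lookup v i)
  m≤m↑ʳ : ∀ m {m′} (j : Fin m′) → m ℕ.≤ toℕ (m Fin.↑ʳ j)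
  m≤m↑ʳ m j = subst (m ℕ.≤_) (sym (Fin.toℕ-↑ʳ m j)) (ℕ.m≤m+n m _)
  fresh-injective : ∀ {σ m m′} (T : Text σ (m ℕ.+ m′)) → FreshFrom m T →
    Injective _≡_ _≡_ (λ j → lookup T (m Fin.↑ʳ j))
  fresh-injective {m = m} T T-fresh {i} {j} same with Fin.<-cmp (m Fin.↑ʳ i) (m Fin.↑ʳ j)
  ... | tri< i<j _ _ = ⊥-elim (T-fresh (m Fin.↑ʳ j) (m Fin.↑ʳ i) (m≤m↑ʳ m j) i<j (sym same))
  ... | tri≈ _ i≡j _ = Fin.↑ʳ-injective m i j i≡j
  ... | tri> _ _ j<i = ⊥-elim (T-fresh (m Fin.↑ʳ i) (m Fin.↑ʳ j) (m≤m↑ʳ m i) j<i same)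

textWeight-update : ∀ {σ n} (T : Text σ n) i c →
  textWeight (T [ i ]≔ c) ℕ.+ toℕ (lookup T i) ≡ toℕ c ℕ.+ textWeight T
textWeight-update (a ∷ T) zero    c =
  solveℕ 3 (λ a c t → (c ⊕ t) ⊕ a ⊜ c ⊕ (a ⊕ t)) refl (toℕ a) (toℕ c) (textWeight T)
textWeight-update (a ∷ T) (suc i) c = trans (ℕ.+-assoc (toℕ a) _ _) (trans
  (cong (toℕ a ℕ.+_) (textWeight-update T i c))
  (solveℕ 3 (λ a c t → a ⊕ (c ⊕ t) ⊜ c ⊕ (a ⊕ t)) refl (toℕ a) (toℕ c) (textWeight T)))

textWeight-zeros : ∀ {σ} n → textWeight (Vec.replicate n (zero {σ})) ≡ 0
textWeight-zeros zero    = refl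
textWeight-zeros (suc n) = textWeight-zeros n

toℕ-reduce≥ : ∀ m {n} (p : Fin (m ℕ.+ n)) (m≤p : m ℕ.≤ toℕ p) → m ℕ.+ toℕ (Fin.reduce≥ p m≤p) ≡ toℕ p
toℕ-reduce≥ zero    p       _   = refl
toℕ-reduce≥ (suc m) (suc p) m≤p = cong suc (toℕ-reduce≥ m p (ℕ.s≤s⁻¹ m≤p))

-- The fresh symbol at position `p` is the number `p` itself, which requires the alphabet to contain
-- all positions; `2 ≤ m` keeps these symbols apart from the bits 0 and 1.
module CubeText {σ m m′ : ℕ} (n≤σ : m ℕ.+ m′ ℕ.≤ suc (suc σ)) (2≤m : 2 ℕ.≤ m) where

  bit : Bool → Fin (suc (suc σ))
  bit false = zero
  bit true  = suc zero

  bit≤1 : ∀ b → toℕ (bit b) ℕ.≤ 1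
  bit≤1 false = ℕ.z≤n
  bit≤1 true  = ℕ.≤-refl

  bit-not : ∀ b → bit (not b) ≢ bit b
  bit-not true  ()
  bit-not false ()

  freshSymbol : Fin m′ → Fin (suc (suc σ))
  freshSymbol j = Fin.fromℕ< (ℕ.<-≤-trans (ℕ.+-monoʳ-< m (Fin.toℕ<n j)) n≤σ)

  cubeText : Vec Bool m → Text (suc (suc σ)) (m ℕ.+ m′)
  cubeText v = Vec.map bit v Vec.++ Vec.tabulate freshSymbol

  -- Turns a step along the cube into the single-symbol update that `distinguishes` handles.
  cubeText-flip : ∀ v j → cubeText (Vec.updateAt v j not) ≡ cubeText v [ j Fin.↑ˡ m′ ]≔ bit (not (lookup v j))
  cubeText-flip v j = trans (cong (Vec._++ Vec.tabulate freshSymbol) (Vec.map-updateAt v j refl))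
    (sym (Vec.[]≔-++-↑ˡ (Vec.map bit v) (Vec.tabulate freshSymbol) j))

  cubeText-bit : ∀ v j → lookup (cubeText v) (j Fin.↑ˡ m′) ≡ bit (lookup v j)
  cubeText-bit v j = trans (Vec.lookup-++ˡ (Vec.map bit v) _ j) (Vec.lookup-map j bit v)

  cubeText-< : ∀ v p → toℕ p ℕ.< m → toℕ (lookup (cubeText v) p) ℕ.≤ 1
  cubeText-< v p p<m = subst (λ a → toℕ a ℕ.≤ 1)
    (sym (trans (Vec.lookup-++-< (Vec.map bit v) _ p p<m) (Vec.lookup-map (Fin.fromℕ< p<m) bit v)))
    (bit≤1 (lookup v (Fin.fromℕ< p<m)))

  cubeText-≥ : ∀ v p → m ℕ.≤ toℕ p → toℕ (lookup (cubeText v) p) ≡ toℕ p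
  cubeText-≥ v p m≤p = begin
    toℕ (lookup (cubeText v) p)
      ≡⟨ cong toℕ (trans (Vec.lookup-++-≥ (Vec.map bit v) _ p m≤p)
           (Vec.lookup∘tabulate freshSymbol (Fin.reduce≥ p m≤p))) ⟩
    toℕ (freshSymbol (Fin.reduce≥ p m≤p))
      ≡⟨ Fin.toℕ-fromℕ< _ ⟩
    m ℕ.+ toℕ (Fin.reduce≥ p m≤p)
      ≡⟨ toℕ-reduce≥ m p m≤p ⟩
    toℕ p ∎
    where open ≡-Reasoning

  cubeText-fresh : ∀ v → FreshFrom m (cubeText v)
  cubeText-fresh v p p′ m≤p p′<p same with m ℕ.≤? toℕ p′
  ... | yes m≤p′ = ℕ.<-irrefl (trans (sym (cubeText-≥ v p′ m≤p′))
      (trans (cong toℕ (sym same)) (cubeText-≥ v p m≤p))) p′<p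
  ... | no  m≰p′ = ℕ.<⇒≱ (ℕ.≤-trans 2≤m m≤p) (subst (ℕ._≤ 1) (trans (cong toℕ (sym same)) (cubeText-≥ v p m≤p))
      (cubeText-< v p′ (ℕ.≰⇒> m≰p′)))

-- `m ≤ m′` makes the fresh tail at least half of the text, so that the size is linear; `m′ ≤ suc m`
-- leaves enough bits, with n ≤ 3m once m ≥ 1.
half : ∀ n → ∃[ m ] ∃[ m′ ] n ≡ m ℕ.+ m′ × m ℕ.≤ m′ × m′ ℕ.≤ suc m
half zero          = 0 , 0 , refl , ℕ.z≤n , ℕ.z≤n
half (suc zero)    = 0 , 1 , refl , ℕ.z≤n , ℕ.≤-refl
half (suc (suc n)) with half n
... | m , m′ , refl , m≤m′ , m′≤1+m = suc m , suc m′ , cong suc (sym (ℕ.+-suc m m′)) , ℕ.s≤s m≤m′ , ℕ.s≤s m′≤1+m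

-- Lower bounds for every problem with hard instances

module _ (P : CompressionProblem) (P-hard : IsHard P) where

  open CompressionProblem P
  open IsHard P-hard

  HasOutput : ∀ {σ n} → (ℕ → Set) → Text σ n → Set
  HasOutput InClass T = ∃[ o ] IsOutput T o × InClass (size o)

  -- A common output would make the two texts permutations of each other and so of equal
  -- `textWeight`, but replacing one symbol by another changes it.
  distinguishes : ∀ {σ n q} InClass (A : QueryAlgorithm σ n q (Output σ)) → Solves P A InClass →
    ∀ x i c → c ≢ lookup x i → HasOutput InClass x → HasOutput InClass (x [ i ]≔ c) →
    Distinguishes _≟ᴼ_ A x (x [ i ]≔ c) i
  distinguishes InClass A A-solves x i c c≢xᵢ (o , x-o , o-in) (o′ , y-o′ , o′-in) =
      mkDistinguishes _≟ᴼ_ A {x} {y} {i} {o} {o′} (λ j j≢i → sym (Vec.lookup∘update′ j≢i x c)) o≢o′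
        (A-solves x o x-o o-in) (A-solves y o′ y-o′ o′-in)
    where
    y = x [ i ]≔ c
    o≢o′ : o ≢ o′
    o≢o′ refl = c≢xᵢ (Fin.toℕ-injective (ℕ.+-cancelʳ-≡ (textWeight x) (toℕ c) (toℕ (lookup x i)) (begin
      toℕ c ℕ.+ textWeight x               ≡⟨ textWeight-update x i c ⟨
      textWeight y ℕ.+ toℕ (lookup x i)    ≡⟨ cong (ℕ._+ toℕ (lookup x i)) (sum-↭ (↭.map⁺ toℕ (output-↭ y x y-o′ x-o))) ⟩
      textWeight x ℕ.+ toℕ (lookup x i)    ≡⟨ ℕ.+-comm (textWeight x) _ ⟩
      toℕ (lookup x i) ℕ.+ textWeight x    ∎)))
      where open ≡-Reasoning

  requires-constant : RequiresΩ√ P (const 1)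
  -- Sparse texts have size between 1 and 5, which fixes the least constants 1 and 5. The factor `b`
  -- bounds z, and 1296 q² bounds n.
  requires-constant = 1 , 5 , λ a b 1≤a 5≤b → b ℕ.* 1296 , 1 , λ
    { (suc n) (suc (suc σ)) q _ _ _ A A-solves z (_ , z≤b) → begin
        z ℕ.* suc n                        ≤⟨ ℕ.*-mono-≤ (ℕ.≤-trans z≤b (ℕ.≤-reflexive (ℕ.*-identityʳ b)))
                                                            (bound 1≤a 5≤b A A-solves) ⟩
        b ℕ.* (1296 ℕ.* (q ℕ.* q))         ≡⟨ ℕ.*-assoc b 1296 (q ℕ.* q) ⟨
        b ℕ.* 1296 ℕ.* (q ℕ.* q)           ∎
    ; (suc n) (suc zero) q _ (ℕ.s≤s ()) }
    where
    open ℕ.≤-Reasoning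
    bound : ∀ {a b n σ q} → 1 ℕ.≤ a → 5 ℕ.≤ b → (A : QueryAlgorithm (suc (suc σ)) (suc n) q (Output _)) →
      Solves P A (Θ[ a , b ] 1) → suc n ℕ.≤ 1296 ℕ.* (q ℕ.* q)
    bound {a} {b} {n} {σ} 1≤a 5≤b A A-solves = search-bound _≟ᴼ_ A zeros (λ i → zeros [ i ]≔ suc zero) λ i →
      distinguishes (Θ[ a , b ] 1) A A-solves zeros i (suc zero)
        (λ 1≡0 → 0≢1 (trans (sym (Vec.lookup-replicate i zero)) (sym 1≡0)))
        (output zeros (ℕ.≤-trans (ℕ.≤-reflexive (textWeight-zeros (suc n))) ℕ.z≤n))
        (output (zeros [ i ]≔ suc zero) (ℕ.≤-trans (ℕ.m≤m+n _ (toℕ (lookup zeros i)))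
          (ℕ.≤-reflexive (trans (textWeight-update zeros i (suc zero)) (cong suc (textWeight-zeros (suc n)))))))
      where
      zeros : Text (suc (suc σ)) (suc n)
      zeros = Vec.replicate (suc n) zero
      0≢1 : zero ≢ suc {suc σ} zero
      0≢1 ()
      output : ∀ (T : Text (suc (suc σ)) (suc n)) → textWeight T ℕ.≤ 1 → HasOutput (Θ[ a , b ] 1) T
      output T T≤1 =
        let o , T-o , 1≤o , o≤5 = sparse-output T T≤1
        in o , T-o , ℕ.*-mono-≤ 1≤a 1≤o , ℕ.≤-trans o≤5 (ℕ.≤-trans 5≤b (ℕ.≤-reflexive (sym (ℕ.*-identityʳ b))))

  requires-linear : RequiresΩ√ P id
  -- The 2 reflects a size of at least n/2, and n ≥ 4 forces at least two bits. The bound n ≤ 108 q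
  -- is used twice, and 11664 is 108².
  requires-linear = 2 , 1 , λ a b 2≤a 1≤b → b ℕ.* 11664 , 4 , λ n σ q 4≤n 2≤σ n≤σ A A-solves z (_ , z≤bn) →
    let m , m′ , n≡m+m′ , m≤m′ , m′≤1+m = half n
        n≤108q = bound n≡m+m′ m≤m′ m′≤1+m 2≤a 1≤b 4≤n 2≤σ n≤σ A A-solves in begin
      z ℕ.* n                                  ≤⟨ ℕ.*-mono-≤ z≤bn n≤108q ⟩
      b ℕ.* n ℕ.* (108 ℕ.* q)                  ≤⟨ ℕ.*-monoˡ-≤ (108 ℕ.* q) (ℕ.*-monoʳ-≤ b n≤108q) ⟩
      b ℕ.* (108 ℕ.* q) ℕ.* (108 ℕ.* q)
        ≡⟨ solveℕ 2 (λ b q → b ⊗ (lit 108 ⊗ q) ⊗ (lit 108 ⊗ q) ⊜ b ⊗ lit 11664 ⊗ (q ⊗ q)) refl b q ⟩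
      b ℕ.* 11664 ℕ.* (q ℕ.* q)                ∎
    where
    open ℕ.≤-Reasoning
    bound : ∀ {a b σ q n m m′} → n ≡ m ℕ.+ m′ → m ℕ.≤ m′ → m′ ℕ.≤ suc m →
      2 ℕ.≤ a → 1 ℕ.≤ b → 4 ℕ.≤ n → 2 ℕ.≤ σ → n ℕ.≤ σ →
      (A : QueryAlgorithm σ n q (Output σ)) → Solves P A (Θ[ a , b ] n) → n ℕ.≤ 108 ℕ.* q
    bound {a} {b} {suc (suc σ)} {q} {_} {m} {m′} refl m≤m′ m′≤1+m 2≤a 1≤b 4≤n (ℕ.s≤s (ℕ.s≤s _)) n≤σ A A-solves = begin
      -- Here 108 arises as 3 · 36: m′ ≤ m + 1 ≤ 2m gives n ≤ 3m, and `cube-bound` gives m ≤ 36 q.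
      m ℕ.+ m′                 ≤⟨ ℕ.+-monoʳ-≤ m (ℕ.≤-trans m′≤1+m (ℕ.+-monoˡ-≤ m (ℕ.≤-trans (ℕ.s≤s ℕ.z≤n) 2≤m))) ⟩
      m ℕ.+ (m ℕ.+ m)          ≡⟨ solveℕ 1 (λ m → m ⊕ (m ⊕ m) ⊜ lit 3 ⊗ m) refl m ⟩
      3 ℕ.* m                  ≤⟨ ℕ.*-monoʳ-≤ 3 (cube-bound _≟ᴼ_ A cubeText edge) ⟩
      3 ℕ.* (36 ℕ.* q)         ≡⟨ ℕ.*-assoc 3 36 q ⟨
      108 ℕ.* q                ∎
      where
      2≤m : 2 ℕ.≤ m
      2≤m = ℕ.≮⇒≥ λ m<2 → ℕ.<⇒≱ (ℕ.s≤s (ℕ.+-mono-≤ (ℕ.≤-pred m<2) (ℕ.≤-trans m′≤1+m m<2))) 4≤n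
      open CubeText n≤σ 2≤m
      output : ∀ v → HasOutput (Θ[ a , b ] (m ℕ.+ m′)) (cubeText v)
      output v =
        let o , T-o , m′≤o , o≤n = fresh-output (cubeText v) (cubeText-fresh v)
        in o , T-o
        , (begin
            m ℕ.+ m′               ≤⟨ ℕ.+-monoˡ-≤ m′ m≤m′ ⟩
            m′ ℕ.+ m′              ≡⟨ solveℕ 1 (λ m → m ⊕ m ⊜ lit 2 ⊗ m) refl m′ ⟩
            2 ℕ.* m′               ≤⟨ ℕ.*-mono-≤ 2≤a m′≤o ⟩
            a ℕ.* size o           ∎)
        , ℕ.≤-trans o≤n (ℕ.≤-trans (ℕ.≤-reflexive (sym (ℕ.*-identityˡ (m ℕ.+ m′)))) (ℕ.*-monoˡ-≤ (m ℕ.+ m′) 1≤b))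
      edge : ∀ v j → Distinguishes _≟ᴼ_ A (cubeText v) (cubeText (Vec.updateAt v j not)) (j Fin.↑ˡ m′)
      edge v j = subst (λ T → Distinguishes _≟ᴼ_ A (cubeText v) T (j Fin.↑ˡ m′)) (sym (cubeText-flip v j))
        (distinguishes (Θ[ a , b ] (m ℕ.+ m′)) A A-solves (cubeText v) (j Fin.↑ˡ m′) (bit (not (lookup v j)))
          (λ same → bit-not (lookup v j) (trans same (cubeText-bit v j)))
          (output v) (subst (HasOutput (Θ[ a , b ] (m ℕ.+ m′))) (cubeText-flip v j) (output (Vec.updateAt v j not))))

theorem4 : (RequiresΩ√ LZ77Problem (const 1) × RequiresΩ√ LZ77Problem id)
         × (RequiresΩ√ RLBWTProblem (const 1) × RequiresΩ√ RLBWTProblem id)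
theorem4 = (requires-constant LZ77Problem LZ77-isHard , requires-linear LZ77Problem LZ77-isHard)
         , (requires-constant RLBWTProblem RLBWT-isHard , requires-linear RLBWTProblem RLBWT-isHard)
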